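{- Let $F_{4,2}$ be the $3$-graph on $\{1,\dots,6\}$ with edges $\{123,124,134,156,256,356,456\}$ and let $F_{3,3}$ be the $3$-graph on $\{1,\dots,6\}$ with edges $\{123\}\cup\{xyz : x\in\{1,2,3\},\ \{y,z\}\subseteq\{4,5,6\}\}$. Then \[\pi(F_{4,2}) \leq 0.4933327,\qquad \gamma(F_{4,2}) \leq 0.4185,\qquad \gamma^+(F_{3,3}) \leq 0.616.\]
   Context: For a $3$-graph $F$: $\mathrm{ex}(n,F)$ is the maximum number of edges of an $n$-vertex $F$-free $3$-graph and $\pi(F)=\lim_{n\to\infty}\mathrm{ex}(n,F)/\binom{n}{3}$ (Turán density). The minimum co-degree $\delta_2(H)$ of a $3$-graph $H$ is the minimum over all pairs of vertices of the number of edges containing the pair; $\mathrm{coex}(n,F)$ is the maximum of $\delta_2(H)$ over $n$-vertex $F$-free $3$-graphs and $\gamma(F)=\lim_{n\to\infty}\mathrm{coex}(n,F)/n$. The minimum positive co-degree $\delta_2^+(H)$ is the largest $k$ such that every pair contained in some edge is contained in at least $k$ edges ($0$ for the edgeless graph); $\mathrm{co^+ex}(n,F)$ is the maximum of $\delta_2^+(H)$ over $n$-vertex $F$-free $3$-graphs and $\gamma^+(F)=\lim_{n\to\infty}\mathrm{co^+ex}(n,F)/n$. Here $F$-free means containing no (not necessarily induced) copy of $F$; all these limits exist. -}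

module Defs where

open import Data.Nat using (ℕ; zero; suc; _+_; _*_; _≤_; _<ᵇ_; _⊓_)
open import Data.Nat.Combinatorics using (_C_)
open import Data.Bool using (Bool; true; false; if_then_else_; _∧_)
open import Data.Fin using (Fin; toℕ)
open import Data.Maybe using (Maybe; just; nothing; fromMaybe)
open import Data.List using (List; []; _∷_)
open import Data.List.Relation.Unary.All using (All)
open import Data.Product using (_×_; _,_; Σ)
open import Function.Definitions using (Injective)
open import Relation.Binary.PropositionalEquality using (_≡_)
open import Relation.Nullary using (¬_)

-- A 3-graph on vertex set Fin n: a Boolean edge indicator on ordered triples
-- that is symmetric under all permutations and false whenever two entries
-- coincide (so edges are exactly 3-element subsets).
record ThreeGraph (n : ℕ) : Set where
  field
    edge    : Fin n → Fin n → Fin n → Bool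
    sym₁₂   : ∀ a b c → edge a b c ≡ edge b a c
    sym₂₃   : ∀ a b c → edge a b c ≡ edge a c b
    irrefl  : ∀ a c → edge a a c ≡ false
open ThreeGraph public

count : ∀ {n} → (Fin n → Bool) → ℕ
count {zero}  p = 0
count {suc n} p = (if p Fin.zero then 1 else 0) + count (λ i → p (Fin.suc i))

sumFin : ∀ {n} → (Fin n → ℕ) → ℕ
sumFin {zero}  f = 0
sumFin {suc n} f = f Fin.zero + sumFin (λ i → f (Fin.suc i))

_<F_ : ∀ {n} → Fin n → Fin n → Bool
i <F j = toℕ i <ᵇ toℕ j

numEdges : ∀ {n} → ThreeGraph n → ℕ
numEdges H = sumFin λ i → sumFin λ j →
  count λ k → (i <F j) ∧ (j <F k) ∧ edge H i j k

codeg : ∀ {n} → ThreeGraph n → Fin n → Fin n → ℕ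
codeg H i j = count (edge H i j)

minM : Maybe ℕ → Maybe ℕ → Maybe ℕ
minM nothing  y        = y
minM (just x) nothing  = just x
minM (just x) (just y) = just (x ⊓ y)

minFin : ∀ {n} → (Fin n → Maybe ℕ) → Maybe ℕ
minFin {zero}  f = nothing
minFin {suc n} f = minM (f Fin.zero) (minFin (λ i → f (Fin.suc i)))

-- minimum co-degree δ₂(H): minimum over pairs i < j of codeg
-- (conventionally 0 if n < 2; irrelevant for large n)
δ₂ : ∀ {n} → ThreeGraph n → ℕ
δ₂ H = fromMaybe 0 (minFin λ i → minFin λ j →
  if i <F j then just (codeg H i j) else nothing)

-- minimum positive co-degree δ₂⁺(H): minimum over pairs i < j with positive
-- codeg (i.e. contained in some edge); 0 if H has no edges
δ₂⁺ : ∀ {n} → ThreeGraph n → ℕ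
δ₂⁺ H = fromMaybe 0 (minFin λ i → minFin λ j →
  if i <F j ∧ (0 <ᵇ codeg H i j) then just (codeg H i j) else nothing)

-- A (small) 3-graph given by its list of edges (triples of vertices)
Triple : ℕ → Set
Triple m = Fin m × Fin m × Fin m

Contains : ∀ {m n} → List (Triple m) → ThreeGraph n → Set
Contains {m} {n} F H = Σ (Fin m → Fin n) λ φ → Injective _≡_ _≡_ φ ×
  All (λ { (a , b , c) → edge H (φ a) (φ b) (φ c) ≡ true }) F

Free : ∀ {m n} → List (Triple m) → ThreeGraph n → Set
Free F H = ¬ Contains F H

v1 v2 v3 v4 v5 v6 : Fin 6
v1 = Fin.zero
v2 = Fin.suc Fin.zero
v3 = Fin.suc (Fin.suc Fin.zero)
v4 = Fin.suc (Fin.suc (Fin.suc Fin.zero))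
v5 = Fin.suc (Fin.suc (Fin.suc (Fin.suc Fin.zero)))
v6 = Fin.suc (Fin.suc (Fin.suc (Fin.suc (Fin.suc Fin.zero))))

F42 : List (Triple 6)
F42 = (v1 , v2 , v3) ∷ (v1 , v2 , v4) ∷ (v1 , v3 , v4) ∷ (v1 , v5 , v6) ∷
      (v2 , v5 , v6) ∷ (v3 , v5 , v6) ∷ (v4 , v5 , v6) ∷ []

F33 : List (Triple 6)
F33 = (v1 , v2 , v3) ∷
      (v1 , v4 , v5) ∷ (v1 , v4 , v6) ∷ (v1 , v5 , v6) ∷
      (v2 , v4 , v5) ∷ (v2 , v4 , v6) ∷ (v2 , v5 , v6) ∷
      (v3 , v4 , v5) ∷ (v3 , v4 , v6) ∷ (v3 , v5 , v6) ∷ []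

-- π(F) ≤ p/q  (limit exists, so this is: for every ε = 1/(m+1) > 0, eventually
-- ex(n,F) ≤ (p/q + ε) C(n,3)), cross-multiplied in ℕ.
TuranDensity≤ : ∀ {k} → List (Triple k) → ℕ → ℕ → Set
TuranDensity≤ F p q = ∀ (m : ℕ) → Σ ℕ λ N → ∀ n → N ≤ n → (H : ThreeGraph n) →
  Free F H → numEdges H * q * suc m ≤ (p * suc m + q) * (n C 3)

CodegreeDensity≤ : ∀ {k} → List (Triple k) → ℕ → ℕ → Set
CodegreeDensity≤ F p q = ∀ (m : ℕ) → Σ ℕ λ N → ∀ n → N ≤ n → (H : ThreeGraph n) →
  Free F H → δ₂ H * q * suc m ≤ (p * suc m + q) * n

PosCodegreeDensity≤ : ∀ {k} → List (Triple k) → ℕ → ℕ → Set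
PosCodegreeDensity≤ F p q = ∀ (m : ℕ) → Σ ℕ λ N → ∀ n → N ≤ n → (H : ThreeGraph n) →
  Free F H → δ₂⁺ H * q * suc m ≤ (p * suc m + q) * n

{-# OPTIONS --safe #-}

-- Flag algebras on six vertices. In F₄,₂ and F₃,₃ every pair of vertices is covered by an edge, so
-- the 3-graph G(x) induced on a 6-tuple x of vertices of an F-free 3-graph H, repetitions allowed, is
-- F-free. If W is a function of labelled 3-graphs on six vertices, invariant under relabelling, with
-- W(G) ≤ 0 whenever G is F-free, then ∑ W(G(x)) ≤ 0 over all tuples, without error terms. Each W is
-- a sum of
--   * squares of combinations of flags with 4, 2 or 0 roots, whose sum over tuples is nonnegative;
--   * a multiplier, whose sum over tuples is (almost) nonnegative by the hypothesis on H;
--   * the quantity to be bounded.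
-- For codegrees the multiplier is g(x₁,…,x₅)(e(x₁x₂x₆) − δ) with g ≥ 0: only the negligible tuples
-- with x₁ = x₂ can contribute negatively. For positive codegrees g is supported on the 3-graphs in
-- which some edge on x₁,…,x₅ contains x₁x₂, and W contains a positive multiple of e(x₁x₂x₃), so a
-- single edge of H gives a contradiction.
--
-- For π(F₄,₂) squares alone reach only 0.49333278; the obstruction is a balanced blow-up of K₅⁽³⁾
-- whose parts have density 1/3. But in an F₄,₂-free 3-graph the link N(b,c) of a pair contains no K₄⁻
-- (three edges on four vertices), and K₄⁻-free 3-graphs have density at most 0.315 by the same method.
-- The multiplier is therefore 0.315 − e(xyz) over edges abc and x, y, z in N(b,c) ∖ (N(a,b) ∪ N(a,c)).

module Submission where

open import Defs
open import Data.Bool using (Bool; true; false; if_then_else_; _∧_; _∨_; not; T)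
open import Data.Bool.ListAction using (all; any)
import Data.Bool.Properties as Bool
open import Data.Char using (Char)
import Data.Char as Char
open import Data.Empty using (⊥; ⊥-elim)
open import Data.Fin using (Fin; zero; suc; toℕ)
import Data.Fin.Properties as Fin
open import Data.Integer using (∣_∣; ℤ; +_; -[1+_]; _+_; _*_; _-_; -_; 0ℤ; 1ℤ; _≤_; +≤+; -≤+)
import Data.Integer as ℤ
open import Data.Integer.Properties
open import Data.Integer.Tactic.RingSolver using (solve-∀)
open import Data.List using (List; []; _∷_; _++_; map; concatMap; length; take; drop; replicate; upTo; filterᵇ; foldr; zip; zipWith)
import Data.List.Properties as List
open import Data.List.Membership.DecPropositional using (_∈?_)
open import Data.List.Membership.Propositional using (_∈_)
open import Data.List.Relation.Binary.Permutation.Propositional using (_↭_; ↭-sym; ↭-trans; ↭-reflexive; refl; prep; swap; trans)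
open import Data.List.Relation.Unary.All as All using (All; []; _∷_)
open import Data.List.Relation.Unary.Any using (Any; here; there; any?)
open import Data.List.Sort.MergeSort.Base using (sort)
open import Data.List.Sort.MergeSort.Properties using (sort-↭)
open import Data.Maybe using (Maybe; just; nothing; maybe; fromMaybe)
open import Data.Nat using (ℕ; zero; suc; _^_; _≡ᵇ_; NonZero)
import Data.Nat as ℕ
open import Data.Nat.Combinatorics using (_C_; nCk+nC[k+1]≡[n+1]C[k+1]; nC1≡n)
open import Data.Nat.Induction using (<-wellFounded)
import Data.Nat.Properties as ℕ
import Data.Nat.Tactic.RingSolver as ℕ-solver
open import Data.Product using (_×_; _,_; proj₁; proj₂; ∃)
open import Data.Product.Properties using (≡-dec)
open import Data.String using (String; toList)
open import Data.Sum using (_⊎_; inj₁; inj₂; map₂; [_,_]′)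
open import Data.Vec as Vec using (Vec; []; _∷_; lookup; allFin)
import Data.Vec.Properties as Vec
open import Function using (_∘_; id)
open import Induction.WellFounded using (Acc; acc)
open import Relation.Binary.Construct.On using (decTotalOrder)
open import Relation.Binary.Definitions using (tri<; tri≈; tri>)
open import Relation.Binary.PropositionalEquality as ≡ hiding (trans)
open import Relation.Nullary using (Dec; yes; no; ¬_; does)
open import Relation.Nullary.Decidable using (from-yes; _⊎-dec_; isYes)

-- A square enters through the integer coefficients of what is squared, and `square₄-nonneg`,
-- `square₂-nonneg` and `square₀-nonneg` hold for arbitrary columns. So rounding a numerical
-- solution cannot spoil positivity, no semidefiniteness is ever tested, and only the inequalities
-- W(G) ≤ 0 remain. These concern 2^20 labelled 3-graphs, each with 720 relabellings, and are
-- decided by evaluation inside the type checker, which shapes everything up to `certified`. Since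
-- the symmetrised W is invariant, a 3-graph is skipped when some relabelling lowers its code, often
-- on the evidence of its first ten bits alone. Each kernel is summed once over the stabiliser of
-- its shape, as a table in its own queries, which leaves only coset representatives to be visited
-- for each 3-graph. Queries are resolved to fixed bit positions in advance.

private variable
  X Y : Set
  k n : ℕ

+-congʳ : ∀ a {b c} → b ≡ c → a + b ≡ a + c
+-congʳ a refl = refl

-- Sums over tuples

∑ : (Fin n → ℤ) → ℤ
∑ {zero}  f = 0ℤ
∑ {suc n} f = f zero + ∑ (f ∘ suc)

∑-cong : {f g : Fin n → ℤ} → (∀ i → f i ≡ g i) → ∑ f ≡ ∑ g
∑-cong {zero}  h = refl
∑-cong {suc n} h = cong₂ _+_ (h zero) (∑-cong (h ∘ suc))

∑-mono : {f g : Fin n → ℤ} → (∀ i → f i ≤ g i) → ∑ f ≤ ∑ g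
∑-mono {zero}  h = ≤-refl
∑-mono {suc n} h = +-mono-≤ (h zero) (∑-mono (h ∘ suc))

∑-zero : ∀ n → ∑ {n} (λ _ → 0ℤ) ≡ 0ℤ
∑-zero zero    = refl
∑-zero (suc n) = ≡.trans (+-identityˡ _) (∑-zero n)

∑-nonneg : {f : Fin n → ℤ} → (∀ i → 0ℤ ≤ f i) → 0ℤ ≤ ∑ f
∑-nonneg {n} {f} h = subst (_≤ ∑ f) (∑-zero n) (∑-mono h)

+-interchange : ∀ a b c d → (a + b) + (c + d) ≡ (a + c) + (b + d)
+-interchange = solve-∀

+-exch : ∀ a b c → a + (b + c) ≡ b + (a + c)
+-exch = solve-∀

∑-+ : (f g : Fin n → ℤ) → ∑ (λ i → f i + g i) ≡ ∑ f + ∑ g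
∑-+ {zero}  f g = refl
∑-+ {suc n} f g = ≡.trans (+-congʳ (f zero + g zero) (∑-+ (f ∘ suc) (g ∘ suc)))
  (+-interchange (f zero) (g zero) (∑ (f ∘ suc)) (∑ (g ∘ suc)))

∑-*ˡ : ∀ c (f : Fin n → ℤ) → ∑ (λ i → c * f i) ≡ c * ∑ f
∑-*ˡ {zero}  c f = sym (*-zeroʳ c)
∑-*ˡ {suc n} c f = ≡.trans (+-congʳ (c * f zero) (∑-*ˡ c (f ∘ suc)))
  (sym (*-distribˡ-+ c (f zero) (∑ (f ∘ suc))))

∑-const : ∀ n c → ∑ {n} (λ _ → c) ≡ + n * c
∑-const zero    c = refl
∑-const (suc n) c = ≡.trans (+-congʳ c (∑-const n c)) (sym (suc-* (+ n) c))

∑-swap : ∀ {m n} (f : Fin m → Fin n → ℤ) →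
  ∑ (λ i → ∑ (λ j → f i j)) ≡ ∑ (λ j → ∑ (λ i → f i j))
∑-swap {zero}  {n} f = sym (∑-zero n)
∑-swap {suc m} {n} f = ≡.trans (+-congʳ (∑ (f zero)) (∑-swap (f ∘ suc)))
  (sym (∑-+ (f zero) (λ j → ∑ (λ i → f (suc i) j))))

∑ⱽ : ∀ k → (Vec (Fin n) k → ℤ) → ℤ
∑ⱽ zero    f = f []
∑ⱽ (suc k) f = ∑ λ i → ∑ⱽ k λ v → f (i ∷ v)

∑ⱽ-cong : ∀ k {f g : Vec (Fin n) k → ℤ} → (∀ v → f v ≡ g v) → ∑ⱽ k f ≡ ∑ⱽ k g
∑ⱽ-cong zero    h = h []
∑ⱽ-cong (suc k) h = ∑-cong λ i → ∑ⱽ-cong k λ v → h (i ∷ v)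

∑ⱽ-mono : ∀ k {f g : Vec (Fin n) k → ℤ} → (∀ v → f v ≤ g v) → ∑ⱽ k f ≤ ∑ⱽ k g
∑ⱽ-mono zero    h = h []
∑ⱽ-mono (suc k) h = ∑-mono λ i → ∑ⱽ-mono k λ v → h (i ∷ v)

∑ⱽ-+ : ∀ k (f g : Vec (Fin n) k → ℤ) → ∑ⱽ k (λ v → f v + g v) ≡ ∑ⱽ k f + ∑ⱽ k g
∑ⱽ-+ zero    f g = refl
∑ⱽ-+ (suc k) f g = ≡.trans (∑-cong λ i → ∑ⱽ-+ k (f ∘ (i ∷_)) (g ∘ (i ∷_))) (∑-+ (λ i → ∑ⱽ k (f ∘ (i ∷_))) (λ i → ∑ⱽ k (g ∘ (i ∷_))))

∑ⱽ-zero : ∀ n k → ∑ⱽ {n} k (λ _ → 0ℤ) ≡ 0ℤ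
∑ⱽ-zero n zero    = refl
∑ⱽ-zero n (suc k) = ≡.trans (∑-cong {n} λ _ → ∑ⱽ-zero n k) (∑-zero n)

-- Words in the adjacent transpositions

swapAt : ℕ → Vec X n → Vec X n
swapAt zero    (a ∷ b ∷ v) = b ∷ a ∷ v
swapAt (suc k) (a ∷ v)     = a ∷ swapAt k v
swapAt _       v           = v

Word : Set
Word = List ℕ

act : Word → Vec X n → Vec X n
act []      v = v
act (k ∷ w) v = act w (swapAt k v)

act-++ : ∀ u w (v : Vec X n) → act (u ++ w) v ≡ act w (act u v)
act-++ []      w v = refl
act-++ (k ∷ u) w v = act-++ u w (swapAt k v)

swapAt-map : ∀ (f : X → Y) k (v : Vec X n) → swapAt k (Vec.map f v) ≡ Vec.map f (swapAt k v)
swapAt-map f zero    []          = refl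
swapAt-map f zero    (a ∷ [])    = refl
swapAt-map f zero    (a ∷ b ∷ v) = refl
swapAt-map f (suc k) []          = refl
swapAt-map f (suc k) (a ∷ v)     = cong (f a ∷_) (swapAt-map f k v)

act-map : ∀ (f : X → Y) w (v : Vec X n) → act w (Vec.map f v) ≡ Vec.map f (act w v)
act-map f []      v = refl
act-map f (k ∷ w) v = ≡.trans (cong (act w) (swapAt-map f k v)) (act-map f w (swapAt k v))

-- Exchanging two adjacent coordinates amounts to exchanging two adjacent sums; this is why
-- permutations are encoded as words in adjacent transpositions. A position beyond the end leaves
-- the vector unchanged, so no bound on `m` is required.
∑ⱽ-swapAt : ∀ m k (f : Vec (Fin n) k → ℤ) → ∑ⱽ k (f ∘ swapAt m) ≡ ∑ⱽ k f
∑ⱽ-swapAt zero    zero          f = refl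
∑ⱽ-swapAt zero    (suc zero)    f = refl
∑ⱽ-swapAt zero    (suc (suc k)) f = ∑-swap λ i j → ∑ⱽ k λ v → f (j ∷ i ∷ v)
∑ⱽ-swapAt (suc m) zero          f = refl
∑ⱽ-swapAt (suc m) (suc k)       f = ∑-cong λ i → ∑ⱽ-swapAt m k (f ∘ (i ∷_))

∑ⱽ-act : ∀ w k (f : Vec (Fin n) k → ℤ) → ∑ⱽ k (f ∘ act w) ≡ ∑ⱽ k f
∑ⱽ-act []      k f = refl
∑ⱽ-act (m ∷ w) k f = ≡.trans (∑ⱽ-swapAt m k (f ∘ act w)) (∑ⱽ-act w k f)

-- Sums over lists

∑ᴸ : (X → ℤ) → List X → ℤ
∑ᴸ f []       = 0ℤ
∑ᴸ f (x ∷ xs) = f x + ∑ᴸ f xs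

∑ᴸ-cong : {f g : X → ℤ} → (∀ x → f x ≡ g x) → ∀ xs → ∑ᴸ f xs ≡ ∑ᴸ g xs
∑ᴸ-cong h []       = refl
∑ᴸ-cong h (x ∷ xs) = cong₂ _+_ (h x) (∑ᴸ-cong h xs)

∑ᴸ-*ˡ : ∀ c (f : X → ℤ) xs → ∑ᴸ (λ x → c * f x) xs ≡ c * ∑ᴸ f xs
∑ᴸ-*ˡ c f []       = sym (*-zeroʳ c)
∑ᴸ-*ˡ c f (x ∷ xs) = ≡.trans (+-congʳ (c * f x) (∑ᴸ-*ˡ c f xs)) (sym (*-distribˡ-+ c (f x) (∑ᴸ f xs)))

∑ᴸ-++ : ∀ (f : X → ℤ) xs ys → ∑ᴸ f (xs ++ ys) ≡ ∑ᴸ f xs + ∑ᴸ f ys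
∑ᴸ-++ f []       ys = sym (+-identityˡ _)
∑ᴸ-++ f (x ∷ xs) ys = ≡.trans (+-congʳ (f x) (∑ᴸ-++ f xs ys)) (sym (+-assoc (f x) (∑ᴸ f xs) (∑ᴸ f ys)))

∑ᴸ-map : ∀ (f : Y → ℤ) (g : X → Y) xs → ∑ᴸ f (map g xs) ≡ ∑ᴸ (f ∘ g) xs
∑ᴸ-map f g []       = refl
∑ᴸ-map f g (x ∷ xs) = +-congʳ (f (g x)) (∑ᴸ-map f g xs)

∑ᴸ-concatMap : ∀ (f : Y → ℤ) (g : X → List Y) xs →
  ∑ᴸ f (concatMap g xs) ≡ ∑ᴸ (λ x → ∑ᴸ f (g x)) xs
∑ᴸ-concatMap f g []       = refl
∑ᴸ-concatMap f g (x ∷ xs) = ≡.trans (∑ᴸ-++ f (g x) (concatMap g xs)) (+-congʳ (∑ᴸ f (g x)) (∑ᴸ-concatMap f g xs))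

∧-split : ∀ {a b} → a ∧ b ≡ true → a ≡ true × b ≡ true
∧-split {true} {true} refl = refl , refl

all-sound : ∀ (p : X → Bool) xs → all p xs ≡ true → All (λ x → p x ≡ true) xs
all-sound p []       h = []
all-sound p (x ∷ xs) h = proj₁ (∧-split h) ∷ all-sound p xs (proj₂ (∧-split {p x} h))

∑ᴸ-↭ : ∀ (f : X → ℤ) {xs ys} → xs ↭ ys → ∑ᴸ f xs ≡ ∑ᴸ f ys
∑ᴸ-↭ f refl         = refl
∑ᴸ-↭ f (prep x r)   = +-congʳ (f x) (∑ᴸ-↭ f r)
∑ᴸ-↭ f (swap {xs} {ys} x y r) = ≡.trans (+-exch (f x) (f y) (∑ᴸ f xs))
  (+-congʳ (f y) (+-congʳ (f x) (∑ᴸ-↭ f r)))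
∑ᴸ-↭ f (trans r s)  = ≡.trans (∑ᴸ-↭ f r) (∑ᴸ-↭ f s)

-- The 3-graph induced by a tuple of six vertices

on : ThreeGraph n → Vec (Fin n) 6 → Triple 6 → Bool
on H x (i , j , k) = edge H (lookup x i) (lookup x j) (lookup x k)

σ : Word → Vec (Fin 6) 6
σ w = act w (allFin 6)

move : Word → Triple 6 → Triple 6
move w (i , j , k) = lookup (σ w) i , lookup (σ w) j , lookup (σ w) k

-- A word moves positions without looking at the entries, so it commutes with `Vec.map`; and every
-- tuple is the image of `allFin 6` under its own lookup.
act≡map : ∀ w (x : Vec X 6) → act w x ≡ Vec.map (lookup x) (σ w)
act≡map w x = ≡.trans (cong (act w) (sym (Vec.map-lookup-allFin x))) (act-map (lookup x) w (allFin 6))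

lookup-act : ∀ w (x : Vec X 6) i → lookup (act w x) i ≡ lookup x (lookup (σ w) i)
lookup-act w x i = ≡.trans (cong (λ y → lookup y i) (act≡map w x)) (Vec.lookup-map i (lookup x) (σ w))

on-act : ∀ (H : ThreeGraph n) w x t → on H (act w x) t ≡ on H x (move w t)
on-act H w x (i , j , k) rewrite lookup-act w x i | lookup-act w x j | lookup-act w x k = refl

-- Colexicographic order of triples is the order of their masks.

mask : Triple 6 → ℕ
mask (i , j , k) = 2 ^ toℕ i ℕ.+ 2 ^ toℕ j ℕ.+ 2 ^ toℕ k

triples : Vec (Triple 6) 20
triples =
  (v1 , v2 , v3) ∷ (v1 , v2 , v4) ∷ (v1 , v3 , v4) ∷ (v2 , v3 , v4) ∷
  (v1 , v2 , v5) ∷ (v1 , v3 , v5) ∷ (v2 , v3 , v5) ∷ (v1 , v4 , v5) ∷ (v2 , v4 , v5) ∷ (v3 , v4 , v5) ∷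
  (v1 , v2 , v6) ∷ (v1 , v3 , v6) ∷ (v2 , v3 , v6) ∷ (v1 , v4 , v6) ∷ (v2 , v4 , v6) ∷ (v3 , v4 , v6) ∷
  (v1 , v5 , v6) ∷ (v2 , v5 , v6) ∷ (v3 , v5 , v6) ∷ (v4 , v5 , v6) ∷ []

masks : Vec ℕ 20
masks = Vec.map mask triples

record Bits : Set where
  constructor bits
  field
    b₀ b₁ b₂ b₃ b₄ b₅ b₆ b₇ b₈ b₉ b₁₀ b₁₁ b₁₂ b₁₃ b₁₄ b₁₅ b₁₆ b₁₇ b₁₈ b₁₉ : Bool
open Bits

data Slot : Set where
  s₀ s₁ s₂ s₃ s₄ s₅ s₆ s₇ s₈ s₉ s₁₀ s₁₁ s₁₂ s₁₃ s₁₄ s₁₅ s₁₆ s₁₇ s₁₈ s₁₉ none : Slot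

get : Slot → Bits → Bool
get s₀ = b₀
get s₁ = b₁
get s₂ = b₂
get s₃ = b₃
get s₄ = b₄
get s₅ = b₅
get s₆ = b₆
get s₇ = b₇
get s₈ = b₈
get s₉ = b₉
get s₁₀ = b₁₀
get s₁₁ = b₁₁
get s₁₂ = b₁₂
get s₁₃ = b₁₃
get s₁₄ = b₁₄
get s₁₅ = b₁₅
get s₁₆ = b₁₆
get s₁₇ = b₁₇
get s₁₈ = b₁₈
get s₁₉ = b₁₉
get none = λ _ → false

slots : Vec Slot 20
slots = s₀ ∷ s₁ ∷ s₂ ∷ s₃ ∷ s₄ ∷ s₅ ∷ s₆ ∷ s₇ ∷ s₈ ∷ s₉ ∷
  s₁₀ ∷ s₁₁ ∷ s₁₂ ∷ s₁₃ ∷ s₁₄ ∷ s₁₅ ∷ s₁₆ ∷ s₁₇ ∷ s₁₈ ∷ s₁₉ ∷ []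

pack : Vec Bool 20 → Bits
pack (a ∷ b ∷ c ∷ d ∷ e ∷ f ∷ g ∷ h ∷ i ∷ j ∷ k ∷ l ∷ m ∷ n ∷ o ∷ p ∷ q ∷ r ∷ s ∷ t ∷ []) =
  bits a b c d e f g h i j k l m n o p q r s t

-- Polymorphic in the result, so that one search by mask yields a slot, a Boolean or a stored
-- triple, and naturality (`select-map`) relates the three.
select : Vec ℕ k → Vec X k → X → ℕ → X
select []       []       d m = d
select (i ∷ is) (a ∷ as) d m = if i ≡ᵇ m then a else select is as d m

slot : ℕ → Slot
slot = select masks slots none

at : ℕ → Bits → Bool
at m = get (slot m)

select-map : ∀ (f : X → Y) (is : Vec ℕ k) as d m →
  f (select is as d m) ≡ select is (Vec.map f as) (f d) m
select-map f []       []       d m = refl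
select-map f (i ∷ is) (a ∷ as) d m with i ≡ᵇ m
... | true  = refl
... | false = select-map f is as d m

get-pack : ∀ v → Vec.map (λ s → get s (pack v)) slots ≡ v
get-pack (a ∷ b ∷ c ∷ d ∷ e ∷ f ∷ g ∷ h ∷ i ∷ j ∷ k ∷ l ∷ m ∷ n ∷ o ∷ p ∷ q ∷ r ∷ s ∷ t ∷ []) = refl

at-pack : ∀ m v → at m (pack v) ≡ select masks v false m
at-pack m v = ≡.trans (select-map (λ s → get s (pack v)) masks slots none m)
  (cong (λ u → select masks u false m) (get-pack v))

-- The slots are computed before the queries are formed: the evaluator shares values of a
-- data type, but not functions.
look : (Triple 6 → ℕ) → List (Triple 6) → List (Bits → Bool)
look g ts = map get (map (λ t → slot (g t)) ts)

length-look : ∀ g ts → length (look g ts) ≡ length ts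
length-look g []       = refl
length-look g (t ∷ ts) = cong suc (length-look g ts)

look-values : ∀ g v ts → map (λ a → a v) (look g ts) ≡ map (λ t → at (g t) v) ts
look-values g v []       = refl
look-values g v (t ∷ ts) = cong (at (g t) v ∷_) (look-values g v ts)

code : ThreeGraph n → Vec (Fin n) 6 → Bits
code H x = pack (Vec.map (on H x) triples)

private
  standard : Triple 6 → Maybe (Triple 6)
  standard t = select masks (Vec.map just triples) nothing (mask t)

  orbit : Triple 6 → List (Triple 6)
  orbit (i , j , k) = (i , j , k) ∷ (j , i , k) ∷ (i , k , j) ∷ (j , k , i) ∷ (k , i , j) ∷ (k , j , i) ∷ []

  Standardised : Triple 6 → Set
  Standardised t@(i , j , k) = maybe (λ t′ → t′ ∈ orbit t) (i ≡ j ⊎ j ≡ k ⊎ i ≡ k) (standard t)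

  standardised? : ∀ t → Dec (Standardised t)
  standardised? t@(i , j , k) with standard t
  ... | just t′ = _∈?_ (≡-dec Fin._≟_ (≡-dec Fin._≟_ Fin._≟_)) t′ (orbit t)
  ... | nothing = (i Fin.≟ j) ⊎-dec ((j Fin.≟ k) ⊎-dec (i Fin.≟ k))

  -- A sum of three distinct powers of two has three binary digits, which determine the summands;
  -- with a repeated vertex at most two digits remain. So a mask is found exactly for nondegenerate
  -- triples, and it determines the triple up to order. The 216 cases are decided by evaluation.
  standardised : ∀ t → Standardised t
  standardised (i , j , k) = from-yes (Fin.all? λ i → Fin.all? λ j → Fin.all? λ k → standardised? (i , j , k)) i j k

on-orbit : ∀ (H : ThreeGraph n) x t → All (λ t′ → on H x t′ ≡ on H x t) (orbit t)
on-orbit H x (i , j , k) = refl ∷ bac ∷ acb ∷ bca ∷ ≡.trans (sym₁₂ H c a b) acb ∷ ≡.trans (sym₁₂ H c b a) bca ∷ []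
  where
  a = lookup x i
  b = lookup x j
  c = lookup x k
  bac = sym₁₂ H b a c
  acb = sym₂₃ H a c b
  bca = ≡.trans (sym₂₃ H b c a) bac

edge-degenerate : ∀ (H : ThreeGraph n) {a b c} → a ≡ b ⊎ b ≡ c ⊎ a ≡ c → edge H a b c ≡ false
edge-degenerate H (inj₁ refl)        = irrefl H _ _
edge-degenerate H (inj₂ (inj₁ refl)) = ≡.trans (sym₁₂ H _ _ _) (≡.trans (sym₂₃ H _ _ _) (irrefl H _ _))
edge-degenerate H (inj₂ (inj₂ refl)) = ≡.trans (sym₂₃ H _ _ _) (irrefl H _ _)

-- By naturality of `select`, the bit read is `on H x` at the stored triple with the mask of `t`,
-- which is a reordering of `t`. If there is none, `t` is degenerate, and the default `false` is the
-- value of `edge` there.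
at-mask : ∀ (H : ThreeGraph n) x t → at (mask t) (code H x) ≡ on H x t
at-mask H x t@(i , j , k) = ≡.trans (at-pack (mask t) (Vec.map (on H x) triples))
  (≡.trans (cong (λ u → select masks u false (mask t)) (Vec.map-∘ (maybe (on H x) false) just triples))
  (≡.trans (sym (select-map (maybe (on H x) false) masks (Vec.map just triples) nothing (mask t)))
  (helper (standard t) (standardised t))))
  where
  helper : ∀ f → maybe (λ t′ → t′ ∈ orbit t) (i ≡ j ⊎ j ≡ k ⊎ i ≡ k) f → maybe (on H x) false f ≡ on H x t
  helper (just t′) g = All.lookup (on-orbit H x t) g
  helper nothing (inj₁ refl)        = sym (edge-degenerate H (inj₁ refl))
  helper nothing (inj₂ (inj₁ refl)) = sym (edge-degenerate H (inj₂ (inj₁ refl)))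
  helper nothing (inj₂ (inj₂ refl)) = sym (edge-degenerate H (inj₂ (inj₂ refl)))

-- Decision tables indexed by Boolean queries

data Table : Set where
  leaf : ℤ → Table
  node : Table → Table → Table

walk : Table → List (X → Bool) → X → ℤ
walk (leaf z)   _        v = z
walk (node l r) []       v = 0ℤ
walk (node l r) (a ∷ as) v = if a v then walk r as v else walk l as v

branch : ℕ → (List Bool → Table) → Table
branch zero    f = f []
branch (suc k) f = node (branch k (f ∘ (false ∷_))) (branch k (f ∘ (true ∷_)))

walk-branch : ∀ f (as bs : List (X → Bool)) v →
  walk (branch (length as) f) (as ++ bs) v ≡ walk (f (map (λ a → a v) as)) bs v
walk-branch f []       bs v = refl
walk-branch f (a ∷ as) bs v with a v
... | true  = walk-branch (f ∘ (true ∷_)) as bs v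
... | false = walk-branch (f ∘ (false ∷_)) as bs v

join : Table → Table → Table
join (leaf y) (leaf z) with y ℤ.≟ z
... | yes _ = leaf z
... | no  _ = node (leaf y) (leaf z)
join l        r        = node l r

walk-join : ∀ l r (a : X → Bool) as v → walk (join l r) (a ∷ as) v ≡ walk (node l r) (a ∷ as) v
walk-join (leaf y) (leaf z) a as v with y ℤ.≟ z
... | no  _    = refl
... | yes refl with a v
...   | true  = refl
...   | false = refl
walk-join (leaf y)   (node _ _) a as v = refl
walk-join (node _ _) (leaf _)   a as v = refl
walk-join (node _ _) (node _ _) a as v = refl

-- Merging equal leaves evaluates the whole table, so it pays only for few queries.
tabulate : Bool → ℕ → (List Bool → ℤ) → Table
tabulate merge zero    f = leaf (f [])
tabulate merge (suc k) f = if merge then join l r else node l r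
  where
  l = tabulate merge k (f ∘ (false ∷_))
  r = tabulate merge k (f ∘ (true ∷_))

walk-tabulate : ∀ merge f (as : List (X → Bool)) v →
  walk (tabulate merge (length as) f) as v ≡ f (map (λ a → a v) as)
walk-tabulate merge f []       v = refl
walk-tabulate merge f (a ∷ as) v = ≡.trans (unmerged merge) merged
  where
  l = tabulate merge (length as) (f ∘ (false ∷_))
  r = tabulate merge (length as) (f ∘ (true ∷_))
  unmerged : ∀ b → walk (if b then join l r else node l r) (a ∷ as) v ≡ walk (node l r) (a ∷ as) v
  unmerged true  = walk-join l r a as v
  unmerged false = refl
  merged : walk (node l r) (a ∷ as) v ≡ f (a v ∷ map (λ a → a v) as)
  merged with a v
  ... | true  = walk-tabulate merge (f ∘ (true ∷_)) as v
  ... | false = walk-tabulate merge (f ∘ (false ∷_)) as v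

-- Kernels and their compiled symmetrisations

record Kernel : Set where
  constructor kernel
  field
    merge : Bool
    query : List (Triple 6)
    table : Table
open Kernel

⟦_⟧ : Kernel → ThreeGraph n → Vec (Fin n) 6 → ℤ
⟦ K ⟧ H = walk (table K) (map (λ t x → on H x t) (query K))

record Shape : Set where
  constructor _▹_
  field
    inner outer : List Word
open Shape

Term : Set
Term = Kernel × Shape

symmetrised : Term → ThreeGraph n → Vec (Fin n) 6 → ℤ
symmetrised (K , S) H x = ∑ᴸ (λ c → ∑ᴸ (λ u → ⟦ K ⟧ H (act u (act c x))) (inner S)) (outer S)

queries : Kernel → Word → List (Bits → Bool)
queries K w = look (λ t → mask (move w t)) (query K)

assoc : List ℕ → List Bool → ℕ → Bool
assoc (i ∷ is) (b ∷ bs) m = if i ≡ᵇ m then b else assoc is bs m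
assoc _        _        m = false

member : ℕ → List ℕ → Bool
member m []       = false
member m (i ∷ is) = if i ≡ᵇ m then true else member m is

-- A code recording only the answers to the queries `ms`. All other bits are set to `false`; `valid`
-- guarantees that an inner relabelling reads none of them.
place : List ℕ → List Bool → Bits
place ms l = pack (Vec.map (assoc ms l) masks)

sumWalks : Table → List (List (X → Bool)) → X → ℤ
sumWalks B []         v = 0ℤ
sumWalks B (as ∷ ass) v = walk B as v + sumWalks B ass v

innerTable : Bool → ℕ → List ℕ → Table → List (List (Bits → Bool)) → Table
innerTable m k ms B us = tabulate m k (λ l → sumWalks B us (place ms l))

Compiled : Set
Compiled = Table × List (List (Bits → Bool))

-- The inner relabellings map the queries of the kernel to queries of the kernel, so the sum over
-- them is again a function of the same answers and is tabulated once. A code then costs one walk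
-- per outer representative: 15 for `shape₄`, in place of 720.
compile : Term → Compiled
compile (K , S) =
  innerTable (merge K) (length (query K)) (map mask (query K)) (table K) (map (queries K) (inner S)) ,
  map (queries K) (outer S)

evaluate : Compiled → Bits → ℤ
evaluate (M , ps) v = sumWalks M ps v

keepsQueries : Kernel → Word → Bool
keepsQueries K u = all (λ t → member (mask (move u t)) (map mask (query K))) (query K)

valid : Term → Bool
valid (K , S) = all (λ m → member m (Vec.toList masks)) (map mask (query K)) ∧ all (keepsQueries K) (inner S)

isYes-sound : ∀ {P : Set} (d : Dec P) → isYes d ≡ true → P
isYes-sound (yes p) _ = p

≡ᵇ-sound : ∀ i m → (i ≡ᵇ m) ≡ true → i ≡ m
≡ᵇ-sound i m h = ℕ.≡ᵇ⇒≡ i m (subst T (sym h) _)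

select-member : ∀ (h : ℕ → Bool) (is : Vec ℕ k) m → member m (Vec.toList is) ≡ true →
  select is (Vec.map h is) false m ≡ h m
select-member h (i ∷ is) m e with i ≡ᵇ m in eq
... | true  = cong h (≡ᵇ-sound i m eq)
... | false = select-member h is m e

assoc-member : ∀ (h : ℕ → Bool) is m → member m is ≡ true → assoc is (map h is) m ≡ h m
assoc-member h (i ∷ is) m e with i ≡ᵇ m in eq
... | true  = cong h (≡ᵇ-sound i m eq)
... | false = assoc-member h is m e

member-all : ∀ (p : ℕ → Bool) is m → all p is ≡ true → member m is ≡ true → p m ≡ true
member-all p (i ∷ is) m a e with i ≡ᵇ m in eq
... | true  = subst (λ z → p z ≡ true) (≡ᵇ-sound i m eq) (proj₁ (∧-split a))
... | false = member-all p is m (proj₂ (∧-split {p i} a)) e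

walk-cong : ∀ T {as : List (X → Bool)} {bs : List (Y → Bool)} u v → map (λ a → a u) as ≡ map (λ b → b v) bs →
  walk T as u ≡ walk T bs v
walk-cong (leaf z)   u v h = refl
walk-cong (node l r) {[]}     {[]}     u v h = refl
walk-cong (node l r) {a ∷ as} {b ∷ bs} u v h
  rewrite List.∷-injectiveˡ h | walk-cong l {as} {bs} u v (List.∷-injectiveʳ h) | walk-cong r {as} {bs} u v (List.∷-injectiveʳ h) = refl

map-cong-all : ∀ {f g : X → Y} {xs} → All (λ x → f x ≡ g x) xs → map f xs ≡ map g xs
map-cong-all []       = refl
map-cong-all (e ∷ es) = cong₂ _∷_ e (map-cong-all es)

map-apply : ∀ (g : X → Y → Bool) v ts → map (λ a → a v) (map g ts) ≡ map (λ t → g t v) ts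
map-apply g v ts = sym (List.map-∘ ts)

module _ (H : ThreeGraph n) where

  answers : ∀ K y → map (λ a → a y) (map (λ t x → on H x t) (query K)) ≡ map (on H y) (query K)
  answers K y = map-apply (λ t x → on H x t) y (query K)

  queries-sound : ∀ K w x → map (λ a → a (code H x)) (queries K w) ≡ map (on H (act w x)) (query K)
  queries-sound K w x = ≡.trans (look-values (λ t → mask (move w t)) (code H x) (query K))
    (List.map-cong (λ t → ≡.trans (at-mask H x (move w t)) (sym (on-act H w x t))) (query K))

  inner-sound : ∀ K y u → let ms = map mask (query K) in
    all (λ m → member m (Vec.toList masks)) ms ≡ true → keepsQueries K u ≡ true →
    walk (table K) (queries K u) (place ms (map (on H y) (query K))) ≡ ⟦ K ⟧ H (act u y)
  inner-sound K y u ok₁ ok₂ = walk-cong (table K) b (act u y)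
    (≡.trans (look-values (λ t → mask (move u t)) b (query K))
    (≡.trans (map-cong-all (All.map (λ {t} → step t) (all-sound _ (query K) ok₂))) (sym (answers K (act u y)))))
    where
    ms = map mask (query K)
    h : ℕ → Bool
    h m = at m (code H y)
    b = place ms (map (on H y) (query K))
    recorded : map (on H y) (query K) ≡ map h ms
    recorded = ≡.trans (List.map-cong (λ t → sym (at-mask H y t)) (query K)) (List.map-∘ (query K))
    step : ∀ t → member (mask (move u t)) ms ≡ true → at (mask (move u t)) b ≡ on H (act u y) t
    step t e = ≡.trans (at-pack m (Vec.map (assoc ms (map (on H y) (query K))) masks))
      (≡.trans (select-member (assoc ms (map (on H y) (query K))) masks m (member-all _ ms m ok₁ e))
      (≡.trans (cong (λ l → assoc ms l m) recorded)
      (≡.trans (assoc-member h ms m e)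
      (≡.trans (at-mask H y (move u t)) (sym (on-act H u y t))))))
      where m = mask (move u t)

  evaluate-sound : ∀ τ x → valid τ ≡ true → evaluate (compile τ) (code H x) ≡ symmetrised τ H x
  evaluate-sound τ@(K , S) x ok = outer-sum (outer S)
    where
    ms = map mask (query K)
    ok₁ = proj₁ (∧-split ok)
    oks = all-sound (keepsQueries K) (inner S) (proj₂ (∧-split {all (λ m → member m (Vec.toList masks)) ms} ok))
    M = proj₁ (compile τ)
    f : List Bool → ℤ
    f l = sumWalks (table K) (map (queries K) (inner S)) (place ms l)
    inner-sum : ∀ y us → All (λ u → keepsQueries K u ≡ true) us →
      sumWalks (table K) (map (queries K) us) (place ms (map (on H y) (query K))) ≡ ∑ᴸ (λ u → ⟦ K ⟧ H (act u y)) us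
    inner-sum y []       []       = refl
    inner-sum y (u ∷ us) (o ∷ os) = cong₂ _+_ (inner-sound K y u ok₁ o) (inner-sum y us os)
    outer-step : ∀ c → walk M (queries K c) (code H x) ≡ ∑ᴸ (λ u → ⟦ K ⟧ H (act u (act c x))) (inner S)
    outer-step c = ≡.trans
      (cong (λ l → walk (tabulate (merge K) l f) (queries K c) (code H x))
        (sym (length-look (λ t → mask (move c t)) (query K))))
      (≡.trans (walk-tabulate (merge K) f (queries K c) (code H x))
      (≡.trans (cong f (queries-sound K c x)) (inner-sum (act c x) (inner S) oks)))
    outer-sum : ∀ cs → sumWalks M (map (queries K) cs) (code H x) ≡
      ∑ᴸ (λ c → ∑ᴸ (λ u → ⟦ K ⟧ H (act u (act c x))) (inner S)) cs
    outer-sum []       = refl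
    outer-sum (c ∷ cs) = cong₂ _+_ (outer-step c) (outer-sum cs)

-- The symmetric group on six letters

-- The initial segments of the word k, k - 1, ..., 0. Their k + 2 products represent the cosets of
-- the symmetric group on k + 1 letters in that on k + 2 letters, so that `perms` has 2 · 3 · 4 · 5
-- · 6 = 720 words.
chain : ℕ → List Word
chain zero    = [] ∷ (0 ∷ []) ∷ []
chain (suc k) = [] ∷ map (suc k ∷_) (chain k)

_⊗_ : List Word → List Word → List Word
us ⊗ ws = concatMap (λ u → map (u ++_) ws) us

perms : List Word
perms = chain 0 ⊗ (chain 1 ⊗ (chain 2 ⊗ (chain 3 ⊗ chain 4)))

senary : Vec (Fin 6) k → ℕ
senary []      = 0
senary (i ∷ v) = toℕ i ℕ.+ 6 ℕ.* senary v

permOrder = decTotalOrder ℕ.≤-decTotalOrder (senary {6})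

_≟ᴾ_ : (xs ys : List (Vec (Fin 6) 6)) → Dec (xs ≡ ys)
_≟ᴾ_ = List.≡-dec (Vec.≡-dec Fin._≟_)

sameElements : List (Vec (Fin 6) 6) → List (Vec (Fin 6) 6) → Bool
sameElements xs ys = isYes (sort permOrder xs ≟ᴾ sort permOrder ys)

sameElements-sound : ∀ xs ys → sameElements xs ys ≡ true → xs ↭ ys
sameElements-sound xs ys h = ↭-trans (↭-sym (sort-↭ permOrder xs))
  (↭-trans (↭-reflexive (isYes-sound _ h)) (sort-↭ permOrder ys))

closedUnder : ℕ → Bool
closedUnder k = sameElements (map σ (map (k ∷_) perms)) (map σ perms)

swaps : List ℕ
swaps = 0 ∷ 1 ∷ 2 ∷ 3 ∷ 4 ∷ []

-- This evaluation takes the place of group theory: prefixing a generator only reorders the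
-- permutations listed by `perms`, so reindexing shows that `full F` is invariant under each
-- generator, and hence under every word in them.
perms-closed : all closedUnder swaps ≡ true
perms-closed = refl

transversal : Shape → Bool
transversal S = sameElements (map σ (outer S ⊗ inner S)) (map σ perms)

∑-words : ∀ (F : Vec X 6 → ℤ) x ws → ∑ᴸ (λ w → F (act w x)) ws ≡ ∑ᴸ (λ s → F (Vec.map (lookup x) s)) (map σ ws)
∑-words F x ws = ≡.trans (∑ᴸ-cong (λ w → cong F (act≡map w x)) ws)
  (sym (∑ᴸ-map (λ s → F (Vec.map (lookup x) s)) σ ws))

∑-words-↭ : ∀ (F : Vec X 6 → ℤ) x us ws → map σ us ↭ map σ ws →
  ∑ᴸ (λ w → F (act w x)) us ≡ ∑ᴸ (λ w → F (act w x)) ws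
∑-words-↭ F x us ws r = ≡.trans (∑-words F x us)
  (≡.trans (∑ᴸ-↭ (λ s → F (Vec.map (lookup x) s)) r) (sym (∑-words F x ws)))

∑ⱽ-∑ᴸ : ∀ k (f : Y → Vec (Fin n) k → ℤ) ys → ∑ⱽ k (λ x → ∑ᴸ (λ y → f y x) ys) ≡ ∑ᴸ (λ y → ∑ⱽ k (f y)) ys
∑ⱽ-∑ᴸ {n = n} k f []       = ∑ⱽ-zero n k
∑ⱽ-∑ᴸ k f (y ∷ ys) = ≡.trans (∑ⱽ-+ k (f y) _) (+-congʳ (∑ⱽ k (f y)) (∑ⱽ-∑ᴸ k f ys))

∑ᴸ-const : ∀ c (ys : List Y) → ∑ᴸ (λ _ → c) ys ≡ + length ys * c
∑ᴸ-const c []       = refl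
∑ᴸ-const c (y ∷ ys) = ≡.trans (+-congʳ c (∑ᴸ-const c ys)) (sym (suc-* (+ length ys) c))

-- Abstract, lest the type checker unfold the sum over 720 permutations.
abstract

  full : (Vec X 6 → ℤ) → Vec X 6 → ℤ
  full F x = ∑ᴸ (λ w → F (act w x)) perms

  full-swapAt : ∀ (F : Vec X 6 → ℤ) x k → member k swaps ≡ true →
    full F (swapAt k x) ≡ full F x
  full-swapAt F x k m = ≡.trans (sym (∑ᴸ-map (λ w → F (act w x)) (k ∷_) perms))
    (∑-words-↭ F x (map (k ∷_) perms) perms (sameElements-sound _ _ (member-all closedUnder swaps k perms-closed m)))

  full-act : ∀ (F : Vec X 6 → ℤ) w x → all (λ k → member k swaps) w ≡ true → full F (act w x) ≡ full F x
  full-act F []      x h = refl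
  full-act F (k ∷ w) x h = ≡.trans (full-act F w (swapAt k x) (proj₂ (∧-split {member k swaps} h)))
    (full-swapAt F x k (proj₁ (∧-split h)))

  ∑ⱽ-full : ∀ (F : Vec (Fin n) 6 → ℤ) → ∑ⱽ 6 (full F) ≡ + 720 * ∑ⱽ 6 F
  ∑ⱽ-full F = ≡.trans (∑ⱽ-∑ᴸ 6 (λ w x → F (act w x)) perms)
    (≡.trans (∑ᴸ-cong (λ w → ∑ⱽ-act w 6 F) perms) (∑ᴸ-const (∑ⱽ 6 F) perms))

  symmetrised-full : ∀ (H : ThreeGraph n) K S x → transversal S ≡ true → symmetrised (K , S) H x ≡ full (⟦ K ⟧ H) x
  symmetrised-full H K S x h = ≡.trans
    (∑ᴸ-cong (λ c → ≡.trans (∑ᴸ-cong (λ u → cong (⟦ K ⟧ H) (sym (act-++ c u x))) (inner S))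
      (sym (∑ᴸ-map (λ w → ⟦ K ⟧ H (act w x)) (c ++_) (inner S)))) (outer S))
    (≡.trans (sym (∑ᴸ-concatMap (λ w → ⟦ K ⟧ H (act w x)) (λ c → map (c ++_) (inner S)) (outer S)))
      (∑-words-↭ (⟦ K ⟧ H) x (outer S ⊗ inner S) perms (sameElements-sound _ _ h)))

-- Lexicographic comparison of codes

num : List Bool → ℕ
num []       = 0
num (b ∷ bs) = (if b then 2 ^ length bs else 0) ℕ.+ num bs

num< : ∀ bs → num bs ℕ.< 2 ^ length bs
num< []           = ℕ.s≤s ℕ.z≤n
num< (true ∷ bs)  = ℕ.+-mono-≤-< (ℕ.≤-refl {2 ^ length bs}) (subst (num bs ℕ.<_) (sym (ℕ.+-identityʳ _)) (num< bs))
num< (false ∷ bs) = ℕ.<-≤-trans (num< bs) (ℕ.m≤m+n _ _)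

lexLess : List (X → Bool) → List (X → Bool) → X → Bool
lexLess (f ∷ fs) (g ∷ gs) v = if f v then (if g v then lexLess fs gs v else false) else (if g v then true else lexLess fs gs v)
lexLess _        _        v = false

values : List (X → Bool) → X → List Bool
values fs v = map (λ f → f v) fs

lexLess-sound : ∀ (fs gs : List (X → Bool)) v → length fs ≡ length gs → lexLess fs gs v ≡ true →
  num (values fs v) ℕ.< num (values gs v)
lexLess-sound (f ∷ fs) (g ∷ gs) v l h with f v | g v
... | true  | true  = subst (λ z → 2 ^ z ℕ.+ _ ℕ.< _) (≡.trans (List.length-map _ gs) (≡.trans (sym (ℕ.suc-injective l)) (sym (List.length-map _ fs))))
  (ℕ.+-monoʳ-< _ (lexLess-sound fs gs v (ℕ.suc-injective l) h))
... | false | true  = ℕ.<-≤-trans (subst (λ z → num (values fs v) ℕ.< 2 ^ z)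
    (≡.trans (List.length-map _ fs) (≡.trans (ℕ.suc-injective l) (sym (List.length-map _ gs)))) (num< (values fs v))) (ℕ.m≤m+n _ _)
... | false | false = lexLess-sound fs gs v (ℕ.suc-injective l) h

-- A strict comparison is settled at the first difference, so later bits cannot reverse it. This is
-- what allows a whole family of codes to be discarded by its common prefix.
lexLess-take : ∀ j (fs gs : List (X → Bool)) v → lexLess (take j fs) (take j gs) v ≡ true → lexLess fs gs v ≡ true
lexLess-take (suc j) (f ∷ fs) (g ∷ gs) v h with f v | g v
... | true  | true  = lexLess-take j fs gs v h
... | false | true  = refl
... | false | false = lexLess-take j fs gs v h

lexLess-values : ∀ (fs gs : List (X → Bool)) u v → values fs u ≡ values fs v → values gs u ≡ values gs v →
  lexLess fs gs u ≡ lexLess fs gs v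
lexLess-values []       []       u v p q = refl
lexLess-values []       (g ∷ gs) u v p q = refl
lexLess-values (f ∷ fs) []       u v p q = refl
lexLess-values (f ∷ fs) (g ∷ gs) u v p q
  rewrite List.∷-injectiveˡ p | List.∷-injectiveˡ q
        | lexLess-values fs gs u v (List.∷-injectiveʳ p) (List.∷-injectiveʳ q) = refl

-- Pruned search through all codes

involutive : Word → Bool
involutive w = isYes (Vec.≡-dec Fin._≟_ (act w (σ w)) (allFin 6))

-- Among 3-graphs on six vertices, 2433 codes cannot be lowered by an involution, against 2136 isomorphism classes.
relabellings : List Word
relabellings = map (_∷ []) swaps ++ filterᵇ involutive perms

prefixRelabellings : List Word
prefixRelabellings = filterᵇ (λ w → toℕ (lookup (σ w) v6) ≡ᵇ 5) relabellings

relabelled : Word → List (Bits → Bool)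
relabelled w = look (λ t → mask (move w t)) (Vec.toList triples)

original : List (Bits → Bool)
original = look mask (Vec.toList triples)

everyV : ∀ k → (Vec Bool k → Bool) → Bool
everyV zero    p = p []
everyV (suc k) p = everyV k (p ∘ (false ∷_)) ∧ everyV k (p ∘ (true ∷_))

everyV-sound : ∀ k p → everyV k p ≡ true → ∀ v → p v ≡ true
everyV-sound zero    p h []          = h
everyV-sound (suc k) p h (false ∷ v) = everyV-sound k _ (proj₁ (∧-split h)) v
everyV-sound (suc k) p h (true ∷ v)  = everyV-sound k _ (proj₂ (∧-split {everyV k (p ∘ (false ∷_))} h)) v

nonpositive : ℤ → Bool
nonpositive (+ zero)  = true
nonpositive (+ suc _) = false
nonpositive -[1+ _ ]  = true

nonpositive-sound : ∀ z → nonpositive z ≡ true → z ≤ 0ℤ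
nonpositive-sound (+ zero)  _ = +≤+ ℕ.z≤n
nonpositive-sound -[1+ _ ]  _ = -≤+

someLess : List (List (X → Bool)) → List (X → Bool) → X → Bool
someLess fss gs v = any (λ fs → lexLess fs gs v) fss

someCopy : List (List (X → Bool)) → X → Bool
someCopy ass v = any (λ as → all (λ a → a v) as) ass

good : List (List (X → Bool)) → List (X → Bool) → List (List (X → Bool)) → (X → ℤ) → X → Bool
good fss gs ass f v = someLess fss gs v ∨ (someCopy ass v ∨ nonpositive (f v))

-- The first ten bits record the 3-graph on the first five vertices; relabellings that fix the sixth act on them.
goodPrefix : (Bits → Bool) → List (List (Bits → Bool)) → List (Bits → Bool) → Vec Bool 10 → Bool
goodPrefix P fss gs p = someLess fss gs (pack (p Vec.++ Vec.replicate 10 false)) ∨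
  everyV 10 (λ q → P (pack (p Vec.++ q)))

evaluateAll : List Compiled → Bits → ℤ
evaluateAll cs v = ∑ᴸ (λ c → evaluate c v) cs

copy : List (Triple 6) → Word → List (Bits → Bool)
copy F w = look (λ t → mask (move w t)) F

goodBits : List Word → List (Triple 6) → List Word → List Term → Bits → Bool
goodBits rs F ws τs = good (map relabelled rs) original (map (copy F) ws) (evaluateAll (map compile τs))

search : List Word → (Bits → Bool) → Bool
search rs P = everyV 10 (goodPrefix P (map (λ w → take 10 (relabelled w)) rs) (take 10 original))

check : List (Triple 6) → List Word → List Term → Bool
check F ws τs = all (λ τ → valid τ ∧ transversal (proj₂ τ)) τs ∧ search prefixRelabellings (goodBits relabellings F ws τs)

-- Soundness of the search

Avoids : List (Triple 6) → ThreeGraph n → Set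
Avoids F H = ∀ x → ¬ (all (on H x) F ≡ true)

∨-split : ∀ {a b} → a ∨ b ≡ true → a ≡ true ⊎ b ≡ true
∨-split {true}  h = inj₁ refl
∨-split {false} h = inj₂ h

any-map-sound : ∀ (p : Y → Bool) (f : X → Y) xs → any p (map f xs) ≡ true → ∃ λ x → p (f x) ≡ true
any-map-sound p f (x ∷ xs) h with p (f x) in e
... | true  = x , e
... | false = any-map-sound p f xs h

select-++ : ∀ {j} (is : Vec ℕ k) (js : Vec ℕ j) (as : Vec X k) bs d m → member m (Vec.toList is) ≡ true →
  select (is Vec.++ js) (as Vec.++ bs) d m ≡ select is as d m
select-++ (i ∷ is) js (a ∷ as) bs d m h with i ≡ᵇ m
... | true  = refl
... | false = select-++ is js as bs d m h

triples₅ : List (Triple 6)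
triples₅ = take 10 (Vec.toList triples)

withinFive : Word → Bool
withinFive w = all (λ t → member (mask (move w t)) (map mask triples₅)) triples₅

prefix-values : ∀ (g : Triple 6 → ℕ) ts (p q q′ : Vec Bool 10) →
  All (λ t → member (g t) (map mask triples₅) ≡ true) ts →
  values (look g ts) (pack (p Vec.++ q)) ≡ values (look g ts) (pack (p Vec.++ q′))
prefix-values g []       p q q′ []       = refl
prefix-values g (t ∷ ts) p q q′ (m ∷ ms) = cong₂ _∷_ (≡.trans (step q) (sym (step q′))) (prefix-values g ts p q q′ ms)
  where
  step : ∀ q → at (g t) (pack (p Vec.++ q)) ≡ select (Vec.take 10 masks) p false (g t)
  step q = ≡.trans (at-pack (g t) (p Vec.++ q)) (select-++ (Vec.take 10 masks) (Vec.drop 10 masks) p q false (g t) m)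

any-map-All : ∀ {P : X → Set} (p : Y → Bool) (f : X → Y) {xs} → All P xs → any p (map f xs) ≡ true →
  ∃ λ x → P x × p (f x) ≡ true
any-map-All p f {x ∷ xs} (a ∷ as) h with p (f x) in e
... | true  = x , a , e
... | false = any-map-All p f as h

generated : Word → Bool
generated = all (λ k → member k swaps)

Prefix : Word → Set
Prefix w = withinFive w ≡ true × generated w ≡ true

abstract

  relabellings-generated : All (λ w → generated w ≡ true) relabellings
  relabellings-generated = all-sound generated relabellings refl

  prefix-closed : All Prefix prefixRelabellings
  prefix-closed = All.zip (all-sound withinFive prefixRelabellings refl , all-sound generated prefixRelabellings refl)

-- Such a `w` permutes the triples on the first five vertices, so both sides of the comparison read
-- only the bits of `p`. The test made with `false` padding therefore decides for every completion
-- `q`.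
prefix-lexLess : ∀ w → withinFive w ≡ true → ∀ p q q′ →
  lexLess (take 10 (relabelled w)) (take 10 original) (pack (p Vec.++ q)) ≡
  lexLess (take 10 (relabelled w)) (take 10 original) (pack (p Vec.++ q′))
prefix-lexLess w h p q q′ = lexLess-values (take 10 (relabelled w)) (take 10 original) (pack (p Vec.++ q)) (pack (p Vec.++ q′))
  (prefix-values (λ t → mask (move w t)) triples₅ p q q′
    (all-sound (λ t → member (mask (move w t)) (map mask triples₅)) triples₅ h))
  (prefix-values mask triples₅ p q q′ (all-sound (λ t → member (mask t) (map mask triples₅)) triples₅ refl))

search-sound : ∀ prs P → search prs P ≡ true → ∀ p →
  someLess (map (λ w → take 10 (relabelled w)) prs) (take 10 original) (pack (p Vec.++ Vec.replicate 10 false)) ≡ true ⊎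
  (∀ q → P (pack (p Vec.++ q)) ≡ true)
search-sound prs P h p = map₂ (everyV-sound 10 (λ q → P (pack (p Vec.++ q)))) (∨-split
  (everyV-sound 10 (goodPrefix P (map (λ w → take 10 (relabelled w)) prs) (take 10 original)) h p))

good-sound : ∀ fss gs ass f (v : X) → good fss gs ass f v ≡ true →
  someLess fss gs v ≡ true ⊎ (someCopy ass v ≡ true ⊎ nonpositive (f v) ≡ true)
good-sound fss gs ass f v h = map₂ ∨-split (∨-split h)

sums : ThreeGraph n → List Term → ℤ
sums H τs = ∑ᴸ (λ τ → ∑ⱽ 6 (⟦ proj₁ τ ⟧ H)) τs

module _ (prs rs : List Word) (prs-ok : All Prefix prs) (rs-ok : All (λ w → generated w ≡ true) rs)
         (F : List (Triple 6)) (ws : List Word) (τs : List Term)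
         (τs-ok : all (λ τ → valid τ ∧ transversal (proj₂ τ)) τs ≡ true)
         (search-ok : search prs (goodBits rs F ws τs) ≡ true)
         {n : ℕ} (H : ThreeGraph n) (avoids : Avoids F H) where

  private
    terms-ok : All (λ τ → valid τ ∧ transversal (proj₂ τ) ≡ true) τs
    terms-ok = all-sound _ τs τs-ok

    total : Vec (Fin n) 6 → ℤ
    total x = ∑ᴸ (λ τ → full (⟦ proj₁ τ ⟧ H) x) τs

    evaluate-total : ∀ x → ∑ᴸ (λ c → evaluate c (code H x)) (map compile τs) ≡ total x
    evaluate-total x = go τs terms-ok
      where
      go : ∀ τs → All (λ τ → valid τ ∧ transversal (proj₂ τ) ≡ true) τs →
        ∑ᴸ (λ c → evaluate c (code H x)) (map compile τs) ≡ ∑ᴸ (λ τ → full (⟦ proj₁ τ ⟧ H) x) τs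
      go []             []       = refl
      go ((K , S) ∷ τs) (v ∷ vs) = cong₂ _+_
        (≡.trans (evaluate-sound H (K , S) x (proj₁ (∧-split v)))
          (symmetrised-full H K S x (proj₂ (∧-split {valid (K , S)} v)))) (go τs vs)

    measure : Vec (Fin n) 6 → ℕ
    measure x = num (map (on H x) (Vec.toList triples))

    look-on : ∀ g x y → (∀ t → at (g t) (code H x) ≡ on H y t) → ∀ ts → values (look g ts) (code H x) ≡ map (on H y) ts
    look-on g x y h []       = refl
    look-on g x y h (t ∷ ts) = cong₂ _∷_ (h t) (look-on g x y h ts)

    relabelled-values : ∀ w x → values (relabelled w) (code H x) ≡ map (on H (act w x)) (Vec.toList triples)
    relabelled-values w x = look-on (λ t → mask (move w t)) x (act w x)
      (λ t → ≡.trans (at-mask H x (move w t)) (sym (on-act H w x t))) (Vec.toList triples)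

    original-values : ∀ x → values original (code H x) ≡ map (on H x) (Vec.toList triples)
    original-values x = look-on mask x x (at-mask H x) (Vec.toList triples)

    lower : ∀ w x → lexLess (relabelled w) original (code H x) ≡ true → measure (act w x) ℕ.< measure x
    lower w x h = subst₂ (λ a b → num a ℕ.< num b) (relabelled-values w x) (original-values x)
      (lexLess-sound (relabelled w) original (code H x) refl h)

    -- Strong induction on the code. A relabelling that lowers the code keeps the total, as `full`
    -- is invariant under words of generators, so the bound is inherited from the smaller code. For
    -- the remaining codes, either a copy of `F` contradicts `avoids`, or the compiled terms were
    -- evaluated and found nonpositive.
    bounded : ∀ x → Acc ℕ._<_ (measure x) → total x ≤ 0ℤ
    bounded x (acc rec) = byPrefix (search-sound prs (goodBits rs F ws τs) search-ok p)
      where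
      v = Vec.map (on H x) triples
      p q : Vec Bool 10
      p = Vec.take 10 v
      q = Vec.drop 10 v
      split : pack (p Vec.++ q) ≡ code H x
      split = cong pack (Vec.take++drop≡id 10 v)

      descend : (∃ λ w → generated w ≡ true × lexLess (relabelled w) original (code H x) ≡ true) → total x ≤ 0ℤ
      descend (w , g , less) = subst (_≤ 0ℤ)
        (∑ᴸ-cong (λ τ → full-act (⟦ proj₁ τ ⟧ H) w x g) τs)
        (bounded (act w x) (rec (lower w x less)))

      prefix-descend : (∃ λ w → Prefix w × lexLess (take 10 (relabelled w)) (take 10 original)
        (pack (p Vec.++ Vec.replicate 10 false)) ≡ true) → total x ≤ 0ℤ
      prefix-descend (w , (within , g) , less) = descend (w , g ,
        lexLess-take 10 (relabelled w) original (code H x)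
          (subst (λ z → lexLess (take 10 (relabelled w)) (take 10 original) z ≡ true) split
            (≡.trans (prefix-lexLess w within p q (Vec.replicate 10 false)) less)))

      avoided : (∃ λ w → all (λ a → a (pack (p Vec.++ q))) (copy F w) ≡ true) → total x ≤ 0ℤ
      avoided (w , h) = ⊥-elim (avoids (act w x)
        (≡.trans (sym (copied w F)) (subst (λ z → all (λ a → a z) (copy F w) ≡ true) split h)))
        where
        copied : ∀ w F → all (λ a → a (code H x)) (copy F w) ≡ all (on H (act w x)) F
        copied w []      = refl
        copied w (t ∷ F) = cong₂ _∧_ (≡.trans (at-mask H x (move w t)) (sym (on-act H w x t))) (copied w F)

      byValue : someCopy (map (copy F) ws) (pack (p Vec.++ q)) ≡ true
        ⊎ nonpositive (∑ᴸ (λ c → evaluate c (pack (p Vec.++ q))) (map compile τs)) ≡ true → total x ≤ 0ℤ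
      byValue (inj₁ h) = avoided (any-map-sound (λ as → all (λ a → a (pack (p Vec.++ q))) as) (copy F) ws h)
      byValue (inj₂ h) = subst (_≤ 0ℤ) (evaluate-total x)
        (nonpositive-sound _ (subst (λ z → nonpositive (∑ᴸ (λ c → evaluate c z) (map compile τs)) ≡ true) split h))

      byCode : someLess (map relabelled rs) original (pack (p Vec.++ q)) ≡ true ⊎
        (someCopy (map (copy F) ws) (pack (p Vec.++ q)) ≡ true ⊎
         nonpositive (∑ᴸ (λ c → evaluate c (pack (p Vec.++ q))) (map compile τs)) ≡ true) → total x ≤ 0ℤ
      byCode (inj₁ h) = descend (subst (λ z → ∃ λ w → generated w ≡ true × lexLess (relabelled w) original z ≡ true) split
        (any-map-All (λ fs → lexLess fs original (pack (p Vec.++ q))) relabelled rs-ok h))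
      byCode (inj₂ h) = byValue h

      byPrefix : someLess (map (λ w → take 10 (relabelled w)) prs) (take 10 original) (pack (p Vec.++ Vec.replicate 10 false)) ≡ true
        ⊎ (∀ q → goodBits rs F ws τs (pack (p Vec.++ q)) ≡ true) → total x ≤ 0ℤ
      byPrefix (inj₁ h) = prefix-descend (any-map-All
        (λ fs → lexLess fs (take 10 original) (pack (p Vec.++ Vec.replicate 10 false))) (λ w → take 10 (relabelled w)) prs-ok h)
      byPrefix (inj₂ h) = byCode (good-sound (map relabelled rs) original (map (copy F) ws) (evaluateAll (map compile τs))
        (pack (p Vec.++ q)) (h q))

  -- The pointwise bound holds only after symmetrisation. A sum over all tuples does not notice a
  -- permutation of coordinates, so symmetrising merely multiplies it by 720, which cancels.
  sums-nonpositive : ∑ᴸ (λ τ → ∑ⱽ 6 (⟦ proj₁ τ ⟧ H)) τs ≤ 0ℤ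
  sums-nonpositive = *-cancelˡ-≤-pos _ 0ℤ (+ 720) (subst₂ _≤_ summed (∑ⱽ-zero n 6)
    (∑ⱽ-mono 6 λ x → bounded x (<-wellFounded (measure x))))
    where
    summed : ∑ⱽ 6 total ≡ + 720 * ∑ᴸ (λ τ → ∑ⱽ 6 (⟦ proj₁ τ ⟧ H)) τs
    summed = ≡.trans (∑ⱽ-∑ᴸ 6 (λ τ x → full (⟦ proj₁ τ ⟧ H) x) τs)
      (≡.trans (∑ᴸ-cong (λ τ → ∑ⱽ-full (⟦ proj₁ τ ⟧ H)) τs) (∑ᴸ-*ˡ (+ 720) (λ τ → ∑ⱽ 6 (⟦ proj₁ τ ⟧ H)) τs))
 

certified : ∀ F ws τs → check F ws τs ≡ true → (H : ThreeGraph n) → Avoids F H →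
  sums H τs ≤ 0ℤ
certified F ws τs ok = sums-nonpositive prefixRelabellings relabellings prefix-closed relabellings-generated F ws τs
  (proj₁ (∧-split ok)) (proj₂ (∧-split {all (λ τ → valid τ ∧ transversal (proj₂ τ)) τs} ok))

-- Decimal integers separated by single spaces; 32 is the space and 45 the minus sign.

private
  signed : Bool → ℕ → ℤ
  signed true  a = - (+ a)
  signed false a = + a

  digits : Bool → ℕ → List Char → List ℤ
  digits s a []       = signed s a ∷ []
  digits s a (c ∷ cs) = if Char.toℕ c ≡ᵇ 32 then signed s a ∷ digits false 0 cs
    else if Char.toℕ c ≡ᵇ 45 then digits true a cs
    else digits s (10 ℕ.* a ℕ.+ (Char.toℕ c ℕ.∸ 48)) cs

parse : String → List ℤ
parse s with toList s
... | []       = []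
... | c ∷ cs = digits false 0 (c ∷ cs)

-- Sums of squares

_⊕_ : List ℤ → List ℤ → List ℤ
[]       ⊕ ys       = ys
(x ∷ xs) ⊕ []       = x ∷ xs
(x ∷ xs) ⊕ (y ∷ ys) = (x + y) ∷ (xs ⊕ ys)

dot : List ℤ → List ℤ → ℤ
dot []       _        = 0ℤ
dot (x ∷ xs) []       = 0ℤ
dot (x ∷ xs) (y ∷ ys) = x * y + dot xs ys

-- A sparse vector with entries ±1: the entry at i is the sign of ±(i + 1) in the list.

entry : List ℤ → ℕ → ℤ
entry []                 i = 0ℤ
entry ((+ a) ∷ zs)       i = if a ≡ᵇ suc i then 1ℤ else entry zs i
entry (-[1+ a ] ∷ zs)    i = if a ≡ᵇ i then - 1ℤ else entry zs i

scale : ℤ → List ℤ → List ℤ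
scale (+ zero) xs = []
scale c        xs = map (c *_) xs

Block : Set
Block = List (List ℤ × List ℤ)

-- The i-th entries of the vectors ∑ⱼ Lⱼᵣ Vⱼ, one for each r.
column : ℕ → Block → List ℤ
-- Row i of a certificate has at most i entries. Starting from `length b` zeros gives all columns of
-- a block the same length, so coordinates stay aligned when the blocks are concatenated.
column i b = foldr (λ p → scale (entry (proj₁ p) i) (proj₂ p) ⊕_) (replicate (length b) 0ℤ) b

columns : ℕ → List Block → List (List ℤ)
columns k bs = map (λ i → concatMap (column i) bs) (upTo k)

nth : List (List ℤ) → ℕ → List ℤ
nth []       _       = []
nth (c ∷ cs) zero    = c
nth (c ∷ cs) (suc i) = nth cs i

index : List Bool → ℕ
index []       = 0
index (b ∷ bs) = (if b then 1 else 0) ℕ.+ 2 ℕ.* index bs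

squareValue : ℕ → List (List ℤ) → List Bool → ℤ
squareValue m cols l = dot (nth cols (index (take m l))) (nth cols (index (drop m l)))

squareTable : ℕ → List (List ℤ) → Table
-- No columns are supplied for a root 3-graph that contributes no squares; a single leaf avoids
-- tabulating zeros.
squareTable m []         = leaf 0ℤ
squareTable m (c ∷ cols) = tabulate false (m ℕ.+ m) (squareValue m (c ∷ cols))

roots : List (Triple 6)
roots = (v1 , v2 , v3) ∷ (v1 , v2 , v4) ∷ (v1 , v3 , v4) ∷ (v2 , v3 , v4) ∷ []

link : Fin 6 → List (Triple 6)
link y = (v1 , v2 , y) ∷ (v1 , v3 , y) ∷ (v2 , v3 , y) ∷ (v1 , v4 , y) ∷ (v2 , v4 , y) ∷ (v3 , v4 , y) ∷ []

pair : Fin 6 → Fin 6 → List (Triple 6)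
pair y z = (v1 , v2 , y) ∷ (v1 , v2 , z) ∷ (v1 , y , z) ∷ (v2 , y , z) ∷ []

-- Squares of combinations of flags with 4, 2 and 0 roots; in the first case the columns depend on the
-- 3-graph induced by the roots.

square₄ : (List Bool → List (List ℤ)) → Kernel
square₄ cols = kernel false (roots ++ link v5 ++ link v6) (branch 4 (λ t → squareTable 6 (cols t)))

square₂ : List (List ℤ) → Kernel
square₂ cols = kernel true (pair v3 v4 ++ pair v5 v6) (squareTable 4 cols)

square₀ : List (List ℤ) → Kernel
square₀ cols = kernel true ((v1 , v2 , v3) ∷ (v4 , v5 , v6) ∷ []) (squareTable 1 cols)

excess : ℤ → ℤ → ℤ → Table
excess c p q = node (leaf (c * (0ℤ - p))) (leaf (c * (q - p)))

edgeKernel : Table → Kernel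
edgeKernel T = kernel true ((v1 , v2 , v3) ∷ []) T

weightAt : List ℤ → ℕ → ℤ
weightAt (c ∷ w ∷ ws) i = if ∣ c ∣ ≡ᵇ i then w else weightAt ws i
weightAt _            i = 0ℤ

weight : List ℤ → List Bool → ℤ
weight ws l = weightAt ws (index l)

weighted : ℤ → ℤ → ℤ → Table
weighted (+ zero) p q = leaf 0ℤ
weighted w        p q = excess w p q

codegreeKernel : (List Bool → ℤ) → ℤ → ℤ → Kernel
codegreeKernel w p q = kernel true (triples₅ ++ (v1 , v2 , v6) ∷ []) (branch 10 (λ l → weighted (w l) p q))

require : List Bool → Table → Table
require []           T = T
require (true ∷ bs)  T = node (leaf 0ℤ) (require bs T)
require (false ∷ bs) T = node (require bs T) (leaf 0ℤ)

cherry : Fin 6 → List (Triple 6)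
cherry x = (v2 , v3 , x) ∷ (v1 , v2 , x) ∷ (v1 , v3 , x) ∷ []

-- The vertices v1, v2, v3 are a, b, c of the multiplier, and v4, v5, v6 are x, y, z. Each `cherry`
-- asks for membership in N(b,c), N(a,b), N(a,c), in this order. The factor `c` is supplied
-- negative, which turns the excess into a multiple of 0.315 - e(xyz).
linkKernel : ℤ → ℤ → ℤ → Kernel
linkKernel c p q = kernel true ((v1 , v2 , v3) ∷ cherry v4 ++ cherry v5 ++ cherry v6 ++ (v4 , v5 , v6) ∷ [])
  (require (true ∷ true ∷ false ∷ false ∷ true ∷ false ∷ false ∷ true ∷ false ∷ false ∷ []) (excess c p q))

-- Shapes: a labelling whose stabiliser is the inner group, and ascents selecting coset representatives.

sameList : List ℕ → List ℕ → Bool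
sameList []       []       = true
sameList (a ∷ as) (b ∷ bs) = (a ≡ᵇ b) ∧ sameList as bs
sameList _        _        = false

shape : Vec ℕ 6 → List (Vec ℕ 6) → List (Fin 6 × Fin 6) → Shape
shape l ls as =
  filterᵇ (λ w → any (λ m → sameList (Vec.toList (act w l)) (Vec.toList m)) (l ∷ ls)) perms ▹
  filterᵇ (λ w → all (λ p → toℕ (lookup (σ w) (proj₁ p)) ℕ.<ᵇ toℕ (lookup (σ w) (proj₂ p))) as) perms

-- In `shape₂` the second labelling admits the exchange of the two flags {v3, v4} and {v5, v6}. The
-- outer parts also enumerate labelled copies of the forbidden 3-graphs: `F42`, and `K₄⁻` with two
-- isolated vertices, have automorphisms 1 | 234 | 56, giving the 60 copies from `shape₁₃₂`; `F33`
-- has automorphisms 123 | 456, giving the 20 copies from `shape₀`.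
shape₄ shape₂ shape₀ shape₂₃ shape₁₂₃ shape₁₃₂ : Shape
shape₄   = shape (0 ∷ 0 ∷ 0 ∷ 0 ∷ 1 ∷ 1 ∷ []) [] ((v1 , v2) ∷ (v2 , v3) ∷ (v3 , v4) ∷ (v5 , v6) ∷ [])
shape₂   = shape (0 ∷ 0 ∷ 1 ∷ 1 ∷ 2 ∷ 2 ∷ []) ((0 ∷ 0 ∷ 2 ∷ 2 ∷ 1 ∷ 1 ∷ []) ∷ [])
             ((v1 , v2) ∷ (v3 , v4) ∷ (v5 , v6) ∷ (v3 , v5) ∷ [])
shape₀   = shape (0 ∷ 0 ∷ 0 ∷ 1 ∷ 1 ∷ 1 ∷ []) [] ((v1 , v2) ∷ (v2 , v3) ∷ (v4 , v5) ∷ (v5 , v6) ∷ [])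
shape₂₃  = shape (0 ∷ 0 ∷ 1 ∷ 1 ∷ 1 ∷ 2 ∷ []) [] ((v1 , v2) ∷ (v3 , v4) ∷ (v4 , v5) ∷ [])
shape₁₂₃ = shape (0 ∷ 1 ∷ 1 ∷ 2 ∷ 2 ∷ 2 ∷ []) [] ((v2 , v3) ∷ (v4 , v5) ∷ (v5 , v6) ∷ [])
shape₁₃₂ = shape (0 ∷ 1 ∷ 1 ∷ 1 ∷ 2 ∷ 2 ∷ []) [] ((v2 , v3) ∷ (v3 , v4) ∷ (v5 , v6) ∷ [])

-- Nonnegativity of the squares

dot-comm : ∀ u v → dot u v ≡ dot v u
dot-comm []      []      = refl
dot-comm []      (y ∷ v) = refl
dot-comm (x ∷ u) []      = refl
dot-comm (x ∷ u) (y ∷ v) = cong₂ _+_ (*-comm x y) (dot-comm u v)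

-- `⊕` pads the shorter list and `dot` truncates the longer one. Both amount to reading missing
-- entries as zero, so bilinearity holds without conditions on lengths.
dot-⊕ : ∀ u v w → dot (u ⊕ v) w ≡ dot u w + dot v w
dot-⊕ []      v       w       = sym (+-identityˡ _)
dot-⊕ (x ∷ u) []      w       = sym (+-identityʳ _)
dot-⊕ (x ∷ u) (y ∷ v) []      = refl
dot-⊕ (x ∷ u) (y ∷ v) (z ∷ w) = ≡.trans (cong₂ _+_ (*-distribʳ-+ z x y) (dot-⊕ u v w))
  (+-interchange (x * z) (y * z) (dot u w) (dot v w))

square-nonneg : ∀ x → 0ℤ ≤ x * x
square-nonneg (+ zero)  = ≤-refl
square-nonneg (+ suc x) = +≤+ ℕ.z≤n
square-nonneg -[1+ x ]  = +≤+ ℕ.z≤n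

dot-nonneg : ∀ u → 0ℤ ≤ dot u u
dot-nonneg []      = ≤-refl
dot-nonneg (x ∷ u) = +-mono-≤ (square-nonneg x) (dot-nonneg u)

collect : (c : Fin n → List ℤ) → ∃ λ Γ → ∀ w → ∑ (λ i → dot (c i) w) ≡ dot Γ w
collect {zero}  c = [] , λ w → refl
collect {suc n} c with collect (c ∘ suc)
... | Γ , h = c zero ⊕ Γ , λ w → ≡.trans (+-congʳ (dot (c zero) w) (h w)) (sym (dot-⊕ (c zero) Γ w))

collectⱽ : ∀ k (c : Vec (Fin n) k → List ℤ) → ∃ λ Γ → ∀ w → ∑ⱽ k (λ y → dot (c y) w) ≡ dot Γ w
collectⱽ zero    c = c [] , λ w → refl
collectⱽ (suc k) c with collect (λ i → proj₁ (collectⱽ k (c ∘ (i ∷_))))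
... | Γ , h = Γ , λ w → ≡.trans (∑-cong λ i → proj₂ (collectⱽ k (c ∘ (i ∷_))) w) (h w)

-- By bilinearity the double sum is `dot Γ Γ`, where Γ is the sum of all columns, supplied by
-- `collectⱽ`.
∑-dot-nonneg : ∀ k (c : Vec (Fin n) k → List ℤ) → 0ℤ ≤ ∑ⱽ k (λ y → ∑ⱽ k (λ z → dot (c y) (c z)))
∑-dot-nonneg k c = subst (0ℤ ≤_) (sym same) (dot-nonneg Γ)
  where
  Γ = proj₁ (collectⱽ k c)
  h = proj₂ (collectⱽ k c)
  same : ∑ⱽ k (λ y → ∑ⱽ k (λ z → dot (c y) (c z))) ≡ dot Γ Γ
  same = ≡.trans (∑ⱽ-cong k λ y → ≡.trans (∑ⱽ-cong k λ z → dot-comm (c y) (c z))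
    (≡.trans (h (c y)) (dot-comm Γ (c y)))) (h Γ)

take-values : ∀ (as bs : List (X → Bool)) v → take (length as) (values (as ++ bs) v) ≡ values as v
take-values []       bs v = refl
take-values (a ∷ as) bs v = cong (a v ∷_) (take-values as bs v)

drop-values : ∀ (as bs : List (X → Bool)) v → drop (length as) (values (as ++ bs) v) ≡ values bs v
drop-values []       bs v = refl
drop-values (a ∷ as) bs v = drop-values as bs v

walk-squareTable : ∀ cs (as bs : List (X → Bool)) v → length bs ≡ length as →
  walk (squareTable (length as) cs) (as ++ bs) v ≡ dot (nth cs (index (values as v))) (nth cs (index (values bs v)))
walk-squareTable []       as bs v h = refl
walk-squareTable (c ∷ cs) as bs v h = ≡.trans
  (cong (λ l → walk (tabulate false l (squareValue (length as) (c ∷ cs))) (as ++ bs) v)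
    (≡.trans (cong (length as ℕ.+_) (sym h)) (sym (List.length-++ as))))
  (≡.trans (walk-tabulate false (squareValue (length as) (c ∷ cs)) (as ++ bs) v)
    (cong₂ (λ l m → dot (nth (c ∷ cs) (index l)) (nth (c ∷ cs) (index m))) (take-values as bs v) (drop-values as bs v)))

asks : ThreeGraph n → List (Triple 6) → List (Vec (Fin n) 6 → Bool)
asks H = map (λ t x → on H x t)

Nonnegative : Kernel → Set
Nonnegative K = ∀ {n} (H : ThreeGraph n) → 0ℤ ≤ ∑ⱽ 6 (⟦ K ⟧ H)

-- No query contains both v5 and v6. With the four roots fixed, the two flags thus depend on one
-- free vertex each and the table entry is a dot product of two columns from the same family, so
-- `∑-dot-nonneg` applies root by root.
square₄-nonneg : ∀ cols → Nonnegative (square₄ cols)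
square₄-nonneg cols {n} H = ∑-nonneg λ a → ∑-nonneg λ b → ∑-nonneg λ c → ∑-nonneg λ d →
  subst (0ℤ ≤_) (sym (∑-cong λ y → ∑-cong λ z → value a b c d y z)) (∑-dot-nonneg {n} 1 (columnOf a b c d))
  where
  columnOf : Fin n → Fin n → Fin n → Fin n → Vec (Fin n) 1 → List ℤ
  columnOf a b c d (x ∷ []) = nth (cols (edge H a b c ∷ edge H a b d ∷ edge H a c d ∷ edge H b c d ∷ []))
    (index (edge H a b x ∷ edge H a c x ∷ edge H b c x ∷ edge H a d x ∷ edge H b d x ∷ edge H c d x ∷ []))
  value : ∀ a b c d y z → ⟦ square₄ cols ⟧ H (a ∷ b ∷ c ∷ d ∷ y ∷ z ∷ []) ≡
    dot (columnOf a b c d (y ∷ [])) (columnOf a b c d (z ∷ []))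
  value a b c d y z = ≡.trans
    (walk-branch (λ t → squareTable 6 (cols t)) (asks H roots) (asks H (link v5) ++ asks H (link v6)) x)
    (walk-squareTable (cols (values (asks H roots) x)) (asks H (link v5)) (asks H (link v6)) x refl)
    where x = a ∷ b ∷ c ∷ d ∷ y ∷ z ∷ []

square₂-nonneg : ∀ cols → Nonnegative (square₂ cols)
square₂-nonneg cols {n} H = ∑-nonneg λ a → ∑-nonneg λ b →
  subst (0ℤ ≤_) (sym (∑-cong λ w → ∑-cong λ x → ∑-cong λ y → ∑-cong λ z → value a b w x y z))
    (∑-dot-nonneg {n} 2 (columnOf a b))
  where
  columnOf : Fin n → Fin n → Vec (Fin n) 2 → List ℤ
  columnOf a b (y ∷ z ∷ []) = nth cols (index (edge H a b y ∷ edge H a b z ∷ edge H a y z ∷ edge H b y z ∷ []))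
  value : ∀ a b w x y z → ⟦ square₂ cols ⟧ H (a ∷ b ∷ w ∷ x ∷ y ∷ z ∷ []) ≡
    dot (columnOf a b (w ∷ x ∷ [])) (columnOf a b (y ∷ z ∷ []))
  value a b w x y z = walk-squareTable cols (asks H (pair v3 v4)) (asks H (pair v5 v6)) (a ∷ b ∷ w ∷ x ∷ y ∷ z ∷ []) refl

square₀-nonneg : ∀ cols → Nonnegative (square₀ cols)
square₀-nonneg cols {n} H = subst (0ℤ ≤_)
  (sym (∑-cong λ a → ∑-cong λ b → ∑-cong λ c → ∑-cong λ x → ∑-cong λ y → ∑-cong λ z → value a b c x y z))
  (∑-dot-nonneg {n} 3 columnOf)
  where
  columnOf : Vec (Fin n) 3 → List ℤ
  columnOf (x ∷ y ∷ z ∷ []) = nth cols (index (edge H x y z ∷ []))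
  value : ∀ a b c x y z → ⟦ square₀ cols ⟧ H (a ∷ b ∷ c ∷ x ∷ y ∷ z ∷ []) ≡
    dot (columnOf (a ∷ b ∷ c ∷ [])) (columnOf (x ∷ y ∷ z ∷ []))
  value a b c x y z = walk-squareTable cols (asks H ((v1 , v2 , v3) ∷ [])) (asks H ((v4 , v5 , v6) ∷ []))
    (a ∷ b ∷ c ∷ x ∷ y ∷ z ∷ []) refl

record Squares : Set where
  constructor mkSquares
  field
    columns₄         : List Bool → List (List ℤ)
    columns₂ columns₀ : List (List ℤ)
open Squares

squareTerms : Squares → List Term
squareTerms Q = (square₄ (columns₄ Q) , shape₄) ∷ (square₂ (columns₂ Q) , shape₂) ∷ (square₀ (columns₀ Q) , shape₀) ∷ []

squareTerms-nonneg : ∀ Q → All (λ τ → Nonnegative (proj₁ τ)) (squareTerms Q)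
squareTerms-nonneg Q = square₄-nonneg (columns₄ Q) ∷ square₂-nonneg (columns₂ Q) ∷ square₀-nonneg (columns₀ Q) ∷ []

sums-nonneg : ∀ (H : ThreeGraph n) {τs} → All (λ τ → Nonnegative (proj₁ τ)) τs → 0ℤ ≤ sums H τs
sums-nonneg H []       = ≤-refl
sums-nonneg H (p ∷ ps) = +-mono-≤ (p H) (sums-nonneg H ps)

two-terms : ∀ (H : ThreeGraph n) {τs} T K S S′ ρs {x y} → τs ≡ (T , S) ∷ (K , S′) ∷ ρs → sums H τs ≤ 0ℤ →
  x ≤ ∑ⱽ 6 (⟦ T ⟧ H) → y ≤ ∑ⱽ 6 (⟦ K ⟧ H) → 0ℤ ≤ sums H ρs → x + y ≤ 0ℤ
two-terms H T K S S′ ρs {x} {y} refl h hx hy hρ = ≤-trans (+-mono-≤ hx (≤-trans (≤-reflexive (sym (+-identityʳ y))) (+-mono-≤ hy hρ))) h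

-- Sums over tuples in which only some of the vertices matter

∑³ : ∀ {n} → (Fin n → Fin n → Fin n → ℤ) → ℤ
∑³ f = ∑ λ a → ∑ λ b → ∑ λ c → f a b c

∑³-cong : {f g : Fin n → Fin n → Fin n → ℤ} → (∀ a b c → f a b c ≡ g a b c) → ∑³ f ≡ ∑³ g
∑³-cong h = ∑-cong λ a → ∑-cong λ b → ∑-cong λ c → h a b c

∑³-*ˡ : ∀ k (f : Fin n → Fin n → Fin n → ℤ) → ∑³ (λ a b c → k * f a b c) ≡ k * ∑³ f
∑³-*ˡ k f = ≡.trans (∑-cong λ a → ≡.trans (∑-cong λ b → ∑-*ˡ k (f a b)) (∑-*ˡ k λ b → ∑ (f a b)))
  (∑-*ˡ k λ a → ∑ λ b → ∑ (f a b))

∑³-const : ∀ n k → ∑³ {n} (λ _ _ _ → k) ≡ + (n ℕ.* (n ℕ.* n)) * k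
∑³-const n k = ≡.trans (∑-cong {n} λ _ → ≡.trans (∑-cong {n} λ _ → ∑-const n k) (∑-const n (+ n * k)))
  (≡.trans (∑-const n (+ n * (+ n * k))) (≡.trans (sym (*-assoc (+ n) (+ n) (+ n * k)))
  (≡.trans (sym (*-assoc (+ n * + n) (+ n) k)) (cong (_* k) (≡.trans (*-assoc (+ n) (+ n) (+ n))
    (≡.trans (cong (+ n *_) (sym (pos-* n n))) (sym (pos-* n (n ℕ.* n)))))))))

excessOf : ℤ → ℤ → ThreeGraph n → ℤ
excessOf p q H = ∑³ λ a b c → (if edge H a b c then q else 0ℤ) - p

answer : Table → Bool → ℤ
answer T b = walk T ((λ _ → b) ∷ []) b

edge-sum : ∀ T (H : ThreeGraph n) → ∑ⱽ 6 (⟦ edgeKernel T ⟧ H) ≡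
  + (n ℕ.* (n ℕ.* n)) * ∑³ (λ a b c → answer T (edge H a b c))
edge-sum {n} T H = ≡.trans (∑³-cong {n} λ a b c → ≡.trans
    (∑³-cong {n} {f = λ x y z → ⟦ edgeKernel T ⟧ H (a ∷ b ∷ c ∷ x ∷ y ∷ z ∷ [])} λ x y z →
      walk-cong T {asks H ((v1 , v2 , v3) ∷ [])} {(λ _ → edge H a b c) ∷ []} (a ∷ b ∷ c ∷ x ∷ y ∷ z ∷ []) (edge H a b c) refl)
    (∑³-const n (answer T (edge H a b c))))
  (∑³-*ˡ (+ (n ℕ.* (n ℕ.* n))) λ a b c → answer T (edge H a b c))

answer-excess : ∀ c p q b → answer (excess c p q) b ≡ c * ((if b then q else 0ℤ) - p)
answer-excess c p q true  = refl
answer-excess c p q false = refl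

excess-sum : ∀ c p q (H : ThreeGraph n) → ∑ⱽ 6 (⟦ edgeKernel (excess c p q) ⟧ H) ≡
  + (n ℕ.* (n ℕ.* n)) * (c * excessOf p q H)
excess-sum {n} c p q H = ≡.trans (edge-sum (excess c p q) H) (cong (+ (n ℕ.* (n ℕ.* n)) *_)
  (≡.trans (∑³-cong {n} λ a b d → answer-excess c p q (edge H a b d))
    (∑³-*ˡ c λ a b d → (if edge H a b d then q else 0ℤ) - p)))

cancel-pos : ∀ c x → + suc c * x ≤ 0ℤ → x ≤ 0ℤ
cancel-pos c x h = *-cancelˡ-≤-pos x 0ℤ (+ suc c) (subst (+ suc c * x ≤_) (sym (*-zeroʳ (+ suc c))) h)

excess-nonpositive : ∀ c p q (H : ThreeGraph n) → ∑ⱽ 6 (⟦ edgeKernel (excess (+ suc c) p q) ⟧ H) ≤ 0ℤ →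
  excessOf p q H ≤ 0ℤ
excess-nonpositive {zero}  c p q H h = ≤-refl
excess-nonpositive {suc n} c p q H h = cancel-pos c (excessOf p q H)
  -- This argument is (n + 1)³ - 1, in the form to which the cube of `suc n` reduces; the other
  -- three vertices of the tuple contribute this cube.
  (cancel-pos (n ℕ.+ n ℕ.* suc n ℕ.+ n ℕ.* (suc n ℕ.* suc n)) (+ suc c * excessOf p q H)
    (subst (_≤ 0ℤ) (excess-sum {suc n} (+ suc c) p q H) h))

first-nonpositive : ∀ {x y : ℤ} → x + y ≤ 0ℤ → 0ℤ ≤ y → x ≤ 0ℤ
first-nonpositive {x} {y} h p = ≤-trans (subst (_≤ x + y) (+-identityʳ x) (+-monoʳ-≤ x p)) h

-- K₄⁻-free 3-graphs

K₄⁻ : List (Triple 6)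
K₄⁻ = (v1 , v2 , v3) ∷ (v1 , v2 , v4) ∷ (v1 , v3 , v4) ∷ []

K₄⁻-terms : Squares → List Term
K₄⁻-terms Q = (edgeKernel (excess (+ 1388) (+ 315) (+ 1000)) , shape₀) ∷ squareTerms Q

K₄⁻-bound : ∀ Q → check K₄⁻ (outer shape₁₃₂) (K₄⁻-terms Q) ≡ true →
  (H : ThreeGraph n) → Avoids K₄⁻ H → excessOf (+ 315) (+ 1000) H ≤ 0ℤ
K₄⁻-bound Q ok H avoids = excess-nonpositive 1387 (+ 315) (+ 1000) H (first-nonpositive
  (certified K₄⁻ (outer shape₁₃₂) (K₄⁻-terms Q) ok H avoids) (sums-nonneg H (squareTerms-nonneg Q)))

-- Induced 3-graphs on subsets of the vertices

pullback : ∀ {m} → (Fin m → Fin n) → ThreeGraph n → ThreeGraph m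
pullback φ H = record
  { edge   = λ a b c → edge H (φ a) (φ b) (φ c)
  ; sym₁₂  = λ a b c → sym₁₂ H (φ a) (φ b) (φ c)
  ; sym₂₃  = λ a b c → sym₂₃ H (φ a) (φ b) (φ c)
  ; irrefl = λ a c → irrefl H (φ a) (φ c) }

-- That each element of the subset is listed exactly once is recorded through `φ-∑`. In this form
-- restricted sums become sums over `Fin size`, so that a bound for all 3-graphs applies to an
-- induced one.
record Enumeration (p : Fin n → Bool) : Set where
  field
    size : ℕ
    φ    : Fin size → Fin n
    φ-in : ∀ i → p (φ i) ≡ true
    φ-∑  : ∀ (g : Fin n → ℤ) → ∑ (λ x → if p x then g x else 0ℤ) ≡ ∑ {size} (λ i → g (φ i))

enumerate : (p : Fin n → Bool) → Enumeration p
enumerate {zero}  p = record { size = 0 ; φ = λ () ; φ-in = λ () ; φ-∑ = λ g → refl }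
enumerate {suc n} p = add (p zero) refl
  where
  open Enumeration (enumerate (p ∘ suc))
  add : ∀ b → p zero ≡ b → Enumeration p
  add true  e = record
    { size = suc size
    ; φ    = λ { zero → zero ; (suc i) → suc (φ i) }
    ; φ-in = λ { zero → e ; (suc i) → φ-in i }
    ; φ-∑  = λ g → cong₂ (λ b s → (if b then g zero else 0ℤ) + s) e (φ-∑ (g ∘ suc)) }
  add false e = record
    { size = size
    ; φ    = suc ∘ φ
    ; φ-in = φ-in
    ; φ-∑  = λ g → ≡.trans (cong₂ (λ b s → (if b then g zero else 0ℤ) + s) e (φ-∑ (g ∘ suc))) (+-identityˡ _) }

if-∑ : ∀ b (g : Fin n → ℤ) → ∑ (λ x → if b then g x else 0ℤ) ≡ (if b then ∑ g else 0ℤ)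
if-∑     true  g = refl
if-∑ {n} false g = ∑-zero n

∑³-restrict : ∀ (p : Fin n → Bool) (g : Fin n → Fin n → Fin n → ℤ) → let open Enumeration (enumerate p) in
  ∑³ (λ x y z → if p x then (if p y then (if p z then g x y z else 0ℤ) else 0ℤ) else 0ℤ) ≡
  ∑³ (λ i j k → g (φ i) (φ j) (φ k))
∑³-restrict p g = ≡.trans (∑-cong λ x → ≡.trans (∑-cong λ y → ≡.trans
    (if-∑ (p x) (λ z → if p y then (if p z then g x y z else 0ℤ) else 0ℤ))
    (cong (λ s → if p x then s else 0ℤ) (≡.trans (if-∑ (p y) (λ z → if p z then g x y z else 0ℤ))
      (cong (λ s → if p y then s else 0ℤ) (φ-∑ (g x y))))))
  (≡.trans (if-∑ (p x) (λ y → if p y then ∑ (λ k → g x y (φ k)) else 0ℤ))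
    (cong (λ s → if p x then s else 0ℤ) (φ-∑ λ y → ∑ λ k → g x y (φ k)))))
  (φ-∑ λ x → ∑ λ j → ∑ λ k → g x (φ j) (φ k))
  where open Enumeration (enumerate p)

-- Links in F₄,₂-free 3-graphs

all-complete : ∀ (p : X → Bool) {xs} → All (λ x → p x ≡ true) xs → all p xs ≡ true
all-complete p []       = refl
all-complete p (e ∷ es) = cong₂ _∧_ e (all-complete p es)

inCherry : ThreeGraph n → (a b c : Fin n) → Fin n → Bool
inCherry H a b c v = edge H b c v ∧ (not (edge H a b v) ∧ not (edge H a c v))

cherries : ∀ (H : ThreeGraph n) a b c → Enumeration (inCherry H a b c)
cherries H a b c = enumerate (inCherry H a b c)

-- `F42` is `K₄⁻` on 1, 2, 3, 4 with each of these vertices joined to the pair 56. A copy of `K₄⁻`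
-- inside N(b,c) is therefore completed to `F42` by b and c.
cherry-avoids : ∀ (H : ThreeGraph n) a b c → Avoids F42 H → Avoids K₄⁻ (pullback (Enumeration.φ (cherries H a b c)) H)
cherry-avoids {n} H a b c avoids y@(w ∷ x ∷ z ∷ t ∷ _) h =
  avoids v (all-complete (on H v) (extend (all-sound (on (pullback φ H) y) K₄⁻ h)))
  where
  open Enumeration (cherries H a b c)
  v : Vec (Fin n) 6
  v = φ w ∷ φ x ∷ φ z ∷ φ t ∷ b ∷ c ∷ []
  joined : ∀ i → edge H (φ i) b c ≡ true
  joined i = ≡.trans (sym₁₂ H (φ i) b c) (≡.trans (sym₂₃ H b (φ i) c) (proj₁ (∧-split (φ-in i))))
  extend : All (λ s → on (pullback φ H) y s ≡ true) K₄⁻ → All (λ s → on H v s ≡ true) F42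
  extend (e₁ ∷ e₂ ∷ e₃ ∷ []) = e₁ ∷ e₂ ∷ e₃ ∷ joined w ∷ joined x ∷ joined z ∷ joined t ∷ []

if-cherry : ∀ u v w (s : ℤ) →
  (if u then (if v then 0ℤ else (if w then 0ℤ else s)) else 0ℤ) ≡ (if u ∧ (not v ∧ not w) then s else 0ℤ)
if-cherry false v     w     s = refl
if-cherry true  true  w     s = refl
if-cherry true  false true  s = refl
if-cherry true  false false s = refl

∑³-if : ∀ b (f : Fin n → Fin n → Fin n → ℤ) → 0ℤ ≤ ∑³ f → 0ℤ ≤ ∑³ (λ x y z → if b then f x y z else 0ℤ)
∑³-if     true  f h = h
∑³-if {n} false f h = ∑-nonneg {n} λ x → ∑-nonneg {n} λ y → ∑-nonneg {n} λ z → ≤-refl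

neg-*-nonneg : ∀ h x → x ≤ 0ℤ → 0ℤ ≤ (- + h) * x
neg-*-nonneg zero    x            p = ≤-refl
neg-*-nonneg (suc h) (+ zero)     p = ≤-reflexive (sym (*-zeroʳ (- + suc h)))
neg-*-nonneg (suc h) -[1+ x ]     p = +≤+ ℕ.z≤n
neg-*-nonneg (suc h) (+ suc x)    (+≤+ ())

-- For a fixed edge abc the sum over x, y, z is -h times the excess of the 3-graph induced on the
-- vertices in `inCherry H a b c`, which avoids `K₄⁻`. For a non-edge it vanishes.
link-nonneg : ∀ h (H : ThreeGraph n) → Avoids F42 H →
  (∀ {m} (G : ThreeGraph m) → Avoids K₄⁻ G → excessOf (+ 315) (+ 1000) G ≤ 0ℤ) →
  0ℤ ≤ ∑ⱽ 6 (⟦ linkKernel (- + h) (+ 315) (+ 1000) ⟧ H)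
link-nonneg {n} h H avoids bound = ∑-nonneg λ a → ∑-nonneg λ b → ∑-nonneg λ c →
  subst (0ℤ ≤_) (sym (∑³-cong {n} (value a b c))) (∑³-if {n} (edge H a b c) (inside a b c)
    (subst (0ℤ ≤_) (sym (restricted a b c)) (neg-*-nonneg h (excessOf (+ 315) (+ 1000) (part a b c)) (bound (part a b c) (cherry-avoids H a b c avoids)))))
  where
  part : ∀ a b c → ThreeGraph (Enumeration.size (cherries H a b c))
  part a b c = pullback (Enumeration.φ (cherries H a b c)) H
  V : Bool → ℤ
  V e = (- + h) * ((if e then + 1000 else 0ℤ) - + 315)
  inside : ∀ a b c x y z → ℤ
  inside a b c x y z = if inCherry H a b c x then (if inCherry H a b c y then
    (if inCherry H a b c z then V (edge H x y z) else 0ℤ) else 0ℤ) else 0ℤ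
  answerV : ∀ e → (if e then (- + h) * (+ 1000 - + 315) else (- + h) * (0ℤ - + 315)) ≡ V e
  answerV true  = refl
  answerV false = refl
  value : ∀ a b c x y z → ⟦ linkKernel (- + h) (+ 315) (+ 1000) ⟧ H (a ∷ b ∷ c ∷ x ∷ y ∷ z ∷ []) ≡
    (if edge H a b c then inside a b c x y z else 0ℤ)
  value a b c x y z = cong (λ s → if edge H a b c then s else 0ℤ)
    (≡.trans (if-cherry (edge H b c x) (edge H a b x) (edge H a c x) _)
    (cong (λ s → if inCherry H a b c x then s else 0ℤ)
    (≡.trans (if-cherry (edge H b c y) (edge H a b y) (edge H a c y) _)
    (cong (λ s → if inCherry H a b c y then s else 0ℤ)
    (≡.trans (if-cherry (edge H b c z) (edge H a b z) (edge H a c z) _)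
    (cong (λ s → if inCherry H a b c z then s else 0ℤ) (answerV (edge H x y z))))))))
  restricted : ∀ a b c → ∑³ (inside a b c) ≡ (- + h) * excessOf (+ 315) (+ 1000) (part a b c)
  restricted a b c = ≡.trans (∑³-restrict (inCherry H a b c) (λ x y z → V (edge H x y z)))
    (∑³-*ˡ (- + h) (λ i j k → (if edge (part a b c) i j k then + 1000 else 0ℤ) - + 315))

F₄₂-terms : Squares → List Term
F₄₂-terms Q = (edgeKernel (excess (+ 206) (+ 4933327) (+ 10000000)) , shape₀) ∷
  -- The dual weight of the link inequality, on the integer scale on which the quantity to be
  -- bounded has coefficient 206.
  (linkKernel (- + 11829169) (+ 315) (+ 1000) , shape₁₂₃) ∷ squareTerms Q

F₄₂-bound : ∀ Q Q′ → check K₄⁻ (outer shape₁₃₂) (K₄⁻-terms Q) ≡ true → check F42 (outer shape₁₃₂) (F₄₂-terms Q′) ≡ true →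
  (H : ThreeGraph n) → Avoids F42 H → excessOf (+ 4933327) (+ 10000000) H ≤ 0ℤ
F₄₂-bound Q Q′ ok ok′ H avoids = excess-nonpositive 205 (+ 4933327) (+ 10000000) H (first-nonpositive
  (certified F42 (outer shape₁₃₂) (F₄₂-terms Q′) ok′ H avoids)
  (+-mono-≤ (link-nonneg 11829169 H avoids (K₄⁻-bound Q ok)) (sums-nonneg H (squareTerms-nonneg Q′))))

-- Homomorphic images of F are copies of F, as every pair of vertices of F is covered by an edge.

pairs : Triple 6 → List (Fin 6 × Fin 6)
pairs (i , j , k) = (i , j) ∷ (j , i) ∷ (i , k) ∷ (k , i) ∷ (j , k) ∷ (k , j) ∷ []

Covering : List (Triple 6) → Set
Covering F = ∀ i j → i ≡ j ⊎ Any (λ t → (i , j) ∈ pairs t) F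

covering? : ∀ F → Dec (Covering F)
covering? F = Fin.all? λ i → Fin.all? λ j → (i Fin.≟ j) ⊎-dec
  any? (λ t → _∈?_ (≡-dec Fin._≟_ Fin._≟_) (i , j) (pairs t)) F

pairs-distinct : ∀ (H : ThreeGraph n) x t → on H x t ≡ true → All (λ { (i , j) → lookup x i ≢ lookup x j }) (pairs t)
pairs-distinct H x (i , j , k) h = ij ∷ ≢-sym ij ∷ ik ∷ ≢-sym ik ∷ jk ∷ ≢-sym jk ∷ []
  where
  absurd : ∀ {a b c} → edge H a b c ≡ true → a ≡ b ⊎ b ≡ c ⊎ a ≡ c → ⊥
  absurd e d with () ← ≡.trans (sym e) (edge-degenerate H d)
  ij : lookup x i ≢ lookup x j
  ij e = absurd h (inj₁ e)
  jk : lookup x j ≢ lookup x k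
  jk e = absurd h (inj₂ (inj₁ e))
  ik : lookup x i ≢ lookup x k
  ik e = absurd h (inj₂ (inj₂ e))

free⇒avoids : ∀ F → Covering F → (H : ThreeGraph n) → Free F H → Avoids F H
free⇒avoids F covering H free x h = free (lookup x , injective , All.map (λ {t} e → e) edges)
  where
  edges : All (λ t → on H x t ≡ true) F
  edges = all-sound (on H x) F h
  distinct : ∀ {F i j} → All (λ t → on H x t ≡ true) F → Any (λ t → (i , j) ∈ pairs t) F → lookup x i ≢ lookup x j
  distinct (e ∷ es) (here m)  = All.lookup (pairs-distinct H x _ e) m
  distinct (e ∷ es) (there a) = distinct es a
  injective : ∀ {i j} → lookup x i ≡ lookup x j → i ≡ j
  injective {i} {j} e with covering i j
  ... | inj₁ i≡j = i≡j
  ... | inj₂ a   = ⊥-elim (distinct edges a e)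

𝟙 : Bool → ℤ
𝟙 b = if b then 1ℤ else 0ℤ

-- The number of edges

count-∑ : ∀ (p : Fin n → Bool) → + count p ≡ ∑ (𝟙 ∘ p)
count-∑ {zero}  p = refl
count-∑ {suc n} p with p zero
... | true  = ≡.trans (pos-+ 1 (count (p ∘ suc))) (+-congʳ 1ℤ (count-∑ (p ∘ suc)))
... | false = ≡.trans (count-∑ (p ∘ suc)) (sym (+-identityˡ _))

sumFin-∑ : ∀ (f : Fin n → ℕ) → + sumFin f ≡ ∑ (λ i → + f i)
sumFin-∑ {zero}  f = refl
sumFin-∑ {suc n} f = ≡.trans (pos-+ (f zero) (sumFin (f ∘ suc))) (+-congʳ (+ f zero) (sumFin-∑ (f ∘ suc)))

increasing : ThreeGraph n → Fin n → Fin n → Fin n → ℤ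
increasing H i j k = 𝟙 ((i <F j) ∧ (j <F k) ∧ edge H i j k)

numEdges-∑ : ∀ (H : ThreeGraph n) → + numEdges H ≡ ∑³ (increasing H)
numEdges-∑ {n} H = ≡.trans (sumFin-∑ (λ i → sumFin (ups i))) (∑-cong λ i → ≡.trans (sumFin-∑ (ups i))
  (∑-cong λ j → count-∑ (λ k → (i <F j) ∧ (j <F k) ∧ edge H i j k)))
  where
  ups : Fin n → Fin n → ℕ
  ups i j = count λ k → (i <F j) ∧ (j <F k) ∧ edge H i j k

orders : (a b c a′ b′ c′ : Bool) → ℤ
orders a b c a′ b′ c′ = 𝟙 (a ∧ b) + (𝟙 (a′ ∧ c) + (𝟙 (c ∧ b′) + (𝟙 (b ∧ c′) + (𝟙 (c′ ∧ a) + 𝟙 (b′ ∧ a′)))))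

atMostOne : Vec Bool 6 → Bool
atMostOne (a ∷ b ∷ c ∷ a′ ∷ b′ ∷ c′ ∷ []) =
  (a ∧ a′) ∨ ((b ∧ b′) ∨ ((c ∧ c′) ∨ ((a ∧ (b ∧ c′)) ∨ ((b′ ∧ (a′ ∧ c)) ∨ nonpositive (orders a b c a′ b′ c′ - 1ℤ)))))

∨-resolve : ∀ {a b} → a ∨ b ≡ true → ¬ (a ≡ true) → b ≡ true
∨-resolve {true}  h ¬a = ⊥-elim (¬a refl)
∨-resolve {false} h ¬a = h

<ᵇ-true : ∀ {m n} → (m ℕ.<ᵇ n) ≡ true → m ℕ.< n
<ᵇ-true {m} {n} e = ℕ.<ᵇ⇒< m n (subst T (sym e) _)

-- Of the 64 patterns of truth values for the six comparisons, those violating asymmetry or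
-- containing one of the two 3-cycles are ruled out; in each of the others at most one of the six
-- strict orders holds, as `atMostOne` verifies by enumeration.
orders≤1 : ∀ i j k → orders (i ℕ.<ᵇ j) (j ℕ.<ᵇ k) (i ℕ.<ᵇ k) (j ℕ.<ᵇ i) (k ℕ.<ᵇ j) (k ℕ.<ᵇ i) ≤ 1ℤ
orders≤1 i j k = i-j≤0⇒i≤j (nonpositive-sound _ (∨-resolve {b′ ∧ (a′ ∧ c)} (∨-resolve {a ∧ (b ∧ c′)}
  (∨-resolve {c ∧ c′} (∨-resolve {b ∧ b′} (∨-resolve {a ∧ a′}
  (everyV-sound 6 atMostOne refl (a ∷ b ∷ c ∷ a′ ∷ b′ ∷ c′ ∷ []))
  (asym i j)) (asym j k)) (asym i k)) (cycle i j k)) (cycle k j i)))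
  where
  a = i ℕ.<ᵇ j
  b = j ℕ.<ᵇ k
  c = i ℕ.<ᵇ k
  a′ = j ℕ.<ᵇ i
  b′ = k ℕ.<ᵇ j
  c′ = k ℕ.<ᵇ i
  asym : ∀ i j → ¬ ((i ℕ.<ᵇ j) ∧ (j ℕ.<ᵇ i) ≡ true)
  asym i j h = ℕ.<-asym (<ᵇ-true {i} {j} (proj₁ (∧-split h))) (<ᵇ-true {j} {i} (proj₂ (∧-split {i ℕ.<ᵇ j} h)))
  cycle : ∀ i j k → ¬ ((i ℕ.<ᵇ j) ∧ ((j ℕ.<ᵇ k) ∧ (k ℕ.<ᵇ i)) ≡ true)
  cycle i j k h = ℕ.<-asym (ℕ.<-trans (<ᵇ-true {i} {j} (proj₁ (∧-split h))) (<ᵇ-true {j} {k} (proj₁ (∧-split t))))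
    (<ᵇ-true {k} {i} (proj₂ (∧-split {j ℕ.<ᵇ k} t)))
    where t = proj₂ (∧-split {i ℕ.<ᵇ j} h)

six : (Fin n → Fin n → Fin n → ℤ) → Fin n → Fin n → Fin n → ℤ
six f i j k = f i j k + (f j i k + (f i k j + (f j k i + (f k i j + f k j i))))

𝟙-∧ : ∀ e a b c a′ b′ c′ → 𝟙 (a ∧ b ∧ e) + (𝟙 (a′ ∧ c ∧ e) + (𝟙 (c ∧ b′ ∧ e) +
  (𝟙 (b ∧ c′ ∧ e) + (𝟙 (c′ ∧ a ∧ e) + 𝟙 (b′ ∧ a′ ∧ e))))) ≡ (if e then orders a b c a′ b′ c′ else 0ℤ)
𝟙-∧ true  a b c a′ b′ c′ rewrite Bool.∧-identityʳ a | Bool.∧-identityʳ b | Bool.∧-identityʳ c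
  | Bool.∧-identityʳ a′ | Bool.∧-identityʳ b′ | Bool.∧-identityʳ c′ = refl
𝟙-∧ false a b c a′ b′ c′ = cong₂ _+_ (zeros a b) (cong₂ _+_ (zeros a′ c) (cong₂ _+_ (zeros c b′)
  (cong₂ _+_ (zeros b c′) (cong₂ _+_ (zeros c′ a) (zeros b′ a′)))))
  where
  zeros : ∀ x y → 𝟙 (x ∧ y ∧ false) ≡ 0ℤ
  zeros false y     = refl
  zeros true  false = refl
  zeros true  true  = refl

six-increasing : ∀ (H : ThreeGraph n) i j k → six (increasing H) i j k ≤ 𝟙 (edge H i j k)
-- Symmetry brings all six edge bits to `edge H i j k`, which leaves the indicators of the six
-- strict orders.
six-increasing H i j k rewrite sym₁₂ H j i k | sym₂₃ H i k j | sym₂₃ H j k i | sym₁₂ H j i k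
  | sym₁₂ H k i j | sym₂₃ H i k j | sym₁₂ H k j i | sym₂₃ H j k i | sym₁₂ H j i k =
  subst (_≤ 𝟙 (edge H i j k)) (sym (𝟙-∧ (edge H i j k) (i <F j) (j <F k) (i <F k) (j <F i) (k <F j) (k <F i)))
    (bound (edge H i j k))
  where
  bound : ∀ e → (if e then orders (i <F j) (j <F k) (i <F k) (j <F i) (k <F j) (k <F i) else 0ℤ) ≤ 𝟙 e
  bound true  = orders≤1 (toℕ i) (toℕ j) (toℕ k)
  bound false = ≤-refl

∑³-+ : (f g : Fin n → Fin n → Fin n → ℤ) → ∑³ (λ a b c → f a b c + g a b c) ≡ ∑³ f + ∑³ g
∑³-+ f g = ≡.trans (∑-cong λ a → ≡.trans (∑-cong λ b → ∑-+ (f a b) (g a b)) (∑-+ (λ b → ∑ (f a b)) (λ b → ∑ (g a b))))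
  (∑-+ (λ a → ∑ λ b → ∑ (f a b)) (λ a → ∑ λ b → ∑ (g a b)))

∑³-mono : {f g : Fin n → Fin n → Fin n → ℤ} → (∀ a b c → f a b c ≤ g a b c) → ∑³ f ≤ ∑³ g
∑³-mono h = ∑-mono λ a → ∑-mono λ b → ∑-mono λ c → h a b c

∑³-six : (f : Fin n → Fin n → Fin n → ℤ) → ∑³ (six f) ≡ + 6 * ∑³ f
∑³-six {n} f = ≡.trans (∑³-+ f _) (≡.trans (+-congʳ s (≡.trans (∑³-+ f₂ _) (cong₂ _+_ e₂
  (≡.trans (∑³-+ f₃ _) (cong₂ _+_ e₃ (≡.trans (∑³-+ f₄ _) (cong₂ _+_ e₄ (≡.trans (∑³-+ f₅ f₆) (cong₂ _+_ e₅ e₆)))))))))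
  (sixfold s))
  where
  s = ∑³ f
  f₂ f₃ f₄ f₅ f₆ : Fin n → Fin n → Fin n → ℤ
  f₂ i j k = f j i k
  f₃ i j k = f i k j
  f₄ i j k = f j k i
  f₅ i j k = f k i j
  f₆ i j k = f k j i
  swap₁₂ : ∀ (g : Fin n → Fin n → Fin n → ℤ) → ∑³ (λ i j k → g j i k) ≡ ∑³ g
  swap₁₂ g = ∑-swap (λ i j → ∑ λ k → g j i k)
  swap₂₃ : ∀ (g : Fin n → Fin n → Fin n → ℤ) → ∑³ (λ i j k → g i k j) ≡ ∑³ g
  swap₂₃ g = ∑-cong λ i → ∑-swap (λ j k → g i k j)
  e₂ = swap₁₂ f
  e₃ = swap₂₃ f
  e₄ : ∑³ f₄ ≡ s
  e₄ = ≡.trans (swap₁₂ f₃) e₃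
  e₅ : ∑³ f₅ ≡ s
  e₅ = ≡.trans (swap₂₃ f₂) e₂
  e₆ : ∑³ f₆ ≡ s
  e₆ = ≡.trans (swap₁₂ f₅) e₅
  sixfold : ∀ s → s + (s + (s + (s + (s + s)))) ≡ + 6 * s
  sixfold = solve-∀

6numEdges≤ : ∀ (H : ThreeGraph n) → + 6 * + numEdges H ≤ ∑³ (λ i j k → 𝟙 (edge H i j k))
6numEdges≤ H = subst (_≤ ∑³ (λ i j k → 𝟙 (edge H i j k)))
  (≡.trans (∑³-six (increasing H)) (cong (+ 6 *_) (sym (numEdges-∑ H)))) (∑³-mono (six-increasing H))

excess-edges : ∀ p q (H : ThreeGraph n) → excessOf (+ p) (+ q) H ≡
  + q * ∑³ (λ i j k → 𝟙 (edge H i j k)) - + (n ℕ.* (n ℕ.* n)) * + p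
excess-edges {n} p q H = ≡.trans (∑³-+ (λ i j k → if edge H i j k then + q else 0ℤ) (λ _ _ _ → - + p))
  (cong₂ _+_ (≡.trans (∑³-cong {n} λ i j k → q𝟙 (edge H i j k)) (∑³-*ˡ (+ q) λ i j k → 𝟙 (edge H i j k)))
    (≡.trans (∑³-const n (- + p)) (sym (neg-distribʳ-* (+ (n ℕ.* (n ℕ.* n))) (+ p)))))
  where
  q𝟙 : ∀ b → (if b then + q else 0ℤ) ≡ + q * 𝟙 b
  q𝟙 true  = sym (*-identityʳ (+ q))
  q𝟙 false = sym (*-zeroʳ (+ q))

numEdges-bound : ∀ p q (H : ThreeGraph n) → excessOf (+ p) (+ q) H ≤ 0ℤ → 6 ℕ.* numEdges H ℕ.* q ℕ.≤ n ℕ.* (n ℕ.* n) ℕ.* p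
numEdges-bound {n} p q H h = drop‿+≤+ (≤-trans (≤-reflexive lhs) (≤-trans (*-monoˡ-≤-nonNeg (+ q) (6numEdges≤ H))
  (≤-trans (i-j≤0⇒i≤j (subst (_≤ 0ℤ) (excess-edges p q H) h)) (≤-reflexive (sym (pos-* (n ℕ.* (n ℕ.* n)) p))))))
  where
  lhs : + (6 ℕ.* numEdges H ℕ.* q) ≡ + q * (+ 6 * + numEdges H)
  lhs = ≡.trans (cong +_ (ℕ.*-comm (6 ℕ.* numEdges H) q)) (≡.trans (pos-* q (6 ℕ.* numEdges H))
    (cong (+ q *_) (pos-* 6 (numEdges H))))

-- Binomial coefficients and the Turán density

2C₂ : ∀ k → 2 ℕ.* (suc k C 2) ≡ suc k ℕ.* k
2C₂ zero    = refl
2C₂ (suc k) = begin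
  2 ℕ.* (suc (suc k) C 2)             ≡⟨ cong (2 ℕ.*_) (sym (nCk+nC[k+1]≡[n+1]C[k+1] (suc k) 1)) ⟩
  2 ℕ.* (suc k C 1 ℕ.+ suc k C 2)     ≡⟨ cong (λ z → 2 ℕ.* (z ℕ.+ suc k C 2)) (nC1≡n (suc k)) ⟩
  2 ℕ.* (suc k ℕ.+ suc k C 2)         ≡⟨ ℕ.*-distribˡ-+ 2 (suc k) (suc k C 2) ⟩
  2 ℕ.* suc k ℕ.+ 2 ℕ.* (suc k C 2)   ≡⟨ cong (2 ℕ.* suc k ℕ.+_) (2C₂ k) ⟩
  2 ℕ.* suc k ℕ.+ suc k ℕ.* k         ≡⟨ step k ⟩
  suc (suc k) ℕ.* suc k               ∎
  where
  open ≡-Reasoning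
  step : ∀ k → 2 ℕ.* suc k ℕ.+ suc k ℕ.* k ≡ suc (suc k) ℕ.* suc k
  step = ℕ-solver.solve-∀

6C₃ : ∀ k → 6 ℕ.* (suc (suc k) C 3) ≡ suc (suc k) ℕ.* (suc k ℕ.* k)
6C₃ zero    = refl
6C₃ (suc k) = begin
  6 ℕ.* (suc (suc (suc k)) C 3)                                      ≡⟨ cong (6 ℕ.*_) (sym (nCk+nC[k+1]≡[n+1]C[k+1] (suc (suc k)) 2)) ⟩
  6 ℕ.* (suc (suc k) C 2 ℕ.+ suc (suc k) C 3)                        ≡⟨ split (suc (suc k) C 2) (suc (suc k) C 3) ⟩
  3 ℕ.* (2 ℕ.* (suc (suc k) C 2)) ℕ.+ 6 ℕ.* (suc (suc k) C 3)        ≡⟨ cong₂ (λ y z → 3 ℕ.* y ℕ.+ z) (2C₂ (suc k)) (6C₃ k) ⟩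
  3 ℕ.* (suc (suc k) ℕ.* suc k) ℕ.+ suc (suc k) ℕ.* (suc k ℕ.* k)    ≡⟨ step k ⟩
  suc (suc (suc k)) ℕ.* (suc (suc k) ℕ.* suc k)                      ∎
  where
  open ≡-Reasoning
  split : ∀ a b → 6 ℕ.* (a ℕ.+ b) ≡ 3 ℕ.* (2 ℕ.* a) ℕ.+ 6 ℕ.* b
  split = ℕ-solver.solve-∀
  step : ∀ k → 3 ℕ.* (suc (suc k) ℕ.* suc k) ℕ.+ suc (suc k) ℕ.* (suc k ℕ.* k) ≡ suc (suc (suc k)) ℕ.* (suc (suc k) ℕ.* suc k)
  step = ℕ-solver.solve-∀

-- With a = p (m + 1), the claim for n = k + 2 is a (k + 2)² ≤ (a + q) (k + 1) k, which holds for k ≥ 4 a.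
turanDensity : ∀ {l} (F : List (Triple l)) p q → (∀ {n} (H : ThreeGraph n) → Free F H → excessOf (+ p) (+ suc q) H ≤ 0ℤ) →
  TuranDensity≤ F p (suc q)
turanDensity F p q bound m = suc (suc (4 ℕ.* a)) , main
  where
  a = p ℕ.* suc m
  main : ∀ n → suc (suc (4 ℕ.* a)) ℕ.≤ n → (H : ThreeGraph n) → Free F H →
    numEdges H ℕ.* suc q ℕ.* suc m ℕ.≤ (p ℕ.* suc m ℕ.+ suc q) ℕ.* (n C 3)
  main (suc (suc k)) (ℕ.s≤s (ℕ.s≤s big)) H free = ℕ.*-cancelˡ-≤ 6 (begin
    6 ℕ.* (numEdges H ℕ.* suc q ℕ.* suc m)         ≡⟨ rearrange (numEdges H) (suc q) (suc m) ⟩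
    6 ℕ.* numEdges H ℕ.* suc q ℕ.* suc m           ≤⟨ ℕ.*-monoˡ-≤ (suc m) (numEdges-bound p (suc q) H (bound H free)) ⟩
    N ℕ.* (N ℕ.* N) ℕ.* p ℕ.* suc m                ≡⟨ factor N p (suc m) ⟩
    N ℕ.* (a ℕ.* (N ℕ.* N))                        ≤⟨ ℕ.*-monoʳ-≤ N square ⟩
    N ℕ.* ((a ℕ.+ suc q) ℕ.* (suc k ℕ.* k))        ≡⟨ regroup N (a ℕ.+ suc q) (suc k ℕ.* k) ⟩
    (a ℕ.+ suc q) ℕ.* (N ℕ.* (suc k ℕ.* k))        ≡⟨ cong ((a ℕ.+ suc q) ℕ.*_) (sym (6C₃ k)) ⟩
    (a ℕ.+ suc q) ℕ.* (6 ℕ.* (N C 3))              ≡⟨ regroup (a ℕ.+ suc q) 6 (N C 3) ⟩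
    6 ℕ.* ((a ℕ.+ suc q) ℕ.* (N C 3))              ∎)
    where
    open ℕ.≤-Reasoning
    N = suc (suc k)
    rearrange : ∀ e q m → 6 ℕ.* (e ℕ.* q ℕ.* m) ≡ 6 ℕ.* e ℕ.* q ℕ.* m
    rearrange = ℕ-solver.solve-∀
    factor : ∀ x p m → x ℕ.* (x ℕ.* x) ℕ.* p ℕ.* m ≡ x ℕ.* (p ℕ.* m ℕ.* (x ℕ.* x))
    factor = ℕ-solver.solve-∀
    regroup : ∀ x y z → x ℕ.* (y ℕ.* z) ≡ y ℕ.* (x ℕ.* z)
    regroup = ℕ-solver.solve-∀
    -- Adding `a * k` makes the surplus over `a * (suc k * k)` the exact multiple `4 * a * suc k`,
    -- which `big` bounds by `k * suc k`.
    expand : ∀ a k → a ℕ.* (suc (suc k) ℕ.* suc (suc k)) ℕ.+ a ℕ.* k ≡ a ℕ.* (suc k ℕ.* k) ℕ.+ 4 ℕ.* a ℕ.* suc k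
    expand = ℕ-solver.solve-∀
    square : a ℕ.* (N ℕ.* N) ℕ.≤ (a ℕ.+ suc q) ℕ.* (suc k ℕ.* k)
    square = begin
      a ℕ.* (N ℕ.* N)                                            ≤⟨ ℕ.m≤m+n _ (a ℕ.* k) ⟩
      a ℕ.* (N ℕ.* N) ℕ.+ a ℕ.* k                                ≡⟨ expand a k ⟩
      a ℕ.* (suc k ℕ.* k) ℕ.+ 4 ℕ.* a ℕ.* suc k                  ≤⟨ ℕ.+-monoʳ-≤ (a ℕ.* (suc k ℕ.* k)) (ℕ.*-monoˡ-≤ (suc k) big) ⟩
      a ℕ.* (suc k ℕ.* k) ℕ.+ k ℕ.* suc k                        ≡⟨ cong (a ℕ.* (suc k ℕ.* k) ℕ.+_) (ℕ.*-comm k (suc k)) ⟩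
      a ℕ.* (suc k ℕ.* k) ℕ.+ suc k ℕ.* k                        ≤⟨ ℕ.+-monoʳ-≤ (a ℕ.* (suc k ℕ.* k)) (ℕ.m≤n*m (suc k ℕ.* k) (suc q)) ⟩
      a ℕ.* (suc k ℕ.* k) ℕ.+ suc q ℕ.* (suc k ℕ.* k)            ≡⟨ sym (ℕ.*-distribʳ-+ (suc k ℕ.* k) a (suc q)) ⟩
      (a ℕ.+ suc q) ℕ.* (suc k ℕ.* k)                            ∎

-- Minimum codegrees

Below : Maybe ℕ → ℕ → Set
Below m v = ∃ λ u → m ≡ just u × u ℕ.≤ v

minM-left : ∀ {x v} y → Below x v → Below (minM x y) v
minM-left nothing  (u , refl , h) = u , refl , h
minM-left (just w) (u , refl , h) = u ℕ.⊓ w , refl , ℕ.≤-trans (ℕ.m⊓n≤m u w) h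

minM-right : ∀ {y v} x → Below y v → Below (minM x y) v
minM-right nothing  b              = b
minM-right (just w) (u , refl , h) = w ℕ.⊓ u , refl , ℕ.≤-trans (ℕ.m⊓n≤n w u) h

minFin-below : ∀ {v} (f : Fin n → Maybe ℕ) i → Below (f i) v → Below (minFin f) v
minFin-below f zero    b = minM-left (minFin (f ∘ suc)) b
minFin-below f (suc i) b = minM-right (f zero) (minFin-below (f ∘ suc) i b)

minFin-nothing : ∀ (f : Fin n → Maybe ℕ) → (∀ i → f i ≡ nothing) → minFin f ≡ nothing
minFin-nothing {zero}  f h = refl
minFin-nothing {suc n} f h rewrite h zero = minFin-nothing (f ∘ suc) (h ∘ suc)

Below-≤ : ∀ {m v} → Below m v → fromMaybe 0 m ℕ.≤ v
Below-≤ (u , refl , h) = h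

Below-if : ∀ {b} v → b ≡ true → Below (if b then just v else nothing) v
Below-if v refl = v , refl , ℕ.≤-refl

count-cong : ∀ {p q : Fin n → Bool} → (∀ i → p i ≡ q i) → count p ≡ count q
count-cong {zero}  h = refl
count-cong {suc n} h = cong₂ (λ b c → (if b then 1 else 0) ℕ.+ c) (h zero) (count-cong (h ∘ suc))

count-false : ∀ n → count {n} (λ _ → false) ≡ 0
count-false zero    = refl
count-false (suc n) = count-false n

count-pos : ∀ (p : Fin n → Bool) i → p i ≡ true → 0 ℕ.< count p
count-pos p zero    h rewrite h = ℕ.s≤s ℕ.z≤n
count-pos p (suc i) h = ℕ.<-≤-trans (count-pos (p ∘ suc) i h) (ℕ.m≤n+m _ (if p zero then 1 else 0))

codeg-sym : ∀ (H : ThreeGraph n) i j → codeg H i j ≡ codeg H j i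
codeg-sym H i j = count-cong (sym₁₂ H i j)

<F-true : ∀ {i j : Fin n} → toℕ i ℕ.< toℕ j → (i <F j) ≡ true
<F-true {i = i} {j} h with i <F j in e
... | true  = refl
... | false = ⊥-elim (subst T e (ℕ.<⇒<ᵇ h))

<ᵇ-intro : ∀ {m} → 0 ℕ.< m → (0 ℕ.<ᵇ m) ≡ true
<ᵇ-intro {suc m} _ = refl

δ₂-< : ∀ (H : ThreeGraph n) {i j} → toℕ i ℕ.< toℕ j → δ₂ H ℕ.≤ codeg H i j
δ₂-< H {i} {j} i<j = Below-≤ (minFin-below _ i (minFin-below _ j (Below-if (codeg H i j) (<F-true i<j))))

δ₂-≤ : ∀ (H : ThreeGraph n) {i j} → i ≢ j → δ₂ H ℕ.≤ codeg H i j
δ₂-≤ H {i} {j} i≢j with ℕ.<-cmp (toℕ i) (toℕ j)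
... | tri< i<j _ _ = δ₂-< H i<j
... | tri≈ _ i≡j _ = ⊥-elim (i≢j (Fin.toℕ-injective i≡j))
... | tri> _ _ j<i = subst (δ₂ H ℕ.≤_) (codeg-sym H j i) (δ₂-< H j<i)

δ₂⁺-< : ∀ (H : ThreeGraph n) {i j} → toℕ i ℕ.< toℕ j → 0 ℕ.< codeg H i j → δ₂⁺ H ℕ.≤ codeg H i j
δ₂⁺-< H {i} {j} i<j pos = Below-≤ (minFin-below _ i (minFin-below _ j
  (Below-if (codeg H i j) (cong₂ _∧_ (<F-true i<j) (<ᵇ-intro pos)))))

δ₂⁺-≤ : ∀ (H : ThreeGraph n) i j k → edge H i j k ≡ true → δ₂⁺ H ℕ.≤ codeg H i j
δ₂⁺-≤ H i j k e with ℕ.<-cmp (toℕ i) (toℕ j)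
... | tri< i<j _ _ = δ₂⁺-< H i<j (count-pos (edge H i j) k e)
... | tri≈ _ i≡j _ with () ← ≡.trans (sym e) (edge-degenerate H (inj₁ (Fin.toℕ-injective i≡j)))
... | tri> _ _ j<i = subst (δ₂⁺ H ℕ.≤_) (codeg-sym H j i)
  (δ₂⁺-< H j<i (subst (0 ℕ.<_) (codeg-sym H i j) (count-pos (edge H i j) k e)))

-- No pair qualifies for the minimum, so it is `nothing` and the convention of value 0 takes effect.
-- The argument for positive codegrees ends in this case.
δ₂⁺-empty : ∀ (H : ThreeGraph n) → (∀ i j k → edge H i j k ≡ false) → δ₂⁺ H ≡ 0
δ₂⁺-empty {n} H edgeless = cong (fromMaybe 0) (minFin-nothing _ λ i → minFin-nothing _ λ j →
  cong (λ b → if b then just (codeg H i j) else nothing)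
    (≡.trans (cong (λ c → (i <F j) ∧ (0 ℕ.<ᵇ c)) (≡.trans (count-cong (edgeless i j)) (count-false n))) (Bool.∧-zeroʳ (i <F j))))

-- The codegree kernel

margin : ℕ → ℕ → ThreeGraph n → Fin n → Fin n → ℤ
margin {n} p q H a b = + (q ℕ.* codeg H a b) - + (n ℕ.* p)

-- The tuple is completed by repeating `e`. As `triples₅` involves only the first five positions,
-- any sixth vertex gives the same list, which lets the weight be taken out of the sum over that
-- vertex.
firstFive : ThreeGraph n → (a b c d e : Fin n) → List Bool
firstFive H a b c d e = values (asks H triples₅) (a ∷ b ∷ c ∷ d ∷ e ∷ e ∷ [])

walk-weighted : ∀ w p q (g : X → Bool) v → walk (weighted w p q) (g ∷ []) v ≡ w * ((if g v then q else 0ℤ) - p)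
walk-weighted (+ zero)   p q g v = refl
walk-weighted (+ suc w)  p q g v with g v
... | true  = refl
... | false = refl
walk-weighted -[1+ w ]   p q g v with g v
... | true  = refl
... | false = refl

margin-sum : ∀ p q (H : ThreeGraph n) a b → ∑ (λ f → (if edge H a b f then + q else 0ℤ) - + p) ≡ margin p q H a b
margin-sum {n} p q H a b = ≡.trans (∑-+ (λ f → if edge H a b f then + q else 0ℤ) (λ _ → - + p)) (cong₂ _+_
  (≡.trans (∑-cong λ f → scaled (edge H a b f)) (≡.trans (∑-*ˡ (+ q) (𝟙 ∘ edge H a b))
    (≡.trans (cong (+ q *_) (sym (count-∑ (edge H a b)))) (sym (pos-* q (codeg H a b))))))
  (≡.trans (∑-const n (- + p)) (≡.trans (sym (neg-distribʳ-* (+ n) (+ p))) (cong -_ (sym (pos-* n p))))))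
  where
  scaled : ∀ b → (if b then + q else 0ℤ) ≡ + q * 𝟙 b
  scaled true  = sym (*-identityʳ (+ q))
  scaled false = sym (*-zeroʳ (+ q))

codegree-sum : ∀ w p q (H : ThreeGraph n) a b c d e →
  ∑ (λ f → ⟦ codegreeKernel w (+ p) (+ q) ⟧ H (a ∷ b ∷ c ∷ d ∷ e ∷ f ∷ [])) ≡ w (firstFive H a b c d e) * margin p q H a b
codegree-sum w p q H a b c d e = ≡.trans (∑-cong λ f → ≡.trans
    (walk-branch (λ l → weighted (w l) (+ p) (+ q)) (asks H triples₅) (asks H ((v1 , v2 , v6) ∷ [])) (a ∷ b ∷ c ∷ d ∷ e ∷ f ∷ []))
    (walk-weighted (w (firstFive H a b c d e)) (+ p) (+ q) (λ x → on H x (v1 , v2 , v6)) (a ∷ b ∷ c ∷ d ∷ e ∷ f ∷ [])))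
  (≡.trans (∑-*ˡ (w (firstFive H a b c d e)) (λ f → (if edge H a b f then + q else 0ℤ) - + p))
    (cong (w (firstFive H a b c d e) *_) (margin-sum p q H a b)))

-- Summing the kernel over the sixth vertex turns e(x₁x₂x₆) into a codegree. The lower bound `B`
-- depends on x₁ and x₂ alone, so the sum over the three vertices between contributes a factor n³.
codegree-lower : ∀ w p q (H : ThreeGraph n) (B : Fin n → Fin n → ℤ) →
  (∀ a b c d e → B a b ≤ w (firstFive H a b c d e) * margin p q H a b) →
  ∑ (λ a → ∑ λ b → + (n ℕ.* (n ℕ.* n)) * B a b) ≤ ∑ⱽ 6 (⟦ codegreeKernel w (+ p) (+ q) ⟧ H)
codegree-lower {n} w p q H B h = ∑-mono λ a → ∑-mono λ b → ≤-trans (≤-reflexive (sym (∑³-const n (B a b))))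
  (∑-mono λ c → ∑-mono λ d → ∑-mono λ e → ≤-trans (h a b c d e) (≤-reflexive (sym (codegree-sum w p q H a b c d e))))

nonnegative≤ : ℕ → ℤ → Bool
nonnegative≤ G (+ u)    = u ℕ.≤ᵇ G
nonnegative≤ G -[1+ _ ] = false

nonnegative≤-sound : ∀ G z → nonnegative≤ G z ≡ true → ∃ λ u → z ≡ + u × u ℕ.≤ G
nonnegative≤-sound G (+ u) h = u , refl , ℕ.≤ᵇ⇒≤ u G (subst T (sym h) _)

boundedWeight : (List Bool → ℤ) → ℕ → Vec Bool 10 → Bool
boundedWeight w G v = nonnegative≤ G (w (Vec.toList v))

boundedWeights : List ℤ → ℕ → Bool
boundedWeights c G = everyV 10 (boundedWeight (weight c) G)

-- The first two vertices lie in an edge on the first five.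
covered : List Bool → Bool
covered (x ∷ y ∷ _ ∷ _ ∷ z ∷ _) = x ∨ (y ∨ z)
covered _                       = false

zero? : ℤ → Bool
zero? (+ zero) = true
zero? _        = false

coveredWeight : (List Bool → ℤ) → ℕ → Vec Bool 10 → Bool
coveredWeight w G v = nonnegative≤ G (w (Vec.toList v)) ∧ (zero? (w (Vec.toList v)) ∨ covered (Vec.toList v))

coveredWeights : List ℤ → ℕ → Bool
coveredWeights c G = everyV 10 (coveredWeight (weight c) G)

firstFiveⱽ : ThreeGraph n → (a b c d e : Fin n) → Vec Bool 10
firstFiveⱽ H a b c d e = Vec.map (λ t → on H (a ∷ b ∷ c ∷ d ∷ e ∷ e ∷ []) t) (Vec.take 10 triples)

bounded-weights : ∀ w G → everyV 10 (boundedWeight w G) ≡ true → ∀ (H : ThreeGraph n) a b c d e →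
  ∃ λ u → w (firstFive H a b c d e) ≡ + u × u ℕ.≤ G
bounded-weights w G h H a b c d e =
  nonnegative≤-sound G (w (firstFive H a b c d e)) (everyV-sound 10 (boundedWeight w G) h (firstFiveⱽ H a b c d e))

-- Codegree densities from certificates

codegreeTerms : ℕ → List ℤ → ℕ → ℕ → Squares → List Term
codegreeTerms t c p q Q = (edgeKernel (leaf (+ suc t)) , shape₀) ∷ (codegreeKernel (weight c) (+ p) (+ q) , shape₂₃) ∷ squareTerms Q

edgeTable : ℕ → Table
edgeTable t = node (leaf 0ℤ) (leaf (+ suc t))

positiveTerms : ℕ → List ℤ → ℕ → ℕ → Squares → List Term
positiveTerms t c p q Q = (edgeKernel (edgeTable t) , shape₀) ∷
  (codegreeKernel (weight c) (+ p) (+ q) , shape₂₃) ∷ squareTerms Q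

if-equal : ∀ (a b : Fin n) k (P : ℤ → Set) → (a ≢ b → P 0ℤ) → P k → P (if does (a Fin.≟ b) then k else 0ℤ)
if-equal a b k P distinct equal with a Fin.≟ b
... | yes _   = equal
... | no  a≢b = distinct a≢b

∑-indicator : ∀ (a : Fin n) k → ∑ (λ b → if does (a Fin.≟ b) then k else 0ℤ) ≡ k
∑-indicator {suc n} zero    k = ≡.trans (+-congʳ k (∑-zero n)) (+-identityʳ k)
∑-indicator {suc n} (suc a) k = ≡.trans (+-identityˡ _) (∑-indicator a k)

margin-nonneg : ∀ p q (H : ThreeGraph n) a b {d} → p ℕ.* n ℕ.≤ d ℕ.* q → d ℕ.≤ codeg H a b → 0ℤ ≤ margin p q H a b
margin-nonneg {n} p q H a b {d} h h′ = i≤j⇒0≤j-i (+≤+ (ℕ.≤-trans (ℕ.≤-reflexive (ℕ.*-comm n p))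
  (ℕ.≤-trans h (ℕ.≤-trans (ℕ.≤-reflexive (ℕ.*-comm d q)) (ℕ.*-monoʳ-≤ q h′)))))

*-nonneg : ∀ u {x} → 0ℤ ≤ x → 0ℤ ≤ + u * x
*-nonneg u {x} h = subst (_≤ + u * x) (*-zeroʳ (+ u)) (*-monoˡ-≤-nonNeg (+ u) h)

densityBound : ∀ d p q n m → d ℕ.* q ℕ.≤ p ℕ.* n → d ℕ.* q ℕ.* suc m ℕ.≤ (p ℕ.* suc m ℕ.+ q) ℕ.* n
densityBound d p q n m h = ℕ.≤-trans (ℕ.*-monoˡ-≤ (suc m) h) (ℕ.≤-trans (ℕ.≤-reflexive (swapped p n (suc m)))
  (ℕ.*-monoˡ-≤ n (ℕ.m≤m+n (p ℕ.* suc m) q)))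
  where
  swapped : ∀ p n m → p ℕ.* n ℕ.* m ≡ p ℕ.* m ℕ.* n
  swapped = ℕ-solver.solve-∀

cubeSum : ∀ n N t G p → N ≡ n ℕ.* (n ℕ.* n) →
  + N * (+ N * + suc t) + + N * (+ n * - + (G ℕ.* (n ℕ.* p))) ≡
  + (N ℕ.* (n ℕ.* (n ℕ.* (n ℕ.* suc t)))) - + (N ℕ.* (n ℕ.* (n ℕ.* (G ℕ.* p))))
cubeSum n N t G p N≡n³ = cong₂ _+_
  (≡.trans (cong (+ N *_) (sym (pos-* N (suc t)))) (≡.trans (sym (pos-* N (N ℕ.* suc t)))
    (cong (λ z → + (N ℕ.* z)) (≡.trans (cong (ℕ._* suc t) N≡n³) (associate n (suc t))))))
  (≡.trans (cong (+ N *_) (≡.trans (sym (neg-distribʳ-* (+ n) (+ K))) (cong -_ (sym (pos-* n K)))))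
    (≡.trans (sym (neg-distribʳ-* (+ N) (+ (n ℕ.* K)))) (cong -_ (≡.trans (sym (pos-* N (n ℕ.* K)))
      (cong (λ z → + (N ℕ.* z)) (regroup n G p))))))
  where
  K = G ℕ.* (n ℕ.* p)
  associate : ∀ x y → x ℕ.* (x ℕ.* x) ℕ.* y ≡ x ℕ.* (x ℕ.* (x ℕ.* y))
  associate = ℕ-solver.solve-∀
  regroup : ∀ x y z → x ℕ.* (y ℕ.* (x ℕ.* z)) ≡ x ℕ.* (x ℕ.* (y ℕ.* z))
  regroup = ℕ-solver.solve-∀

cubeCancel : ∀ n t G p → + (n ℕ.* (n ℕ.* n) ℕ.* (n ℕ.* (n ℕ.* (n ℕ.* suc t)))) -
  + (n ℕ.* (n ℕ.* n) ℕ.* (n ℕ.* (n ℕ.* (G ℕ.* p)))) ≤ 0ℤ → n ℕ.≤ G ℕ.* p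
cubeCancel zero    t G p h = ℕ.z≤n
cubeCancel n@(suc _) t G p h = ℕ.≤-trans (ℕ.m≤m*n n (suc t)) (cancel n (cancel n (cancel (n ℕ.* (n ℕ.* n)) (drop‿+≤+ (i-j≤0⇒i≤j h)))))
  where
  cancel : ∀ m .{{_ : NonZero m}} {x y} → m ℕ.* x ℕ.≤ m ℕ.* y → x ℕ.≤ y
  cancel m {x} {y} = ℕ.*-cancelˡ-≤ m

module _ (t G p q : ℕ) (γ : List ℤ) (Q : Squares) (weights-ok : boundedWeights γ G ≡ true)
         (F : List (Triple 6)) (ws : List Word) (covering : Covering F) (ok : check F ws (codegreeTerms t γ p q Q) ≡ true) where

  private
    -- The constant term sums to n⁶(t + 1). The multiplier can be negative only where a = b, and
    -- there it loses at most G n p for each of the n⁴ choices of a, c, d, e, that is n⁵ G p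
    -- altogether. Hence n (t + 1) ≤ G p.
    large : ∀ n (H : ThreeGraph n) → Free F H → p ℕ.* n ℕ.≤ δ₂ H ℕ.* q → n ℕ.≤ G ℕ.* p
    large n H free h = cubeCancel n t G p (subst (_≤ 0ℤ) (cubeSum n (n ℕ.* (n ℕ.* n)) t G p refl) summed)
      where
      N = n ℕ.* (n ℕ.* n)
      K = G ℕ.* (n ℕ.* p)
      B : Fin n → Fin n → ℤ
      -- Off the diagonal the codegree hypothesis gives 0. On the diagonal the codegree is at least
      -- 0 and the weight at most G, so the product is at least -G n p.
      B a b = if does (a Fin.≟ b) then - + K else 0ℤ
      scaled : ∀ a b {z} → (∃ λ u → z ≡ + u × u ℕ.≤ G) → B a b ≤ z * margin p q H a b
      scaled a b (u , refl , u≤G) = if-equal a b (- + K) (_≤ + u * margin p q H a b)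
        (λ a≢b → *-nonneg u (margin-nonneg p q H a b h (δ₂-≤ H a≢b)))
        (≤-trans (subst (- + K ≤_) (≡.trans (cong -_ (pos-* u (n ℕ.* p))) (neg-distribʳ-* (+ u) (+ (n ℕ.* p))))
            (neg-mono-≤ (+≤+ (ℕ.*-monoˡ-≤ (n ℕ.* p) u≤G))))
          (*-monoˡ-≤-nonNeg (+ u) (subst (_≤ margin p q H a b) (+-identityˡ _)
            (+-monoˡ-≤ (- + (n ℕ.* p)) (+≤+ (ℕ.z≤n {q ℕ.* codeg H a b}))))))
      below : ∀ a b c d e → B a b ≤ weight γ (firstFive H a b c d e) * margin p q H a b
      below a b c d e = scaled a b (bounded-weights (weight γ) G weights-ok H a b c d e)
      lower : + N * (+ n * - + K) ≤ ∑ⱽ 6 (⟦ codegreeKernel (weight γ) (+ p) (+ q) ⟧ H)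
      lower = subst (_≤ ∑ⱽ 6 (⟦ codegreeKernel (weight γ) (+ p) (+ q) ⟧ H))
        (≡.trans (∑-cong λ a → ≡.trans (∑-*ˡ (+ N) (B a)) (cong (+ N *_) (∑-indicator a (- + K))))
          (≡.trans (∑-const n (+ N * - + K)) (exchange (+ n) (+ N) (- + K))))
        (codegree-lower (weight γ) p q H B below)
        where
        exchange : ∀ x y z → x * (y * z) ≡ y * (x * z)
        exchange = solve-∀
      summed : + N * (+ N * + suc t) + + N * (+ n * - + K) ≤ 0ℤ
      summed = two-terms H (edgeKernel (leaf (+ suc t))) (codegreeKernel (weight γ) (+ p) (+ q)) shape₀ shape₂₃ (squareTerms Q) refl
        (certified F ws (codegreeTerms t γ p q Q) ok H (free⇒avoids F covering H free))
        (≤-reflexive (sym (≡.trans (edge-sum (leaf (+ suc t)) H) (cong (+ N *_) (∑³-const n (+ suc t))))))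
        lower (sums-nonneg H (squareTerms-nonneg Q))

  codegreeDensity : CodegreeDensity≤ F p q
  -- Beyond G p the inequality holds without any ε, so the threshold is the same for every `m`.
  codegreeDensity m = suc (G ℕ.* p) , λ n n≥ H free → densityBound (δ₂ H) p q n m (small n n≥ H free)
    where
    small : ∀ n → suc (G ℕ.* p) ℕ.≤ n → (H : ThreeGraph n) → Free F H → δ₂ H ℕ.* q ℕ.≤ p ℕ.* n
    small n n≥ H free = [ id , (λ h → ⊥-elim (ℕ.<-irrefl refl (ℕ.≤-trans n≥ (large n H free h)))) ]′
      (ℕ.≤-total (δ₂ H ℕ.* q) (p ℕ.* n))

-- Positive codegrees

∑-term : ∀ (f : Fin n → ℤ) → (∀ i → 0ℤ ≤ f i) → ∀ i → f i ≤ ∑ f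
∑-term f h zero    = subst (_≤ ∑ f) (+-identityʳ (f zero)) (+-monoʳ-≤ (f zero) (∑-nonneg (h ∘ suc)))
∑-term f h (suc i) = ≤-trans (∑-term (f ∘ suc) (h ∘ suc) i)
  (subst (_≤ ∑ f) (+-identityˡ (∑ (f ∘ suc))) (+-monoˡ-≤ (∑ (f ∘ suc)) (h zero)))

term-nonneg : ∀ t b → 0ℤ ≤ answer (edgeTable t) b
term-nonneg t true  = +≤+ ℕ.z≤n
term-nonneg t false = ≤-refl

term-zero : ∀ t b → answer (edgeTable t) b ≤ 0ℤ → b ≡ false
term-zero t true  (+≤+ ())
term-zero t false _ = refl

∑³-term : ∀ (f : Fin n → Fin n → Fin n → ℤ) → (∀ a b c → 0ℤ ≤ f a b c) → ∀ a b c → f a b c ≤ ∑³ f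
∑³-term f h a b c = ≤-trans (∑-term (f a b) (h a b) c) (≤-trans
  (∑-term (λ b → ∑ (f a b)) (λ b → ∑-nonneg (h a b)) b)
  (∑-term (λ a → ∑ λ b → ∑ (f a b)) (λ a → ∑-nonneg λ b → ∑-nonneg (h a b)) a))

cancel-cube : ∀ {n} → Fin n → ∀ x → + (n ℕ.* (n ℕ.* n)) * x ≤ 0ℤ → x ≤ 0ℤ
cancel-cube {suc n} _ x h = cancel-pos (n ℕ.+ n ℕ.* suc n ℕ.+ n ℕ.* (suc n ℕ.* suc n)) x h

weighted-nonneg : ∀ {w G c m} → (∃ λ u → w ≡ + u × u ℕ.≤ G) → zero? w ∨ c ≡ true → (c ≡ true → 0ℤ ≤ m) → 0ℤ ≤ w * m
weighted-nonneg {m = m} (zero  , refl , _) o h = ≤-reflexive (sym (*-zeroˡ m))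
weighted-nonneg         (suc u , refl , _) o h = *-nonneg (suc u) (h o)

covered-weights : ∀ w G → everyV 10 (coveredWeight w G) ≡ true → ∀ (H : ThreeGraph n) a b c d e {m} →
  (covered (firstFive H a b c d e) ≡ true → 0ℤ ≤ m) → 0ℤ ≤ w (firstFive H a b c d e) * m
covered-weights w G ok H a b c d e = weighted-nonneg
  (nonnegative≤-sound G (w (firstFive H a b c d e)) (proj₁ (∧-split checked)))
  (proj₂ (∧-split {nonnegative≤ G (w (firstFive H a b c d e))} checked))
  where
  checked : nonnegative≤ G (w (firstFive H a b c d e)) ∧ (zero? (w (firstFive H a b c d e)) ∨ covered (firstFive H a b c d e)) ≡ true
  checked = everyV-sound 10 (coveredWeight w G) ok (firstFiveⱽ H a b c d e)

δ₂⁺-covered : ∀ (H : ThreeGraph n) a b c d e → covered (firstFive H a b c d e) ≡ true → δ₂⁺ H ℕ.≤ codeg H a b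
δ₂⁺-covered H a b c d e h = [ δ₂⁺-≤ H a b c , (λ h′ → [ δ₂⁺-≤ H a b d , δ₂⁺-≤ H a b e ]′ (∨-split {edge H a b d} h′)) ]′
  (∨-split {edge H a b c} h)

module _ (t G p q : ℕ) (γ : List ℤ) (Q : Squares) (weights-ok : coveredWeights γ G ≡ true)
         (F : List (Triple 6)) (ws : List Word) (covering : Covering F) (ok : check F ws (positiveTerms t γ p q Q) ≡ true) where

  private
    -- A nonzero weight requires an edge containing a and b, so their codegree is at least `δ₂⁺ H`.
    -- Such an edge also forces a ≠ b, and in contrast to codegrees there is no loss on the
    -- diagonal.
    weight-nonneg : ∀ {n} (H : ThreeGraph n) → p ℕ.* n ℕ.≤ δ₂⁺ H ℕ.* q → ∀ a b c d e →
      0ℤ ≤ weight γ (firstFive H a b c d e) * margin p q H a b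
    weight-nonneg H h a b c d e = covered-weights (weight γ) G weights-ok H a b c d e
      (λ cov → margin-nonneg p q H a b h (δ₂⁺-covered H a b c d e cov))

    -- The multiplier and the squares have nonnegative sums, so the sum of (t + 1) e(abc) over all
    -- triples is at most 0. Its summands are nonnegative, hence each of them vanishes.
    edgeless : ∀ n (H : ThreeGraph n) → Free F H → p ℕ.* n ℕ.≤ δ₂⁺ H ℕ.* q → ∀ a b c → edge H a b c ≡ false
    edgeless n H free h a b c = term-zero t (edge H a b c) (≤-trans
      (∑³-term (λ a b c → answer (edgeTable t) (edge H a b c)) (λ a b c → term-nonneg t (edge H a b c)) a b c) total)
      where
      codegrees-nonneg : 0ℤ ≤ ∑ⱽ 6 (⟦ codegreeKernel (weight γ) (+ p) (+ q) ⟧ H)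
      codegrees-nonneg = subst (_≤ ∑ⱽ 6 (⟦ codegreeKernel (weight γ) (+ p) (+ q) ⟧ H))
        (≡.trans (∑-cong {n} λ a → ≡.trans (∑-cong {n} λ b → *-zeroʳ (+ (n ℕ.* (n ℕ.* n)))) (∑-zero n)) (∑-zero n))
        (codegree-lower (weight γ) p q H (λ _ _ → 0ℤ) (weight-nonneg H h))
      total : ∑³ (λ a b c → answer (edgeTable t) (edge H a b c)) ≤ 0ℤ
      total = cancel-cube a (∑³ λ a b c → answer (edgeTable t) (edge H a b c)) (subst (_≤ 0ℤ) (+-identityʳ _)
        (two-terms H (edgeKernel (edgeTable t)) (codegreeKernel (weight γ) (+ p) (+ q)) shape₀ shape₂₃ (squareTerms Q) refl
          (certified F ws (positiveTerms t γ p q Q) ok H (free⇒avoids F covering H free))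
          (≤-reflexive (sym (edge-sum (edgeTable t) H))) codegrees-nonneg (sums-nonneg H (squareTerms-nonneg Q))))

  posCodegreeDensity : PosCodegreeDensity≤ F p q
  -- Without error terms the inequality holds for every n. If δ₂⁺ q were at least p n, then H would
  -- be edgeless and δ₂⁺ would be 0.
  posCodegreeDensity m = 0 , λ n _ H free → densityBound (δ₂⁺ H) p q n m (small n H free)
    where
    small : ∀ n (H : ThreeGraph n) → Free F H → δ₂⁺ H ℕ.* q ℕ.≤ p ℕ.* n
    small n H free = [ id , (λ h → ℕ.≤-trans (ℕ.≤-reflexive (cong (ℕ._* q) (δ₂⁺-empty H (edgeless n H free h)))) ℕ.z≤n) ]′
      (ℕ.≤-total (δ₂⁺ H ℕ.* q) (p ℕ.* n))

-- Certificates: rounded solutions of the semidefinite programs. The bases span, for each irreducible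
-- representation of the stabiliser of a type with 0, …, 4 edges on its roots (or of the pairs and triples),
-- the image of a Young symmetriser; row i of a certificate lists the coefficients of basis vector i in the
-- squared combinations. Weights are listed as alternating codes and values.

basis₀ : List (List String)
basis₀ =
  ("1" ∷ "64" ∷ "13 19 34" ∷ "31 46 52" ∷ "8 26 43 53" ∷ "12 22 39 57" ∷ "2 3 5 9 17 33" ∷ "32 48 56 60 62 63" ∷ "4 6 7 10 11 18 21 25 35 37 41 49" ∷
   "14 15 20 23 27 29 36 38 42 45 50 51" ∷ "16 24 28 30 40 44 47 54 55 58 59 61" ∷ []) ∷
  ("8 -53" ∷ "12 -57" ∷ "2 3 -17 -33" ∷ "32 48 -62 -63" ∷ "4 6 7 -21 -37 -49" ∷ "16 24 40 -54 -55 -61" ∷ "-4 -10 -11 25 41 49" ∷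
   "-16 -28 -44 58 59 61" ∷ "14 15 20 -29 36 -45 -50 -51" ∷ []) ∷
  ("13 -34" ∷ "31 -52" ∷ "2 -5 -9 33" ∷ "32 -56 -60 63" ∷ "4 -7 -11 18 -21 -25 35 49" ∷ "14 20 -23 -27 -38 -42 45 51" ∷
   "15 -20 23 27 29 -36 -50 -51" ∷ "16 30 -40 -44 47 -54 -58 61" ∷ []) ∷
  ("4 -7 -10 25 37 -49" ∷ "16 -28 -40 55 58 -61" ∷ "14 15 -20 23 -27 -29 -36 -38 42 -45 50 51" ∷ []) ∷
  ("14 -15 -20 23 27 -29 36 -38 -42 45 50 -51" ∷ []) ∷
  []

basis₁ : List (List String)
basis₁ =
  ("1" ∷ "8" ∷ "57" ∷ "64" ∷ "2 3 5" ∷ "4 6 7" ∷ "9 17 33" ∷ "12 22 39" ∷ "13 19 34" ∷ "16 24 40" ∷ "25 41 49" ∷ "26 43 53" ∷ "31 46 52" ∷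
   "32 48 56" ∷ "58 59 61" ∷ "60 62 63" ∷ "10 11 18 21 35 37" ∷ "14 15 20 23 36 38" ∷ "27 29 42 45 50 51" ∷ "28 30 44 47 54 55" ∷ []) ∷
  ("2 -5" ∷ "4 -7" ∷ "9 -33" ∷ "12 -39" ∷ "13 -34" ∷ "16 -40" ∷ "25 -49" ∷ "26 -53" ∷ "31 -52" ∷ "32 -56" ∷ "58 -61" ∷ "60 -63" ∷ "10 18 -21 -37" ∷
   "11 -18 21 -35" ∷ "14 20 -23 -38" ∷ "15 -20 23 -36" ∷ "27 29 -50 -51" ∷ "28 30 -54 -55" ∷ "-29 42 -45 50" ∷ "-30 44 -47 54" ∷ []) ∷
  ("10 -11 -18 21 35 -37" ∷ "14 -15 -20 23 36 -38" ∷ "27 -29 -42 45 50 -51" ∷ "28 -30 -44 47 54 -55" ∷ []) ∷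
  []

basis₂ : List (List String)
basis₂ =
  ("1" ∷ "2" ∷ "31" ∷ "32" ∷ "33" ∷ "34" ∷ "63" ∷ "64" ∷ "7 25" ∷ "8 26" ∷ "11 21" ∷ "12 22" ∷ "13 19" ∷ "14 20" ∷ "39 57" ∷ "40 58" ∷ "43 53" ∷
   "44 54" ∷ "45 51" ∷ "46 52" ∷ "3 5 9 17" ∷ "4 6 10 18" ∷ "15 23 27 29" ∷ "16 24 28 30" ∷ "35 37 41 49" ∷ "36 38 42 50" ∷ "47 55 59 61" ∷
   "48 56 60 62" ∷ []) ∷
  ("7 -25" ∷ "8 -26" ∷ "39 -57" ∷ "40 -58" ∷ "3 5 -9 -17" ∷ "4 6 -10 -18" ∷ "15 23 -27 -29" ∷ "16 24 -28 -30" ∷ "35 37 -41 -49" ∷ "36 38 -42 -50" ∷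
   "47 55 -59 -61" ∷ "48 56 -60 -62" ∷ []) ∷
  ("11 -21" ∷ "12 -22" ∷ "43 -53" ∷ "44 -54" ∷ "3 -5 9 -17" ∷ "4 -6 10 -18" ∷ "15 -23 27 -29" ∷ "16 -24 28 -30" ∷ "35 -37 41 -49" ∷ "36 -38 42 -50" ∷
   "47 -55 59 -61" ∷ "48 -56 60 -62" ∷ []) ∷
  ("13 -19" ∷ "14 -20" ∷ "45 -51" ∷ "46 -52" ∷ "3 -5 -9 17" ∷ "4 -6 -10 18" ∷ "15 -23 -27 29" ∷ "16 -24 -28 30" ∷ "35 -37 -41 49" ∷ "36 -38 -42 50" ∷
   "47 -55 -59 61" ∷ "48 -56 -60 62" ∷ []) ∷
  []

basis₃ : List (List String)
basis₃ =
  ("1" ∷ "12" ∷ "53" ∷ "64" ∷ "2 3 9" ∷ "4 10 11" ∷ "5 17 33" ∷ "8 26 43" ∷ "13 19 34" ∷ "16 28 44" ∷ "21 37 49" ∷ "22 39 57" ∷ "31 46 52" ∷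
   "32 48 60" ∷ "54 55 61" ∷ "56 62 63" ∷ "6 7 18 25 35 41" ∷ "14 15 20 27 36 42" ∷ "23 29 38 45 50 51" ∷ "24 30 40 47 58 59" ∷ []) ∷
  ("2 -9" ∷ "4 -11" ∷ "5 -33" ∷ "8 -43" ∷ "13 -34" ∷ "16 -44" ∷ "21 -49" ∷ "22 -57" ∷ "31 -52" ∷ "32 -60" ∷ "54 -61" ∷ "56 -63" ∷ "6 7 -35 -41" ∷
   "14 15 -36 -42" ∷ "-7 18 -25 35" ∷ "-15 20 -27 36" ∷ "23 38 -45 -51" ∷ "24 40 -47 -59" ∷ "29 -38 45 -50" ∷ "30 -40 47 -58" ∷ []) ∷
  ("6 -7 -18 25 35 -41" ∷ "14 -15 -20 27 36 -42" ∷ "23 -29 -38 45 50 -51" ∷ "24 -30 -40 47 58 -59" ∷ []) ∷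
  []

basis-pairs : List (List String)
basis-pairs =
  ("1" ∷ "13" ∷ "2 3" ∷ "14 15" ∷ "4" ∷ "16" ∷ "5 9" ∷ "6 7 10 11" ∷ "8 12" ∷ []) ∷
  ("-5 9" ∷ "-6 -7 10 11" ∷ "-8 12" ∷ []) ∷
  []

basis-triples : List (List String)
basis-triples =
  ("1" ∷ "2" ∷ []) ∷
  []

K₄⁻-squares₀ : List (List String)
K₄⁻-squares₀ =
  ("449" ∷ "" ∷ "-663 518" ∷ "453 19 446" ∷ "" ∷ "-870 -11 -257 5" ∷ "365 -23 -523 11 202" ∷ "" ∷ "341 7 169 -4 -17 8" ∷
   "306 -37 106 -49 -130 4 162" ∷ "" ∷ []) ∷
  ("" ∷ "" ∷ "" ∷ "" ∷ "" ∷ "" ∷ "" ∷ "" ∷ "" ∷ []) ∷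
  ("" ∷ "" ∷ "" ∷ "" ∷ "" ∷ "" ∷ "" ∷ "" ∷ []) ∷
  ("" ∷ "" ∷ "" ∷ []) ∷
  ("" ∷ []) ∷
  []

K₄⁻-pairs : List (List String)
K₄⁻-pairs =
  ("484" ∷ "-950 1412" ∷ "117 -1193 17" ∷ "" ∷ "395 -2498 -1 18" ∷ "" ∷ "10 783 -10 5 18" ∷ "-287 295 1 -4 -1 2" ∷ "" ∷ []) ∷
  ("1471" ∷ "1181 11" ∷ "" ∷ []) ∷
  []

F₄₂-squares₀ : List (List String)
F₄₂-squares₀ =
  ("208" ∷ "-1477 4459" ∷ "277 -2646 17874" ∷ "-420 1036 106 1272" ∷ "-782 2779 -5281 1603 15333" ∷ "-300 5 6 -458 8 546" ∷
   "1472 -4662 -477 -5717 -1 4 193" ∷ "-333 -169 29 489 -919 719 -63 4164" ∷ "1171 -32 -34 2745 -50 -3256 -1 -8 272" ∷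
   "-991 1867 -2356 1051 -1457 1441 -74 -1042 -132 7860" ∷ "-1134 1901 -729 502 -1242 1695 -81 -871 -200 -3573 6200" ∷ []) ∷
  ("34730" ∷ "568 1368" ∷ "6914 8496 12960" ∷ "2069 2668 2462 6645" ∷ "1770 6722 -599 3144 4129" ∷ "8966 10742 12660 -16815 -20527 20811" ∷
   "-4914 -4434 -1839 9424 12309 -93 1151" ∷ "11701 6470 15623 -18916 -22397 13911 -521 19256" ∷ "3668 4288 5771 2303 -750 711 14 -1380 18517" ∷ []) ∷
  ("45986" ∷ "1209 2805" ∷ "-5440 -12623 237" ∷ "-66 13 -23 5820" ∷ "-7190 -9312 173 2909 6186" ∷ "9035 5469 -100 -1219 -840 19278" ∷
   "12857 6785 -199 -671 69 13414 16806" ∷ "1184 4088 -101 -1383 -4149 525 429 12146" ∷ []) ∷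
  ("27060" ∷ "17570 25475" ∷ "-809 4115 20518" ∷ []) ∷
  ("25827" ∷ []) ∷
  []

F₄₂-squares₁ : List (List String)
F₄₂-squares₁ =
  ("55645" ∷ "-29757 93500" ∷ "-41153 4706 10396" ∷ "-108625 27648 28688 13574" ∷ "67816 -14109 -31181 -8 386" ∷ "4363 42117 915 8707 383 28292" ∷
   "29636 -19094 -7170 -15035 -345 1630 19201" ∷ "22420 3938 -9102 4944 166 -5510 4611 26575" ∷
   "33295 -25504 -9996 -11026 -216 1653 4936 375 20355" ∷ "-21903 42801 6602 19824 583 10920 -1536 10641 -11139 27659" ∷
   "16309 -25394 -5179 -4279 -176 -6757 -2633 -1659 819 -3088 11197" ∷ "-11492 -38621 1501 373 -64 -12446 -7849 -10761 -2885 -2965 -2711 28030" ∷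
   "-26611 -4632 5754 324 -73 -7086 -3059 -5420 -5111 -685 -1116 -960 9959" ∷
   "-60410 12763 23753 587 -235 2816 -326 -5168 1027 -1458 -3441 189 -2601 13923" ∷
   "-87929 34636 42017 5095 -387 184 -2935 944 -10493 -6339 554 -2687 210 -4331 25100" ∷
   "-94758 39643 40119 6365 -269 4741 -2291 2956 -5073 1747 -465 -1603 973 -2129 2237 14654" ∷
   "23539 -13814 -12080 -1883 103 -1782 -2757 -2056 957 235 -1283 -2642 850 388 -7464 -4091 15820" ∷
   "-14277 26786 6372 7833 185 4332 209 4251 -4250 877 -808 -4930 575 -1930 2140 3407 -4733 16871" ∷
   "8401 -19027 -4433 -3583 -67 -6906 -3615 -2980 -2333 -2375 -543 -321 -1346 205 -3227 -3168 -1286 -4431 9880" ∷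
   "-41086 -41 13434 622 -159 -5877 -3622 -4332 -184 -4362 -1157 -34 -2911 -1402 3033 1398 -5700 -5119 -5234 12165" ∷ []) ∷
  ("59372" ∷ "35166 61081" ∷ "16123 2225 73378" ∷ "14266 -37921 17017 82889" ∷ "-33270 -19875 51578 -12893 54940" ∷
   "-2649 -26218 -14687 94980 1129 64670" ∷ "22607 5054 38880 31196 22487 13499 24862" ∷ "84719 42346 54526 73570 2366 5871 -1792 55701" ∷
   "-12010 3354 10691 12065 6437 -2634 -4766 -1564 12587" ∷ "18601 11340 6781 30073 5943 18257 7566 2543 -6088 25044" ∷
   "4430 -7428 22816 45846 4124 23583 -11614 -96 -1796 -8505 41202" ∷ "11793 3034 -3009 9028 4661 2962 5211 4687 399 -2588 625 18358" ∷
   "69233 29059 40364 36417 855 -4835 5544 20771 -86 6099 4718 4459 43056" ∷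
   "936 5228 30871 -23356 3074 -18596 -50 4958 2093 -8137 -641 -4430 19789 33047" ∷
   "1457 3438 41779 16180 17724 4490 -4605 10940 -1710 2469 7055 -279 -620 -4916 40367" ∷
   "-22568 -7694 32783 8504 18246 3283 -5929 214 1479 -5010 5065 -3131 -4200 1019 24652 29743" ∷
   "2373 -425 19962 32 17007 441 1832 3921 -7552 1574 1514 4904 452 400 -2662 -4490 20433" ∷
   "48992 25902 17435 66495 22984 14966 11445 18970 -4778 13767 2263 5169 17049 -22250 4869 -9260 7185 41194" ∷
   "47098 26463 -2486 23516 -16027 61 -4033 5882 1445 1711 2889 727 2754 -524 -1239 1679 6891 2861 24846" ∷
   "10810 -25122 -25306 75432 3897 23540 6661 4157 571 5838 -303 7083 6174 -10266 -396 -2721 3643 20355 591 26264" ∷ []) ∷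
  ("50171" ∷ "-4390 39304" ∷ "-11161 20027 27590" ∷ "5057 3307 4686 32760" ∷ []) ∷
  []

F₄₂-squares₂ : List (List String)
F₄₂-squares₂ =
  ("10513" ∷ "-37928 40911" ∷ "8632 -26420 13870" ∷ "78288 -27845 26868 25057" ∷ "-45034 -4252 1350 24294 46128" ∷
   "-7795 130019 -116919 -32650 -4064 32821" ∷ "108596 -48231 27084 6973 2276 4676 20447" ∷ "138426 2521 -4444 356 -4262 479 -1428 11810" ∷
   "-26542 -16800 14205 -3522 -9541 -15529 -2389 151 34948" ∷ "27293 -19583 42007 4606 19353 -24957 6252 -5567 -4798 37288" ∷
   "-64341 -7452 -7385 -19617 677 -5466 0 -3 0 -2 64" ∷ "40020 -16961 16440 10288 3342 -6935 34 571 273 2557 54 10230" ∷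
   "-63559 -6139 -4536 8841 -16269 -6089 -23674 -2373 942 -8814 -288 4651 29532" ∷
   "46675 -31652 38261 15707 5504 -10101 -482 -912 -2526 8998 -174 12421 2441 44307" ∷
   "40840 -54707 40683 20801 2889 -5947 -723 3657 -4789 -7754 -261 1410 -4907 11738 51691" ∷
   "114438 69949 -65925 -52422 -23177 18929 6727 1072 -3149 -9429 25 13 -6987 -13661 -22585 35143" ∷
   "-49678 -32578 5014 7976 310 4065 -1189 -384 -104 -487 15 -13165 1585 2915 2489 -2994 17728" ∷
   "86850 81745 -56312 -17275 -22587 27349 -224 1381 -690 -11447 22 -8529 -1658 -13665 -5248 7511 -11745 26072" ∷
   "-25080 -34299 9088 20026 -492 5420 -105 452 95 86 165 -579 541 32 -72 -287 -42 -251 2544" ∷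
   "17062 105200 -91891 -83391 -39936 38100 4566 2933 -4171 -17771 323 -19772 -7616 -11863 -2843 9524 -10921 10276 -7936 35358" ∷
   "-52072 -11095 -141 4292 -6096 -5464 -5257 -1348 -499 -1607 -125 2800 2018 -1493 -5707 -3828 -815 -618 1901 -2943 22026" ∷
   "-3531 -7511 28030 5675 20182 -20438 2074 -3497 665 9781 -480 4543 -2005 4608 3066 -3751 4253 -5237 2366 -8088 -1939 16639" ∷
   "-25193 -23498 6946 -4155 -5431 -9735 119 191 -155 -7024 -6 -1640 -1748 -7534 -4002 914 -483 1041 1782 -441 -579 -3260 11299" ∷
   "55596 -27010 32674 23177 14080 -14531 -751 -1931 369 11154 -214 9238 4895 12039 4191 -5579 2883 -8629 -153 -5035 66 1018 -5118 17326" ∷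
   "-45583 -26888 9196 13817 7049 -8 1157 732 -1610 559 100 -2170 -3314 1416 1332 -4447 2171 -5136 -153 -2069 -3849 -3264 -197 -4776 14947" ∷
   "21676 137803 -116241 -71241 -25832 36909 6472 5339 -3019 -17312 388 -10196 -9422 -23809 -11591 11463 -12365 10169 -6049 5895 -2996 -5147 590 -7599 -10095 25394" ∷
   "64416 -52428 31182 18863 2494 3824 1250 864 815 40 56 -2426 -1834 2084 3150 -3777 1842 1198 -799 1604 -3596 -3441 -4922 -5923 -1629 -9492 16453" ∷
   "121915 41128 -33482 -19054 -9537 16143 2212 111 -159 -4179 -117 -2386 -2189 -5113 -1476 2829 -5234 4755 -1977 4820 -3134 -2663 -737 -88 -6522 844 -4500 15655" ∷ []) ∷
  ("94762" ∷ "78792 99014" ∷ "-36906 -13724 83350" ∷ "-27751 -28577 -84558 130573" ∷ "514 3191 22533 10008 44446" ∷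
   "57128 50575 -7938 -23232 -1267 35630" ∷ "41146 39891 -16191 -1466 -326 14259 16799" ∷ "23524 31569 361 -7059 3928 7580 5068 26731" ∷
   "-1020 12935 3493 -1285 -135 -998 3984 16805 24662" ∷ "26901 6735 -46897 42292 -2692 16783 14330 -8589 -8207 44850" ∷
   "-25487 -12709 31469 -23148 11896 -17384 -10581 20788 4573 -6896 19550" ∷
   "-70415 -55151 -3512 55033 17194 -31937 -1946 9881 16170 3331 -899 29028" ∷ []) ∷
  ("74170" ∷ "11208 39988" ∷ "61956 67764 21748" ∷ "109145 26843 9853 27863" ∷ "38772 25699 16320 -821 44057" ∷ "21521 -7281 7325 -4064 8332 25019" ∷
   "22470 16210 2249 3320 36 -4449 16928" ∷ "-5250 58216 6288 16065 -1354 -1314 3592 28257" ∷ "51173 55467 10360 17841 7870 14415 667 19279 20166" ∷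
   "38950 21522 13421 -5352 11131 11726 -3952 -3436 1907 29644" ∷ "-6415 14512 17324 -3936 18921 20232 -6364 7227 5020 11325 27289" ∷
   "10532 19378 2609 6335 -4118 -365 2402 7088 6402 -1029 -2305 16801" ∷ []) ∷
  ("64600" ∷ "16760 63814" ∷ "6243 7468 43496" ∷ "-32972 -13072 -9909 73584" ∷ "-35315 -7279 -568 -2805 53406" ∷
   "-22664 1303 31100 34185 3052 23555" ∷ "23084 -8275 -28350 -20291 -11159 -14011 30615" ∷ "-5165 2770 -2396 3535 3476 6487 -5841 17475" ∷
   "-11145 642 921 -8176 -6026 -10470 13368 -8725 27759" ∷ "16487 20531 17009 -17806 1448 -14885 -18106 -4681 -6013 42927" ∷
   "2404 -8262 -24304 5099 1323 951 -28878 -8597 -10048 13743 30795" ∷ "-15844 -17286 -40440 -972 21951 3920 -22722 5586 -22860 2642 6600 33278" ∷ []) ∷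
  []

F₄₂-squares₃ : List (List String)
F₄₂-squares₃ =
  ("65400" ∷ "-16814 58909" ∷ "75149 -61468 34543" ∷ "-244964 -72637 -116452 160122" ∷ "11687 37727 9761 -39926 30882" ∷
   "45229 71068 26605 -47468 10959 17640" ∷ "57668 18187 44222 2451 -705 12601 40675" ∷ "34765 66533 17585 -36995 -6408 -11176 -17185 32529" ∷
   "-39643 -36335 -24947 -10611 15397 21246 9221 -35512 34189" ∷ "-70509 6787 -40205 3541 475 -2138 1057 2051 -2867 8535" ∷
   "74860 -52274 42090 12122 -8601 -3998 1445 -1140 -3969 467 17462" ∷ "36958 -1719 37397 79302 -20073 -30784 -4719 9957 -13809 7961 -806 30641" ∷
   "-89972 -110722 -76657 -31676 4939 11829 -2940 -2519 6507 -9213 -9838 -8191 15096" ∷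
   "-102119 -57787 -56207 54492 -12500 -19004 -163 -735 440 726 -1372 18 -804 7087" ∷
   "-15297 -31247 -2022 37526 -4502 -11531 7939 -2072 -5383 7380 3301 -1140 -60 1235 12108" ∷
   "-216518 -96447 -106060 161700 -51086 -53458 -3987 4690 -24523 6469 -9553 9198 2666 2517 4626 45092" ∷
   "37437 54741 28447 -10281 3747 562 -4098 1524 -6529 5350 1413 1035 -1681 -262 3883 -1106 14318" ∷
   "-32395 -19787 -30881 -22172 2112 13257 -7965 -7431 11037 -13230 -5648 -4797 -3388 595 -14429 272 -4982 12051" ∷
   "-13417 -49799 -14143 140 4196 6313 5120 -10232 3234 -2282 84 -7118 -542 510 726 -3781 -2616 -1521 11067" ∷
   "-62041 -36813 -34174 53512 -23165 -15878 -6986 2921 996 -4764 -4283 793 -1870 -246 -6505 1940 -4214 2018 -5339 14785" ∷ []) ∷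
  ("108437" ∷ "35053 70615" ∷ "-2766 10795 92561" ∷ "81907 43342 37567 101125" ∷ "-17627 92313 -27527 -87612 170719" ∷
   "16007 57553 9659 -312 147175 51387" ∷ "-16142 62401 19837 18862 -6834 -1905 28771" ∷ "16303 -28077 -2221 10465 -6133 -33791 -10413 85222" ∷
   "3445 40096 -2880 -22530 144440 54432 -15185 -34732 24749" ∷ "9123 -42737 -3413 -20333 137488 53452 -15221 -13898 3213 27759" ∷
   "12577 18985 -2547 6186 -94848 -28504 3960 1848 -7554 -348 13993" ∷ "-6735 -142000 5320 28802 -188963 -1345 14406 -54002 4382 9627 8551 67155" ∷
   "73754 46288 32746 72068 5356 8842 1338 -13974 -6312 1956 627 1391 40466" ∷
   "13064 72636 21398 7634 217192 71597 -1500 -27433 8451 -693 -19567 -3666 1478 23237" ∷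
   "53151 -9814 -11935 16978 25207 12331 -10249 -4834 -492 14223 3546 3483 20531 -5615 27081" ∷
   "9435 -43475 31862 64924 62866 49465 934 -55194 9390 4235 -3227 4231 8103 3113 1471 28597" ∷
   "9121 -8339 22607 39610 -19754 27849 6871 -57470 -481 5232 1829 14278 5141 1142 -1697 5885 29944" ∷
   "18563 -84438 23523 47955 59571 56885 -5158 -44444 4192 14640 -4140 8099 9203 -6584 4132 8745 11193 29027" ∷
   "-7161 52469 -16005 -58411 114754 36316 -2978 -14813 7386 2483 -3765 5866 -4165 4769 1244 -4675 6449 -6076 21815" ∷
   "19283 13375 -16056 -44053 164522 40836 -8715 3463 9178 6289 -8064 -3808 -667 -94 6420 -4799 -8619 2134 5900 22187" ∷ []) ∷
  ("57148" ∷ "-8199 69933" ∷ "-19889 -20843 70024" ∷ "-25567 -72569 79997 41355" ∷ []) ∷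
  []

F₄₂-squares₄ : List (List String)
F₄₂-squares₄ =
  ("49388" ∷ "-122701 73599" ∷ "-36580 20359 19383" ∷ "-150150 84239 992 52001" ∷ "30675 -18400 0 0 23" ∷ "18816 -11754 -751 74 9 5596" ∷
   "27176 -18790 -1539 -322 3 -23 13797" ∷ "-135832 79985 -548 1011 -90 -464 -3075 23034" ∷ "27931 -16885 -1590 -3148 9 614 -3014 -3366 6269" ∷
   "-40501 24452 1133 928 -14 -3939 -661 80 -4427 8077" ∷ "-58811 35340 632 342 -36 -2822 -536 711 -1014 -473 3252" ∷ []) ∷
  ("71991" ∷ "66087 8126" ∷ "28223 -9061 35304" ∷ "-2722 -4981 -10610 52840" ∷ "45310 -4250 11738 -13406 20890" ∷
   "-58816 -9218 -4142 10449 2539 31068" ∷ "-14956 5479 7533 -11701 62 -13786 14492" ∷ "-20098 646 -2596 4108 -220 10913 615 4448" ∷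
   "-27423 -9055 -473 3776 5183 14507 -3837 2939 14129" ∷ []) ∷
  ("120620" ∷ "201672 81355" ∷ "-1157 10407 47441" ∷ "121889 14366 3693 35585" ∷ "2886 9663 21353 5561 13450" ∷
   "146058 17277 -2629 16231 -5525 25710" ∷ "135973 17112 -1833 17021 -2928 19150 15943" ∷ "144035 19863 4870 13757 -5588 15659 616 16727" ∷ []) ∷
  ("49025" ∷ "45343 35667" ∷ "8090 6410 14068" ∷ []) ∷
  ("23148" ∷ []) ∷
  []

F₄₂-pairs : List (List String)
F₄₂-pairs =
  ("31698" ∷ "-30249 1426" ∷ "21831 -6615 578" ∷ "-36838 -1154 2159 2228" ∷ "35495 5411 -7295 -5372 4093" ∷ "-25168 -2101 6140 626 -79 1766" ∷
   "1204 3634 2025 -553 -2097 123 3129" ∷ "-5163 -504 -1358 1061 -867 -890 -174 19" ∷ "-1327 857 878 -1040 988 852 -453 -26 997" ∷ []) ∷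
  ("30877" ∷ "17666 9574" ∷ "18063 10388 1268" ∷ []) ∷
  []

F₄₂-triples : List (List String)
F₄₂-triples =
  ("3170" ∷ "-3257 16" ∷ []) ∷
  []

codegree-squares₀ : List (List String)
codegree-squares₀ =
  ("58740" ∷ "-59635 7866" ∷ "257984 209756 85007" ∷ "1045115 -317875 -346101 188703" ∷ "197159 -165071 -127744 53200 3302" ∷
   "-484191 125850 143821 -80299 -46 642" ∷ "-119321 128609 98074 -39247 -3508 1400 4094" ∷ "338735 -118643 -128518 69156 1073 -1270 -1318 1307" ∷
   "-44202 -16784 -1603 -4425 1667 -249 -1290 -43 797" ∷ "395461 -108398 -123135 67739 -907 -1357 -981 -541 -1302 1327" ∷
   "188450 -12408 -40074 29687 -1715 -900 124 -201 -1017 -156 859" ∷ []) ∷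
  ("596059" ∷ "241191 270144" ∷ "185623 -549697 419261" ∷ "-259896 22450 -92549 16168" ∷ "-179722 -75396 43308 10964 1646" ∷
   "424205 277445 167332 -18116 -1850 1826" ∷ "-771796 158874 -313533 20122 3625 -430 2173" ∷ "360207 -577946 411913 -15532 -1344 990 -187 2095" ∷
   "382723 100737 27515 -4967 -1386 -148 -336 26 2169" ∷ []) ∷
  ("869085" ∷ "1092343 23096" ∷ "-291139 6769 6836" ∷ "88218 -17395 -10184 2761" ∷ "-572216 -11670 646 368 1445" ∷
   "843780 25302 3299 -453 -1223 2711" ∷ "1162638 34393 3234 632 -1793 -108 3480" ∷ "574674 17006 2153 840 -334 -204 -124 1766" ∷ []) ∷
  ("445290" ∷ "182432 3361" ∷ "172857 -962 2659" ∷ []) ∷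
  ("423660" ∷ []) ∷
  []

codegree-squares₁ : List (List String)
codegree-squares₁ =
  ("1228819" ∷ "68651 1794453" ∷ "-436563 -325302 809234" ∷ "-1622205 533383 457282 265912" ∷ "545274 -102274 -193785 246259 316136" ∷
   "234628 1404874 14948 399564 143894 189336" ∷ "581392 -510486 621655 -20921 346392 -66402 12450" ∷
   "-206578 115859 503044 1145200 360799 -58072 -8604 24231" ∷ "283308 -452504 40242 162177 19297 64427 4209 2471 6291" ∷
   "-209511 1055008 10497 212512 23590 247284 4538 -10080 9127 15248" ∷ "-323643 -1015006 17084 -70055 392808 -104905 -334 -3333 -7266 -5246 3691" ∷
   "-342689 -656355 -216993 -33688 -42823 -309420 -11640 12586 -14383 -6491 1675 6112" ∷
   "-329987 109981 -845160 -1382902 -407642 101131 11357 -29875 -263 905 3051 -1167 5629" ∷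
   "-1071801 56009 -484638 96815 -373405 -16780 -5339 14178 -2396 -8397 -543 91 -623 3962" ∷
   "-487129 97186 232981 -552444 -669292 -37809 -2886 -935 -2451 1356 -2843 -369 -1389 -1022 3192" ∷
   "-927525 894959 596696 -537122 -535864 33138 2311 -6785 3522 5293 -3495 -1396 -1197 -1092 65 5804" ∷
   "284848 24801 -184114 218862 35329 11080 -3500 7837 -4641 -7239 3894 296 1442 1235 -150 -905 3243" ∷
   "-212436 873714 -53216 -802749 216764 189389 14753 -36140 8861 11036 442 -1697 2360 -1618 -624 672 -2939 4651" ∷
   "-104954 -553138 -59168 -333599 -353170 -84739 -1886 -421 1459 2582 -2763 132 -1301 -389 -159 7 -561 -393 913" ∷
   "-697969 -81677 117027 52993 -276094 -139658 -5339 11834 -1912 -1826 -3981 589 -3182 -367 424 186 -1252 -1690 -1176 2980" ∷ []) ∷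
  ("1677596" ∷ "1044276 1547902" ∷ "159492 -165736 1666901" ∷ "-521955 625058 -1544906 722838" ∷ "-283082 -1165205 1367627 409530 824527" ∷
   "-762967 294100 -1921926 1170187 1182657 690773" ∷ "54266 -52993 557731 668194 1031645 -1358 51218" ∷
   "72299 524318 1420733 230523 -73870 72390 -145102 26726" ∷ "-427624 -376482 -682317 862177 369117 -160865 -134047 -453 25088" ∷
   "-609163 597317 -604205 827735 1106895 388733 221809 -19773 -19244 12490" ∷
   "-453935 1167422 -528438 -242914 -615289 177867 -2595 3905 -11110 -2651 5597" ∷
   "-3413 374938 215750 210751 26173 -190460 -10439 15478 5109 1379 -487 12400" ∷
   "750980 759490 532130 305635 -701446 -34599 -86354 -661 -7331 6573 437 -3381 10535" ∷
   "15608 249986 579928 56656 -578926 9746 -127482 1805 -1629 240 97 -4353 5614 4856" ∷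
   "245446 -15195 604859 605156 366141 234314 -620389 60102 66632 -30971 -4977 4006 -8842 2833 18224" ∷
   "-565395 -728191 -57278 875811 582582 278477 -1068133 97806 113888 -60013 -7348 280 -12895 6290 28271 10205" ∷
   "-108346 -91541 148297 288742 -20706 222623 -141981 8204 3224 -4817 -1349 -1075 1674 2682 2274 1004 2807" ∷
   "-832714 798321 295977 832306 -281855 316651 -224697 25892 2245 997 -3600 3217 10092 -5350 6987 -1247 1191 9179" ∷
   "-319775 1388230 21315 -424636 -823034 77947 29814 -269 -16139 1585 741 0 1275 777 -750 -123 819 505 2651" ∷
   "-936662 594728 -320225 421174 -243698 375978 176869 -7607 -34724 19034 -931 6257 10520 -8506 -2665 -4516 832 8025 673 5190" ∷ []) ∷
  ("1197774" ∷ "245072 189443" ∷ "-182240 618708 106580" ∷ "20544 337928 -228736 50322" ∷ []) ∷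
  []

codegree-squares₂ : List (List String)
codegree-squares₂ =
  ("875448" ∷ "49444 1541679" ∷ "-377263 282136 858981" ∷ "-1460622 939723 1567795 1500558" ∷ "825786 -237565 -573146 -1103554 436298" ∷
   "-258377 -3364166 -2227323 309035 -925031 263706" ∷ "-185789 129424 919211 -79043 769843 -274276 192595" ∷
   "-1479813 -1158967 90228 263243 139339 -176417 605127 31046" ∷ "674206 43435 186130 85003 -39070 -260184 716577 36496 22424" ∷
   "-382514 744734 769463 775512 1493880 -530219 -706595 -69658 -53794 51637" ∷
   "266099 -193987 -275448 -358972 118328 26596 -401703 -27979 -15024 15156 5049" ∷
   "-488772 37871 697682 -115778 1123657 -565903 778488 16566 -12136 23982 -5292 10725" ∷
   "-52911 445079 270364 -446777 -932615 284283 114733 24756 19325 -25651 -4225 -2729 8345" ∷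
   "-955726 694053 994475 937492 1361445 -155030 -488405 -51989 -37659 38672 8598 8167 -9960 10681" ∷
   "1086192 80024 -216808 -666813 809325 -611548 612604 23393 1476 5898 -4215 1597 215 -4846 7712" ∷
   "-741108 -3726677 -1050037 316734 280506 -29842 28585 -16318 -18137 22551 -182 8051 -4825 6338 -4800 6371" ∷
   "572696 -28098 388473 275398 -220462 99340 -55379 12704 15429 -19949 -1533 -3953 -1623 1720 -423 1478 3989" ∷
   "-112691 -1961943 -1228043 675483 -1740844 430033 -209530 12306 31397 -29492 -8352 -3953 6254 1420 -2708 5355 -2161 13365" ∷
   "24798 507541 197341 -342999 -420074 130124 274139 30450 22121 -26717 -3207 -3410 2058 -2340 713 -2786 -1308 -826 2200" ∷
   "570892 -2902897 -1734012 1126997 -1652380 915398 -1837029 -71985 -5618 -10159 6828 -11916 -4361 4727 -4272 6334 6508 3678 -7627 8470" ∷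
   "160050 -426870 448637 4001 -227838 -114010 45177 3974 -5569 -1820 -9785 -3469 10947 -1850 -3227 751 -893 -378 1307 -1010 6476" ∷
   "-30223 933788 500807 519357 1103710 -405163 -177440 -31496 -28905 32124 1220 2648 -3302 856 -77 1222 240 -225 -135 -346 1045 2486" ∷
   "367835 287409 212027 -664512 -264878 143108 333910 25385 22929 -12542 3287 3791 -3511 504 183 1838 1473 1663 -2072 1194 -2368 -2119 2950" ∷
   "-1006279 479696 790113 790825 1299155 -524038 -33243 -32935 -37246 42088 1978 5465 -1767 -2924 2239 -3083 -1565 -997 -59 -475 -62 692 -1842 4272" ∷
   "373009 -116914 -155590 -303993 -209 -34016 -41380 3336 1157 -7984 -2973 -4091 3358 -1211 -693 -790 -1219 -1164 1647 -1271 1953 852 -755 -402 2038" ∷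
   "50000 -3318727 -2386052 930025 -1029129 720814 -667146 -29225 7673 814 17496 2264 -15541 7827 -671 3391 3394 2303 -4358 946 -6950 -3035 -433 -2089 -3266 3506" ∷
   "155017 337144 181660 -302837 276361 -102028 153882 11452 7635 -6531 1555 -531 -1086 -2958 4009 -2779 -91 8 -2296 -425 -1687 -1040 -345 421 -708 -1035 3338" ∷
   "-604552 -2189286 -915937 287246 -619264 241524 319993 23739 19918 -9842 2117 3394 -6951 4217 238 4317 2185 2260 -2100 182 -4061 -1018 1225 -1652 -853 -125 -2105 4367" ∷ []) ∷
  ("1653077" ∷ "785473 1837286" ∷ "-983335 -517317 773517" ∷ "844817 -1430960 1746376 3643282" ∷ "61841 -288709 -319809 123114 609101" ∷
   "626361 654224 83022 -312852 -146681 13504" ∷ "844804 1004143 161739 121824 -59713 9008 7201" ∷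
   "527916 1284085 842467 -73241 294941 21157 43628 20740" ∷ "120770 638496 385695 -308719 -233054 8677 3746 2429 2725" ∷
   "1577048 208139 350090 1523785 564579 14043 22191 7852 -4339 4807" ∷ "-734867 42254 555649 -297152 284875 5489 18202 13291 3506 -59 5408" ∷
   "-395778 -1006624 930275 1542780 144901 -6788 1926 3188 3661 531 1246 6564" ∷ []) ∷
  ("1464747" ∷ "-191116 1702093" ∷ "1125902 254479 491500" ∷ "1557027 -241356 -718893 340316" ∷ "815985 -44585 -210686 331769 13273" ∷
   "724311 159094 712337 798479 31288 22461" ∷ "153461 444242 540800 21822 303 3934 4814" ∷ "-622896 967569 147708 -208653 -9799 -3843 1956 5797" ∷
   "397466 660868 326079 492590 19763 14250 -1621 -458 3170" ∷ "384735 -170780 165924 325487 10372 2085 2994 2918 -5710 3828" ∷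
   "260981 446618 -128949 582333 20487 6207 -1060 1969 -998 1571 4291" ∷ "390612 429798 560763 196654 8571 10832 938 -774 1287 -26 -2026 4381" ∷ []) ∷
  ("1507925" ∷ "289878 1347903" ∷ "660935 790681 562275" ∷ "502940 -1441702 -596865 740694" ∷ "-149005 6412 197318 144925 653980" ∷
   "-827493 -116647 -386251 368866 63286 31424" ∷ "551701 -315067 273494 -515062 582346 -181246 30597" ∷
   "-566444 545762 -94809 -261554 192935 -105322 23170 7048" ∷ "-220714 -290358 95345 309421 -76643 133182 -29348 567 6502" ∷
   "-450179 907888 703322 -769622 -651130 -94801 15410 -7331 -13757 5181" ∷
   "1155375 -36438 -386112 -660526 -578365 -91382 16945 -2037 -9697 1113 6619" ∷
   "331140 -287858 -909340 -437331 -474569 -110689 25944 1767 -6756 -147 4688 7468" ∷ []) ∷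
  []

codegree-squares₃ : List (List String)
codegree-squares₃ =
  ("1283435" ∷ "-1160790 1868395" ∷ "815401 -277462 555166" ∷ "-4574680 -3002874 -3333323 263387" ∷ "446125 553348 148650 179836 123583" ∷
   "430310 1457101 747636 -107633 -6611 15822" ∷ "675800 280443 289835 404255 170572 -69284 27350" ∷
   "402665 1352418 993693 -1052236 -424308 143841 -46340 16723" ∷ "-328149 -775019 -816435 837370 326791 -125430 39206 -14884 5402" ∷
   "-1839107 -703556 -800252 -100612 -40352 17522 -11446 4895 -1305 8499" ∷ "800699 -28091 165462 -52968 -29872 19580 -7211 1608 -1168 -3829 2736" ∷
   "-295641 843038 -557952 -1030577 -463923 205707 -81474 19080 -1663 -3601 3050 11457" ∷
   "-268615 -3786435 -750903 63345 -17871 -73063 32611 -9134 1281 -1149 -2691 -3923 5010" ∷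
   "-2706109 -2602058 -1875104 318525 85112 -58086 11678 -5117 441 5219 -2329 -1011 -1370 5491" ∷
   "-1612528 -930427 -620294 155943 88533 16655 -15843 7013 -6507 7518 -1504 104 -2330 1287 5759" ∷
   "-2041379 -2006759 -2071856 -672424 -481356 44641 -14654 512 181 -15860 2238 3030 2469 -3775 -2374 12735" ∷
   "280233 847779 492271 -158523 -29182 42535 -13444 4506 -838 -490 287 412 -23 -1139 716 581 3510" ∷
   "215735 -850490 -489363 156517 15702 -50785 19452 -10654 2617 -3399 96 -1041 1087 643 -4379 -921 -3279 3694" ∷
   "-419729 -1240112 -375165 386854 164870 -58416 16915 -4145 -1370 4329 -1743 -2053 -559 754 1219 -1115 -341 -447 1710" ∷
   "-806331 -448988 -839853 -662196 -407708 47319 -15123 3662 3267 -8351 1657 3172 1572 -3018 -3820 1828 -943 -767 -2745 3399" ∷ []) ∷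
  ("1614938" ∷ "1269596 1288817" ∷ "-706005 648431 593600" ∷ "55942 1631000 -987771 1197441" ∷ "570963 833672 -2042091 -827290 1238527" ∷
   "1139815 618446 -4052442 -277438 1431255 1264541" ∷ "-286896 1752623 -627835 639078 294700 -834094 185044" ∷
   "-1173871 -7755 -1010265 -641326 -1154625 -288331 -669698 355593" ∷ "578894 1558339 -2699450 -1130028 1908294 2404043 205380 -140001 28193" ∷
   "1606935 -2664062 -1717591 -164581 1565519 1311167 -182845 -171079 -26214 20220" ∷
   "-368625 920679 2005343 801534 -1144826 -1011909 -371515 56233 -27073 3438 8545" ∷
   "1338532 -1739885 4240185 1020833 -178714 -140817 385686 -293095 -1090 9671 2897 19885" ∷
   "265266 639212 -1025302 540794 -773017 107093 823239 182994 83008 -24930 -20265 -107 23225" ∷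
   "1681666 258442 -3640953 -249596 1924875 1015698 448376 -105114 27069 -4861 -8718 289 1480 8072" ∷
   "1070829 -787793 -517579 -48450 -283813 279997 -91551 76107 6871 574 -4751 -1359 6069 -314 4277" ∷
   "378133 -1077177 -186646 509195 1082399 936820 660853 -251998 18519 -971 -4086 5142 -3140 2990 1216 13880" ∷
   "-59518 472272 624821 992648 870373 381155 300686 -246046 -5228 6878 3789 5500 -1759 1278 -1047 456 6179" ∷
   "-160712 -1318306 -88049 1212032 1134243 2216167 185505 -326178 -9581 19635 5216 511 -3656 -2303 -1948 -274 8390 13987" ∷
   "1329479 333850 -2151525 -922280 1255261 639131 142174 -13845 18207 -6401 -4406 3573 2913 2046 -33 -316 -1132 -4720 4590" ∷
   "1425688 -1145567 -2641766 -832550 934035 1473672 274755 34218 36935 -6644 -11337 -884 9454 -2155 -166 -12 -877 1563 1864 6100" ∷ []) ∷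
  ("700517" ∷ "-366186 1258526" ∷ "672445 42769 1196076" ∷ "-111700 -1635950 1944035 10810" ∷ []) ∷
  []

codegree-squares₄ : List (List String)
codegree-squares₄ =
  ("219234" ∷ "-1832537 3722289" ∷ "-341463 1167066 29926" ∷ "-2357035 1098013 422373 278162" ∷ "264445 -888914 -48696 -8842 2341" ∷
   "511655 -217715 378509 67520 -21957 11486" ∷ "355118 -33282 80264 4225 -5283 1804 1736" ∷
   "-1689690 2512080 -513030 -108755 27638 -12000 -6038 7671" ∷ "340582 -308816 93465 11754 -6468 1815 964 -1324 1528" ∷
   "-517915 704232 -62910 -1392 4785 -2344 -854 824 -1214 1827" ∷ "-771223 1060634 -122675 -16399 7973 -4212 -1349 836 -992 -767 1529" ∷ []) ∷
  ("249815" ∷ "1510598 1257496" ∷ "-115243 15627 98345" ∷ "-1374406 319776 2196654 211644" ∷ "-186131 292309 -60111 -35489 11065" ∷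
   "707541 -1651858 -632253 22971 -32226 11398" ∷ "-67130 255892 -103894 -23031 4508 156 2391" ∷ "519587 -326057 -338594 994 -11065 4444 1716 3781" ∷
   "70703 -908114 -617289 -38798 -4139 7129 4354 6090 5958" ∷ []) ∷
  ("2471339" ∷ "2764768 47279" ∷ "-96865 8527 186179" ∷ "2504049 -6593 -490277 56054" ∷ "-199639 6457 -33222 15661 2254" ∷
   "2753769 7891 -138954 29517 1659 6097" ∷ "2774252 -694 -208906 19918 747 4698 2775" ∷ "3364262 16883 194642 11758 -151 3058 -1262 4775" ∷ []) ∷
  ("219668" ∷ "2280062 54372" ∷ "110809 1692 3625" ∷ []) ∷
  ("552377" ∷ []) ∷
  []

codegree-pairs : List (List String)
codegree-pairs =
  ("172127" ∷ "-366264 13775" ∷ "450782 -23342 10792" ∷ "-546212 20551 -14566 3146" ∷ "609686 -28130 20603 -6084 2239" ∷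
   "-954350 50770 -33157 2047 -1469 3647" ∷ "-109127 7289 -336 -6 445 137 680" ∷ "-9156 -2942 -958 927 -604 -776 -144 271" ∷
   "-187540 12104 -6352 -1369 341 1634 -543 -1024 524" ∷ []) ∷
  ("487520" ∷ "533642 11174" ∷ "577688 22017 1102" ∷ []) ∷
  []

codegree-triples : List (List String)
codegree-triples =
  ("7459" ∷ "-10322 88" ∷ []) ∷
  []

codegree-weights : List String
codegree-weights =
  "0 7936415 16 41724 18 224466 19 9894 24 92616 28 290173221 58 19244514 82 107506116 90 45114 114 1522517004 122 475284 126 308721357" ∷
  "152 143580 184 19470 192 462623166 200 472605456 208 289165656 210 452484 211 91072230 216 29460 218 52560 219 23088 220 21918 250 162744" ∷
  "256 250354278 272 495606984 274 1511652 275 354251088 280 200388 284 833040 314 59172 320 25422 328 242722566 336 17388 338 27444 339 11298" ∷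
  "344 34314 346 123630 347 19624 348 315069738 370 888276 378 576588 382 158502 384 751849803 400 629995518 402 345348633 403 400806783" ∷
  "408 283248 412 1344242454 424 347715960 440 189816 442 574529580 443 187254 448 424047192 456 160332 464 1505931360 466 740376504" ∷
  "467 649374132 472 657511752 474 234251262 475 158676 476 863535168 480 374205870 488 842234064 492 743459212 496 501119010 498 560768934" ∷
  "499 186847827 504 1308864456 506 2306750784 507 153606 508 1815247302 510 1889593374 511 219237 512 174963957 528 418569906 530 144671700" ∷
  "531 300347861 536 570147996 540 674904936 570 15816 594 944004 602 477222 626 1577747022 634 1010737188 638 1055742153 664 141288" ∷
  "696 485680392 704 25560 712 77510424 720 99462 722 36288 723 22746 728 70920 730 11430 731 80292 732 1456842 762 1218912 768 178763658" ∷
  "784 546828 786 24950436 787 956912022 792 691728804 796 393828 826 67020 832 294394488 840 39584 848 28182 850 176388 851 1779722760" ∷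
  "856 410076 858 33672 859 55880 860 151158 882 340389660 890 147972 894 11715462 896 597803058 912 583273914 914 153033 915 239931981" ∷
  "920 240768 924 1436133720 936 193035822 952 235624320 954 1549885440 955 5235576 960 253213116 968 56124 976 1451366136 978 94822200" ∷
  "979 882804072 984 334680 986 304518 987 117618 988 1528034724 992 823749516 1000 1633298028 1004 1270842327 1008 1252255275 1010 2078770392" ∷
  "1011 1885293 1016 611327964 1018 5740344108 1019 1525901166 1020 559028694 1022 1283417586 1023 765028074" ∷ []

positive-squares₀ : List (List String)
positive-squares₀ =
  ("" ∷ "351" ∷ "-336 204" ∷ "268 0 25" ∷ "-91 0 6 63" ∷ "1 0 0 0 5" ∷ "-1234 -6 -25 6 -2 51" ∷ "-192 1 -14 -4 -6 -5 18" ∷ "455 1 14 5 0 -4 -26 30" ∷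
   "85 -37 11 -13 5 4 -7 -9 137" ∷ "6 1 3 -5 -1 -8 2 -11 -9 35" ∷ []) ∷
  ("106" ∷ "14 22" ∷ "-1162 -1704 549" ∷ "54 72 -30 30" ∷ "-316 -479 134 76 68" ∷ "247 380 -108 -25 -34 77" ∷ "-91 -140 54 42 -4 7 52" ∷
   "-373 -553 180 4 -14 0 0 144" ∷ "-713 -1031 303 113 25 -89 4 153 275" ∷ []) ∷
  ("439" ∷ "-381 310" ∷ "1177 -940 100" ∷ "145 -121 -10 24" ∷ "417 -343 17 44 41" ∷ "-1103 1068 -31 -139 -47 482" ∷ "-786 743 -44 -73 -24 332 212" ∷
   "53 -59 -1 17 3 -15 4 59" ∷ []) ∷
  ("291" ∷ "-1649 485" ∷ "1403 -414 438" ∷ []) ∷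
  ("1089" ∷ []) ∷
  []

positive-squares₁ : List (List String)
positive-squares₁ =
  ("3835" ∷ "-3233 4266" ∷ "2414 -2078 3080" ∷ "-2603 718 1730 808" ∷ "1333 -434 1286 537 1951" ∷ "722 245 1464 -363 -2437 483" ∷
   "1138 -904 790 -3013 695 1595 911" ∷ "-331 -995 904 1779 70 -491 -434 261" ∷ "2635 -1332 -1456 -1079 1834 811 38 183 309" ∷
   "-4896 287 -2250 855 1481 -656 63 -104 -133 259" ∷ "802 566 -906 -82 -2202 -236 -202 35 2 -57 299" ∷
   "-1073 -152 -84 1274 -148 -955 -148 -96 -176 29 -3 259" ∷ "662 -25 -2741 -922 -554 -129 -7 -63 -11 -17 3 -9 51" ∷
   "-3811 883 -1401 363 -1118 -267 -13 -13 -67 72 79 17 -28 106" ∷ "3195 -791 1520 -979 -285 572 231 -108 60 -39 -58 -20 -27 10 149" ∷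
   "2173 104 903 -588 1015 540 78 36 126 -113 -82 -40 27 -104 -27 75" ∷ "587 166 1468 206 -189 486 -71 61 174 8 80 -38 59 17 49 94 306" ∷
   "-656 428 -280 435 1001 -454 20 -141 -157 -23 25 -28 45 -42 -59 -40 -120 177" ∷
   "333 -573 64 -66 -2127 -470 -102 -20 -61 50 -101 39 -51 -80 -6 -64 -40 -81 219" ∷
   "57 -529 -1674 -518 -626 -126 -9 65 -39 -27 -79 37 -80 34 -24 -40 -32 -24 -28 113" ∷ []) ∷
  ("4318" ∷ "4472 6814" ∷ "-1395 -562 6834" ∷ "5343 1241 -4638 649" ∷ "-6543 -1413 2005 -2376 2342" ∷ "-666 778 -877 1752 -1679 542" ∷
   "3011 -42 3324 -2627 3874 -2071 2972" ∷ "5276 1418 4514 -39 943 738 466 1311" ∷ "-4653 4346 -1088 -470 117 17 -601 -367 174" ∷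
   "255 -121 608 710 -422 351 248 412 -136 130" ∷ "4108 -1776 -883 2028 -905 -367 733 269 -153 -88 553" ∷
   "5458 -1237 2970 -793 2448 -2582 2742 44 -12 -190 754 291" ∷ "3771 810 1475 313 -421 -1695 636 -857 136 -199 492 286 556" ∷
   "-293 -718 2110 -1646 2120 -1870 1521 -441 95 -132 331 248 238 372" ∷ "-471 650 1594 738 -336 1714 -705 1064 -210 239 -77 -273 -156 -68 356" ∷
   "-4236 -1953 1045 2139 -1328 2215 -114 1447 -390 266 -203 -283 -149 59 132 399" ∷
   "148 1795 251 -555 540 -1987 550 -1035 318 -268 465 289 157 -75 -106 -83 360" ∷
   "5762 -3428 3105 645 931 -1119 2914 810 -370 -24 248 166 -57 64 -49 125 -61 229" ∷
   "3668 4209 1408 1582 -71 -2969 1933 -638 176 -444 1347 519 160 -108 -19 4 211 36 284" ∷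
   "6469 -111 -77 -366 2210 -2330 2979 -29 -9 -178 404 216 -70 109 -122 75 4 101 -38 223" ∷ []) ∷
  ("1760" ∷ "282 181" ∷ "-1786 25 576" ∷ "-2439 -34 792 477" ∷ []) ∷
  []

positive-squares₂ : List (List String)
positive-squares₂ =
  ("3658" ∷ "658 2151" ∷ "-187 -1862 1235" ∷ "-1110 -1164 -1807 452" ∷ "-467 -605 679 -1368 6476" ∷ "-651 -3052 2523 -2621 -3535 4593" ∷
   "930 852 1748 -2256 -3036 784 337" ∷ "-1249 -250 1184 2584 -6400 1559 51 619" ∷ "-857 595 -2571 -3325 657 -2501 1131 -967 751" ∷
   "786 4468 -4609 1599 -405 110 -425 605 -185 390" ∷ "3094 149 -358 -345 -1246 -51 84 1 8 28 151" ∷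
   "-1490 2046 1003 -590 541 175 -58 55 -24 -11 -120 37" ∷ "716 1565 1232 -2127 1521 -2114 460 -543 140 -146 25 -25 388" ∷
   "-443 2982 694 860 55 3259 -709 1088 -406 309 -174 146 -51 415" ∷ "3721 281 -1857 982 2884 -4206 -318 -814 -57 -121 129 -76 -32 -210 303" ∷
   "-940 -780 4132 4413 -1716 1425 -26 996 -71 -187 -23 175 87 303 -253 295" ∷
   "2520 -32 -3877 -1141 6125 -1866 -230 -378 -66 148 107 -31 12 32 -7 -27 121" ∷
   "-1587 -2380 884 1839 -361 -937 150 -279 182 -144 -12 -48 -29 -54 44 16 -99 169" ∷
   "-1206 -984 1126 -3451 8683 -3495 357 -1161 145 -219 -123 -39 29 -60 -17 37 -47 -3 111" ∷
   "-1564 -7169 -1 1860 954 822 -218 -283 147 -117 63 -33 -75 -82 52 -35 -142 63 -107 126" ∷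
   "649 -311 503 -264 -1539 103 295 25 70 -52 63 32 24 87 -49 93 33 43 33 0 315" ∷
   "1091 3630 -836 1497 -3007 371 -124 442 -67 88 33 9 19 15 11 -13 99 -17 -2 -81 5 110" ∷
   "2392 -1553 -2325 -2689 2979 -1222 119 -677 76 -3 136 -40 -26 -81 50 -52 -37 32 -24 27 1 -2 53" ∷
   "-808 2691 -1260 -1284 892 -605 -15 -136 -19 37 -43 9 63 15 0 23 78 -2 28 -84 9 22 -6 127" ∷
   "911 -1572 1647 526 3135 -221 -318 20 -156 -55 10 31 -43 -118 -40 41 -49 -116 -41 8 -96 -12 -38 -34 272" ∷
   "-2879 -3693 437 327 -3920 1596 -107 -319 84 33 -95 -178 -177 -341 251 -296 -123 -11 -22 119 -28 -76 -41 -103 -6 160" ∷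
   "2722 1173 -2011 -1125 2043 327 -286 223 -175 184 89 49 19 96 -47 10 96 -47 -46 -27 6 5 -6 1 6 -20 51" ∷
   "-2308 439 1215 893 -644 -51 54 126 10 -48 -122 2 3 3 -5 12 -12 -6 33 -9 -4 -5 -8 -12 -4 1 -17 17" ∷ []) ∷
  ("4375" ∷ "3528 3441" ∷ "4571 -597 4495" ∷ "-1774 3827 6015 2080" ∷ "1051 -885 1725 -73 768" ∷ "-1913 2303 449 1042 -34 318" ∷
   "2530 -1253 1213 -569 63 -209 228" ∷ "1148 4243 794 830 -150 59 109 294" ∷ "1436 -882 1324 -347 37 -162 184 -33 301" ∷
   "-3004 -290 140 768 113 269 -156 -217 -4 321" ∷ "950 2358 1065 519 -53 59 71 124 -3 -57 78" ∷ "-2466 5260 848 1787 -105 349 -126 126 -5 9 40 74" ∷ []) ∷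
  ("2783" ∷ "-410 2232" ∷ "-441 2680 623" ∷ "-677 182 -1913 1556" ∷ "360 -1442 1712 405 737" ∷ "1183 -1542 -1039 2807 132 463" ∷
   "2118 218 3409 -3116 358 -438 390" ∷ "1169 989 195 -2956 -160 -483 60 261" ∷ "-2248 -3731 -2473 -2199 327 -823 512 407 454" ∷
   "2234 -1595 59 1060 238 159 41 -151 48 216" ∷ "3505 282 3085 -1952 178 -164 194 -58 -47 -28 97" ∷
   "2587 191 1673 -753 81 -43 87 -60 -37 -29 57 34" ∷ []) ∷
  ("6067" ∷ "4650 5572" ∷ "11261 15 2356" ∷ "4145 8223 289 1469" ∷ "-1452 2578 -773 805 886" ∷ "1064 429 1783 717 -78 367" ∷
   "2051 3739 -2376 787 750 -526 565" ∷ "-347 6381 70 1109 -197 115 -138 104" ∷ "-4746 3413 1705 1769 -1233 481 -320 171 666" ∷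
   "-1144 -1230 -641 1506 264 -342 458 93 525 459" ∷ "2451 2984 -2022 1486 619 -636 628 49 322 255 109" ∷
   "1337 6067 -2145 1818 633 -513 575 57 210 154 56 46" ∷ []) ∷
  []

positive-squares₃ : List (List String)
positive-squares₃ =
  ("4397" ∷ "-367 3277" ∷ "-1439 -1987 3521" ∷ "-848 -4070 -3342 3049" ∷ "-928 265 -1419 1758 358" ∷ "-1432 7 -368 719 -738 2796" ∷
   "-224 -1061 2243 -868 -432 1311 267" ∷ "-672 5514 711 764 -101 313 -32 416" ∷ "-832 -2347 267 199 297 -497 -33 -242 216" ∷
   "-581 948 -881 898 183 -587 -26 -31 33 87" ∷ "3223 1244 1972 -5088 -110 330 6 -130 12 32 77" ∷
   "73 3941 1655 -2210 -170 704 -51 209 -9 28 -31 119" ∷ "2613 -4296 -3120 -2498 839 -2354 -14 -608 133 121 68 -4 156" ∷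
   "2495 486 -4332 -408 -223 680 14 77 -41 -57 -3 1 -14 25" ∷ "-2931 -584 4081 1895 -486 1139 11 272 -72 -49 -27 6 -82 -23 59" ∷
   "-1876 -3161 2610 1555 87 -746 39 -81 -34 -33 -23 -24 -56 -31 19 74" ∷ "69 1692 3191 -1712 235 -793 8 -104 25 0 -32 -10 -16 -30 14 31 107" ∷
   "-1139 -332 -1669 1692 -199 990 -26 50 33 26 1 -1 52 0 -5 -72 -8 75" ∷
   "1445 -954 324 -2812 759 -2223 -41 -356 124 135 63 11 112 4 -12 -32 -1 -21 49" ∷
   "1468 3687 -201 -600 87 -494 10 238 -58 -77 -31 0 -45 8 -16 -7 -1 0 -20 16" ∷ []) ∷
  ("6453" ∷ "1213 2569" ∷ "-3349 1000 1496" ∷ "1134 6727 -215 2340" ∷ "-6102 448 1238 379 438" ∷ "3738 -628 -1939 2312 -724 777" ∷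
   "-878 4379 2031 748 1257 -1269 694" ∷ "1716 3647 1732 1675 -718 1107 -1185 833" ∷ "-2461 -5553 -1356 1303 -1967 2429 -1362 463 261" ∷
   "-1355 2909 -197 3131 -1606 2055 -1634 719 148 228" ∷ "-465 243 -1823 -753 -286 224 354 -460 25 -104 97" ∷
   "-1761 1766 1023 1006 -2266 2865 -2688 1168 290 207 -19 133" ∷ "2210 2225 315 -1325 1779 -2087 1931 -779 -241 -305 97 -98 263" ∷
   "2732 849 3683 1030 217 106 -771 963 104 -26 -133 66 0 153" ∷ "3429 -219 -1363 -2041 1341 -1815 1877 -1011 -238 -306 68 -45 179 -2 171" ∷
   "-945 2543 2319 -2907 1820 -2049 1204 -409 -59 -214 29 40 91 16 29 145" ∷ "168 2510 1573 32 1316 -1383 943 -198 -72 -94 9 -35 74 3 15 58 74" ∷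
   "-1213 7874 3410 1082 583 -341 -512 576 68 114 -21 17 43 -5 -4 29 29 71" ∷
   "-1338 180 3106 2096 -1047 1639 -2005 1334 190 217 -126 20 44 3 -3 36 70 -3 83" ∷
   "2181 2965 1637 2873 -819 1198 -1340 972 87 185 -104 -8 16 4 -8 -25 26 15 48 52" ∷ []) ∷
  ("2596" ∷ "568 1265" ∷ "-1610 -2254 322" ∷ "-2922 163 46 156" ∷ []) ∷
  []

positive-squares₄ : List (List String)
positive-squares₄ =
  ("1815" ∷ "-1558 9863" ∷ "1659 -734 250" ∷ "-1297 5112 -49 151" ∷ "664 -1786 42 -29 26" ∷ "-881 -2166 -151 6 -37 101" ∷
   "848 -3129 47 -16 25 41 101" ∷ "-118 2280 34 4 -6 -55 -8 17" ∷ "460 -2818 -16 18 28 10 -13 -26 61" ∷ "-215 -415 -35 18 0 41 6 -11 -7 12" ∷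
   "-236 44 -28 -1 -14 1 0 0 1 -4 7" ∷ []) ∷
  ("6159" ∷ "3527 353" ∷ "1786 578 380" ∷ "5945 -551 -153 73" ∷ "-83 607 171 -64 92" ∷ "4567 200 330 -64 -15 129" ∷
   "-1075 -1223 -823 280 4 -130 124" ∷ "-1969 -54 75 -7 -8 42 2 11" ∷ "-136 883 391 -134 2 53 -16 3 28" ∷ []) ∷
  ("2627" ∷ "3829 234" ∷ "-3027 -142 158" ∷ "36 -37 5 67" ∷ "32 46 29 -58 107" ∷ "-1093 -98 51 106 16 52" ∷ "-1127 -141 68 175 28 53 18" ∷
   "-2537 -197 67 158 14 43 7 31" ∷ []) ∷
  ("884" ∷ "232 37" ∷ "-532 -39 46" ∷ []) ∷
  ("1958" ∷ []) ∷
  []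

positive-pairs : List (List String)
positive-pairs =
  ("" ∷ "5" ∷ "-1 56" ∷ "-2 -16 62" ∷ "5 67 -132 50" ∷ "-2 -57 9 -59 13" ∷ "-2 -15 3 -10 -11 25" ∷ "0 13 24 17 -6 2 18" ∷ "1 9 -55 2 2 -6 -33 4" ∷ []) ∷
  ("192" ∷ "-1139 331" ∷ "-2276 663 6" ∷ []) ∷
  []

positive-triples : List (List String)
positive-triples =
  ("" ∷ "1" ∷ []) ∷
  []

positive-weights : List String
positive-weights =
  "16 23919 18 261 19 18 24 846 28 927 58 366 82 33984 90 21462 114 23832 122 1368 126 81 152 60600 184 10752 208 1560 210 75168 211 552" ∷
  "216 44856 218 156 219 360 220 111918 250 2868 272 97980 274 318 275 38508 280 4608 284 9768 314 120432 336 8334 338 1536 339 4914 344 13242" ∷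
  "346 288 347 28 348 76848 370 56748 378 1236 382 157956 400 219012 402 39966 403 143514 408 14868 412 132960 440 126684 442 93216 443 52926" ∷
  "464 34416 466 89976 467 212856 472 588 474 57888 475 64584 476 133680 496 5508 498 56574 499 60 504 252 506 768 507 13932 508 162660" ∷
  "510 122949 511 43568 528 279 530 31551 531 87 536 1872 540 6945 570 43326 594 1788 602 13092 626 309444 634 1332 638 40170 664 4020 696 3066" ∷
  "720 42498 722 252 723 228 728 123060 730 40182 731 468 732 966 762 20856 784 49092 786 726 787 97692 792 67620 796 612 826 8268 848 37032" ∷
  "850 54456 851 11016 856 26598 858 354 859 308 860 984 882 1464 890 90696 894 98760 912 185466 914 140007 915 146391 920 73752 924 136392" ∷
  "952 176172 954 312 955 186 976 115356 978 161820 979 107304 984 152616 986 159972 987 46980 988 168552 1008 36006 1010 120084 1011 204" ∷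
  "1016 45636 1018 341880 1019 72 1020 155211 1022 290373 1023 227675" ∷ []

blocks : List (List String) → List (List String) → List Block
blocks = zipWith (λ V L → zip (map parse V) (map parse L))

-- One labelling of each isomorphism type of root 3-graph carries the squares; symmetrisation over
-- all relabellings distributes them to the others, which get empty tables here.
byType : (M₀ M₁ M₂ M₃ M₄ : List (List ℤ)) → List Bool → List (List ℤ)
byType M₀ M₁ M₂ M₃ M₄ (false ∷ false ∷ false ∷ false ∷ []) = M₀
byType M₀ M₁ M₂ M₃ M₄ (true ∷ false ∷ false ∷ false ∷ [])  = M₁
byType M₀ M₁ M₂ M₃ M₄ (true ∷ true ∷ false ∷ false ∷ [])   = M₂
byType M₀ M₁ M₂ M₃ M₄ (true ∷ true ∷ true ∷ false ∷ [])    = M₃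
byType M₀ M₁ M₂ M₃ M₄ (true ∷ true ∷ true ∷ true ∷ [])     = M₄
byType M₀ M₁ M₂ M₃ M₄ _                                    = []

squares : (M₀ M₁ M₂ M₃ M₄ N P : List (List String)) → Squares
squares M₀ M₁ M₂ M₃ M₄ N P = mkSquares
  (byType (columns 64 (blocks basis₀ M₀)) (columns 64 (blocks basis₁ M₁)) (columns 64 (blocks basis₂ M₂))
    -- The complete root 3-graph has the same stabiliser as the edgeless one, so both use `basis₀`.
    (columns 64 (blocks basis₃ M₃)) (columns 64 (blocks basis₀ M₄)))
  (columns 16 (blocks basis-pairs N)) (columns 2 (blocks basis-triples P))

K₄⁻-squares F₄₂-squares codegree-squares positive-squares : Squares
-- For 0.315 it suffices to square flags over four roots spanning no edge and flags over two roots.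
K₄⁻-squares = squares K₄⁻-squares₀ [] [] [] [] K₄⁻-pairs []
F₄₂-squares = squares F₄₂-squares₀ F₄₂-squares₁ F₄₂-squares₂ F₄₂-squares₃ F₄₂-squares₄ F₄₂-pairs F₄₂-triples
codegree-squares = squares codegree-squares₀ codegree-squares₁ codegree-squares₂ codegree-squares₃ codegree-squares₄
  codegree-pairs codegree-triples
positive-squares = squares positive-squares₀ positive-squares₁ positive-squares₂ positive-squares₃ positive-squares₄
  positive-pairs positive-triples

codegreeWeights positiveWeights : List ℤ
codegreeWeights = concatMap parse codegree-weights
positiveWeights = concatMap parse positive-weights

-- The finite checks, by evaluation

abstract

  covering₄₂ : Covering F42
  covering₄₂ = from-yes (covering? F42)

  covering₃₃ : Covering F33
  covering₃₃ = from-yes (covering? F33)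

  K₄⁻-checked : check K₄⁻ (outer shape₁₃₂) (K₄⁻-terms K₄⁻-squares) ≡ true
  K₄⁻-checked = refl

  F₄₂-checked : check F42 (outer shape₁₃₂) (F₄₂-terms F₄₂-squares) ≡ true
  F₄₂-checked = refl

  -- 10^11 is a generous bound on the weights; its size affects only the threshold G p.
  codegree-bounded : boundedWeights codegreeWeights 100000000000 ≡ true
  codegree-bounded = refl

  codegree-checked : check F42 (outer shape₁₃₂) (codegreeTerms 23896254 codegreeWeights 4185 10000 codegree-squares) ≡ true
  codegree-checked = refl

  positive-covered : coveredWeights positiveWeights 100000000000 ≡ true
  positive-covered = refl

  positive-checked : check F33 (outer shape₀) (positiveTerms 4339 positiveWeights 616 1000 positive-squares) ≡ true
  positive-checked = refl

theorem2p6 : TuranDensity≤ F42 4933327 10000000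
    × CodegreeDensity≤ F42 4185 10000
    × PosCodegreeDensity≤ F33 616 1000
theorem2p6 =
  turanDensity F42 4933327 9999999 (λ H free → F₄₂-bound K₄⁻-squares F₄₂-squares K₄⁻-checked F₄₂-checked H
    (free⇒avoids F42 covering₄₂ H free)) ,
  codegreeDensity 23896254 100000000000 4185 10000 codegreeWeights codegree-squares codegree-bounded
    F42 (outer shape₁₃₂) covering₄₂ codegree-checked ,
  posCodegreeDensity 4339 100000000000 616 1000 positiveWeights positive-squares positive-covered
    F33 (outer shape₀) covering₃₃ positive-checked
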